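{- Let $X$ be a finite nonempty set and suppose that $\mathcal N$ is a phylogenetic network on $X$ that displays two forests $\mathcal F$ and $\mathcal F'$ on $X$. Then there is a cherry picking sequence $\sigma$ for $\mathcal F$ and $\mathcal F'$ with $r(\mathcal N)\ge w(\sigma)$.
   Context: All graphs are finite multigraphs without loops. A leaf is a vertex of degree at most one. Suppressing a degree-two vertex $v$ with incident edges $\{u,v\},\{v,w\}$, $u\neq w$, means deleting $v$ and these edges and adding $\{u,w\}$. A phylogenetic network on a finite nonempty set $X$ is a simple connected graph $\mathcal N=(V,E)$ whose set of leaves is exactly $X$ and in which every non-leaf vertex has degree three; if $X=\{x\}$ the single vertex $x$ is a phylogenetic network. $r(\mathcal N)=|E|-(|V|-1)$. A phylogenetic tree on $X$ is a phylogenetic network on $X$ with no cycles. A forest on $X$ is a set of phylogenetic trees whose leaf sets are pairwise disjoint with union $X$. A phylogenetic tree $\mathcal T$ on $Y\subseteq X$ is displayed by $\mathcal N$ if $\mathcal T$ can be obtained from some subtree $\mathcal N[\mathcal T]$ of $\mathcal N$ by suppressing all its degree-two vertices; $\mathcal N$ displays a forest $\mathcal F$ on $X$ if every tree of $\mathcal F$ is displayed by $\mathcal N$ with the subtrees $\mathcal N[\mathcal T]$, $\mathcal T\in\mathcal F$, chosen pairwise vertex-disjoint. Forest notions: a cherry of a phylogenetic tree $\mathcal T$ is a pair $(x,y)$ of distinct leaves such that either $\mathcal T$ is the single edge $\{x,y\}$ or $x,y$ are adjacent to a common vertex; a cherry of a forest is a cherry of one of its trees. For a leaf $x$, $e_x$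 denotes the edge containing $x$. A phylogenetic tree $\mathcal S$ is a proper pendant subtree of a tree $\mathcal T$ if there is a cut-edge $e$ of $\mathcal T$ such that $\mathcal S$ equals one of the two components obtained by deleting $e$ and suppressing degree-two vertices; this edge is $e_{\mathcal S}$ (for $\mathcal S$ a single leaf $p$, $e_{\mathcal S}=e_p$). $((x,y),p)$ denotes a proper pendant subtree with leaf set $\{x,y,p\}$ in which $(x,y)$ is a cherry, and $((x,y),(p,q))$ one with leaf set $\{x,y,p,q\}$ in which $(x,y)$ and $(p,q)$ are cherries; $(p,q)$ also denotes the two-leaf pendant subtree on $\{p,q\}$. For an edge $e$ of a tree $\mathcal T_e$ in a forest $\mathcal F$, $\mathcal F-e$ replaces $\mathcal T_e$ by the trees obtained from $\mathcal T_e$ by deleting $e$ and suppressing degree-two vertices. For $x\in X$, $|X|\ge2$, with $\mathcal T_x$ the tree containing $x$, $\mathcal F-x$ removes $\mathcal T_x$ if it is the single vertex $x$ and otherwise replaces $\mathcal T_x$ by the tree obtained by deleting $x$ and $e_x$ and suppressing the resulting degree-two vertex. Cherry picking sequence: for forests $\mathcal F,\mathcal F'$ on $X$, a sequence $\sigma=(x_1,\dots,x_m)$ of elements of $X$, $m\ge|X|\ge1$, is a cherry picking sequence for $\mathcal F$ and $\mathcal F'$ if there are forests $\mathcal F[i],\mathcal F'[i]$, $1\le i\le m$, with $\mathcal F[1]=\mathcal F$, $\mathcal F'[1]=\mathcal F'$, $\mathcal F[m]=\mathcal F'[m]=\{x_m\}$, and for each $1\le i\le m-1$ precisely one of: (C1)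 $(x_i,y)$ is a cherry in both $\mathcal F[i]$ and $\mathcal F'[i]$ for some $y$, and $\mathcal F[i+1]=\mathcal F[i]-x_i$, $\mathcal F'[i+1]=\mathcal F'[i]-x_i$; (C2) $(x_i,y)$ is a cherry in $\mathcal F[i]$ for some $y$ and one of: (a) $(x_i,z)$ is a cherry in $\mathcal F'[i]$ with $z\ne y$, $\mathcal F'[i+1]=\mathcal F'[i]$, and either (i) $\mathcal F[i+1]$ is $\mathcal F[i]-e_{x_i}$ or $\mathcal F[i]-e_y$, or (ii) $((x_i,y),p)$ is a proper pendant subtree of a tree in $\mathcal F[i]$, $p\in X$, and $\mathcal F[i+1]=\mathcal F[i]-e_{\mathcal S}$ for some $\mathcal S\in\{p,((x_i,y),p)\}$, or (iii) $((x_i,y),(p,q))$ is a proper pendant subtree of a tree in $\mathcal F[i]$, $p\ne q\in X$, and $\mathcal F[i+1]=\mathcal F[i]-e_{\mathcal S}$ for some $\mathcal S\in\{p,q,(p,q)\}$; (b) $x_i,y$ are leaves of one tree $\mathcal T'\in\mathcal F'[i]$, neither in a cherry of $\mathcal T'$, and either (i) $\mathcal F'[i+1]=\mathcal F'[i]$ and $\mathcal F[i+1]$ is $\mathcal F[i]-e_{x_i}$ or $\mathcal F[i]-e_y$, or (ii) for $e$ the edge of $\mathcal T'$ containing the vertex adjacent to $x_i$ and not on the path between $x_i$ and $y$, $\mathcal F'[i+1]=\mathcal F'[i]-e$ and $\mathcal F[i+1]=\mathcal F[i]$; (c) $x_i,y$ lie in different trees of $\mathcal F'[i]$, neither is an isolated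 vertex or in a cherry of $\mathcal F'[i]$, $\mathcal F'[i+1]=\mathcal F'[i]$, and $\mathcal F[i+1]$ is $\mathcal F[i]-e_{x_i}$ or $\mathcal F[i]-e_y$; or the same with the roles of $\mathcal F$ and $\mathcal F'$ reversed; (C3) $x_i$ is a single-vertex component of $\mathcal F[i]$, $\mathcal F[i+1]=\mathcal F[i]-x_i$ and $\mathcal F'[i+1]=\mathcal F'[i]-x_i$, or the same with the roles of $\mathcal F$ and $\mathcal F'$ reversed. Weight: if $m\ge2$, $c(x_i)=0$ if (C1) or (C3) applies at step $i$ and $c(x_i)=1$ otherwise, and $w(\sigma)=\sum_{i=1}^{m-1}c(x_i)$; if $m=1$, $w(\sigma)=0$. -}

module Defs where

open import Data.Nat using (ℕ; zero; suc; _+_; _≤_)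
open import Data.Nat.Properties using () renaming (_≟_ to _≟ℕ_)
open import Data.Fin using (Fin) renaming (_≟_ to _≟F_)
open import Data.Sum using (_⊎_; inj₁; inj₂)
open import Data.Sum.Properties using (≡-dec)
open import Data.Product using (Σ; ∃; ∃-syntax; _×_; _,_)
open import Data.List using (List; []; _∷_; [_]; _++_; length; map)
open import Data.Nat.ListAction using (sum)
open import Data.List.Membership.Propositional using (_∈_; _∉_)
open import Data.List.Relation.Unary.All using (All)
open import Data.List.Relation.Unary.Unique.Propositional using (Unique)
open import Data.Unit using (⊤)
open import Data.Bool using (Bool; true; false; if_then_else_; _∨_; _∧_)
open import Data.Integer using (ℤ; +_; _-_)
open import Relation.Nullary using (¬_; ⌊_⌋)
open import Relation.Binary.PropositionalEquality using (_≡_; _≢_)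
open import Relation.Binary.Definitions using (DecidableEquality)
open import Relation.Binary.Construct.Closure.ReflexiveTransitive using (Star)
open import Function.Bundles using (_⇔_)

-- Conventions.
-- The finite nonempty set X is Fin (suc k).  All graphs (networks and
-- forests) live on the vertex universe  V k = X ⊎ ℕ : the vertex
-- inj₁ x *is* the leaf labelled x, vertices inj₂ n are unlabelled.
-- A (finite, loopless) multigraph is a duplicate-free list of vertices
-- together with a list of edges (an edge (u , v) stands for the
-- unordered pair {u,v}; parallel edges = repeated entries).
-- A forest on X (a set of phylogenetic trees with disjoint leaf sets)
-- is represented by a single graph, namely the disjoint union of its
-- trees; the trees are the connected components.

X : ℕ → Set
X k = Fin (suc k)

V : ℕ → Set
V k = Fin (suc k) ⊎ ℕ

_≟V_ : ∀ {k} → DecidableEquality (V k)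
_≟V_ = ≡-dec _≟F_ _≟ℕ_

ι : ∀ {k} → X k → V k
ι = inj₁

record Graph (k : ℕ) : Set where
  field
    verts : List (V k)
    edges : List (V k × V k)
    verts-unique : Unique verts
    edges-ok : All (λ e → Σ.proj₁ e ∈ verts × Σ.proj₂ e ∈ verts × Σ.proj₁ e ≢ Σ.proj₂ e) edges
open Graph public

module _ {k : ℕ} where

  eqb : V k → V k → Bool
  eqb a b = ⌊ a ≟V b ⌋

  ind : V k → V k → V k → V k → ℕ
  ind a b u v = if (eqb a u ∧ eqb b v) ∨ (eqb a v ∧ eqb b u) then 1 else 0

  mult : Graph k → V k → V k → ℕ
  mult G a b = sum (map (λ e → ind a b (Σ.proj₁ e) (Σ.proj₂ e)) (edges G))

  -- degree (no loops, so each incident edge counts once)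
  deg : Graph k → V k → ℕ
  deg G a = sum (map (λ e → if eqb a (Σ.proj₁ e) ∨ eqb a (Σ.proj₂ e) then 1 else 0) (edges G))

  _∈V_ : V k → Graph k → Set
  v ∈V G = v ∈ verts G

  Adj : Graph k → V k → V k → Set
  Adj G a b = 1 ≤ mult G a b

  Leaf : Graph k → V k → Set
  Leaf G v = v ∈V G × deg G v ≤ 1

  Labelled : V k → Set
  Labelled v = ∃[ x ] v ≡ ι x

  _≈G_ : Graph k → Graph k → Set
  G ≈G H = (∀ v → v ∈V G ⇔ v ∈V H) × (∀ a b → mult G a b ≡ mult H a b)

  Simple : Graph k → Set
  Simple G = ∀ a b → mult G a b ≤ 1

  data Reach (G : Graph k) : V k → V k → Set where
    here  : ∀ {v} → v ∈V G → Reach G v v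
    there : ∀ {u w v} → Adj G u w → Reach G w v → Reach G u v

  Connected : Graph k → Set
  Connected G = ∀ u v → u ∈V G → v ∈V G → Reach G u v

  Chain : Graph k → List (V k) → Set
  Chain G (a ∷ b ∷ r) = Adj G a b × Chain G (b ∷ r)
  Chain G _ = ⊤

  Cyclic : Graph k → Set
  Cyclic G = (∃[ a ] ∃[ b ] 2 ≤ mult G a b)
           ⊎ (∃[ v₀ ] ∃[ vs ] 3 ≤ length (v₀ ∷ vs) × Unique (v₀ ∷ vs)
                × Chain G ((v₀ ∷ vs) ++ [ v₀ ]))

  Acyclic : Graph k → Set
  Acyclic G = ¬ Cyclic G

  data Walk (G : Graph k) : V k → V k → List (V k) → Set where
    stop : ∀ {v} → v ∈V G → Walk G v v [ v ]
    step : ∀ {u w v P} → Adj G u w → Walk G w v P → Walk G u v (u ∷ P)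

  Path : Graph k → V k → V k → List (V k) → Set
  Path G a b P = Walk G a b P × Unique P

  data Consec (u t : V k) : List (V k) → Set where
    now  : ∀ {a b r} → (a ≡ u × b ≡ t) ⊎ (a ≡ t × b ≡ u) → Consec u t (a ∷ b ∷ r)
    next : ∀ {a r} → Consec u t r → Consec u t (a ∷ r)

  LeafCondition : Graph k → Set
  LeafCondition G =
    (∀ (x : X k) → ι x ∈V G) ×
    (∀ v → v ∈V G → (Labelled v × deg G v ≤ 1) ⊎ (¬ Labelled v × deg G v ≡ 3))

  PhyloNetwork : Graph k → Set
  PhyloNetwork N = Simple N × Connected N × LeafCondition N

  -- a forest on X: every component is a phylogenetic tree, the leaf sets
  -- partition X
  ForestOn : Graph k → Set
  ForestOn F = Acyclic F × LeafCondition F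

  r : Graph k → ℤ
  r N = + length (edges N) - (+ length (verts N) - + 1)

  -- Graph operations (as relations; results are determined up to ≈G)

  SuppressStep : Graph k → Graph k → Set
  SuppressStep G H = ∃[ v ] ∃[ u ] ∃[ w ]
      v ∈V G × deg G v ≡ 2 × u ≢ w × Adj G u v × Adj G v w
    × (∀ a → a ∈V H ⇔ (a ∈V G × a ≢ v))
    × (∀ a b → mult H a b + ind a b u v + ind a b v w ≡ mult G a b + ind a b u w)

  SuppressAll : Graph k → Graph k → Set
  SuppressAll G H = ∃[ H₁ ] Star SuppressStep G H₁ × H₁ ≈G H
                    × (∀ v → v ∈V H → deg H v ≢ 2)

  DelEdge : Graph k → V k → V k → Graph k → Set
  DelEdge G a b H = Adj G a b × (∀ v → v ∈V H ⇔ v ∈V G)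
                  × (∀ c d → mult H c d + ind c d a b ≡ mult G c d)

  DelVertex : Graph k → V k → Graph k → Set
  DelVertex G v H = v ∈V G × (∀ a → a ∈V H ⇔ (a ∈V G × a ≢ v))
                  × (∀ a b → a ≢ v → b ≢ v → mult H a b ≡ mult G a b)

  MinusEdge : Graph k → V k → V k → Graph k → Set
  MinusEdge F a b H = ∃[ H₀ ] DelEdge F a b H₀ × SuppressAll H₀ H

  MinusLeafEdge : Graph k → X k → Graph k → Set
  MinusLeafEdge F x H = ∃[ w ] Adj F (ι x) w × MinusEdge F (ι x) w H

  MinusLeaf : Graph k → X k → Graph k → Set
  MinusLeaf F x H = ∃[ H₀ ] DelVertex F (ι x) H₀ × SuppressAll H₀ H

  Cherry : Graph k → X k → X k → Set
  Cherry G x y = x ≢ y × Leaf G (ι x) × Leaf G (ι y)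
               × (Adj G (ι x) (ι y) ⊎ (∃[ w ] Adj G (ι x) w × Adj G (ι y) w))

  InCherry : Graph k → X k → Set
  InCherry G x = ∃[ z ] Cherry G x z

  Isolated : Graph k → X k → Set
  Isolated G x = ι x ∈V G × deg G (ι x) ≡ 0

  CompLeaves : Graph k → X k → List (X k) → Set
  CompLeaves G c L = ∀ l → Reach G (ι c) (ι l) ⇔ l ∈ L

  -- {a,b} is the edge e_S of a proper pendant subtree S of the tree of F
  -- containing c ∈ ℓ(S), where S has leaf set L and S (after deleting e
  -- and suppressing) satisfies P
  PendantEdge : Graph k → X k → List (X k) → (Graph k → Set) → V k → V k → Set
  PendantEdge F c L P a b = Adj F a b × Reach F (ι c) a
    × (∃[ G₁ ] MinusEdge F a b G₁ × CompLeaves G₁ c L × P G₁)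

  -- ((x,y),p) is a proper pendant subtree, with edge {a,b}
  Pendant3 : Graph k → X k → X k → X k → V k → V k → Set
  Pendant3 F x y p a b = p ≢ x × p ≢ y
    × PendantEdge F x (x ∷ y ∷ p ∷ []) (λ G₁ → Cherry G₁ x y) a b

  -- ((x,y),(p,q)) is a proper pendant subtree, with edge {a,b}
  Pendant4 : Graph k → X k → X k → X k → X k → V k → V k → Set
  Pendant4 F x y p q a b = p ≢ x × p ≢ y × q ≢ x × q ≢ y × p ≢ q
    × PendantEdge F x (x ∷ y ∷ p ∷ q ∷ []) (λ G₁ → Cherry G₁ x y × Cherry G₁ p q) a b

  Pendant2 : Graph k → X k → X k → V k → V k → Set
  Pendant2 F p q a b = PendantEdge F p (p ∷ q ∷ []) (λ G₁ → Cherry G₁ p q) a b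

  -- Cherry picking steps  (F, F') ↦ (G, G')  picking x

  C1 : X k → Graph k → Graph k → Graph k → Graph k → Set
  C1 x F F' G G' = (∃[ y ] Cherry F x y × Cherry F' x y)
                 × MinusLeaf F x G × MinusLeaf F' x G'

  C3 : X k → Graph k → Graph k → Graph k → Graph k → Set
  C3 x F F' G G' = (Isolated F x ⊎ Isolated F' x)
                 × MinusLeaf F x G × MinusLeaf F' x G'

  C2-one : X k → Graph k → Graph k → Graph k → Graph k → Set
  C2-one x F F' G G' = ∃[ y ] Cherry F x y × (caseA y ⊎ caseB y ⊎ caseC y)
    where
    cutxy : X k → Set
    cutxy y = MinusLeafEdge F x G ⊎ MinusLeafEdge F y G

    caseA : X k → Set
    caseA y = (∃[ z ] Cherry F' x z × z ≢ y) × G' ≈G F'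
      × ( cutxy y
        ⊎ (∃[ p ] ∃[ a ] ∃[ b ] Pendant3 F x y p a b
             × (MinusLeafEdge F p G ⊎ MinusEdge F a b G))
        ⊎ (∃[ p ] ∃[ q ] ∃[ a ] ∃[ b ] Pendant4 F x y p q a b
             × (MinusLeafEdge F p G ⊎ MinusLeafEdge F q G
               ⊎ (∃[ c ] ∃[ d ] Pendant2 F p q c d × MinusEdge F c d G))))

    caseB : X k → Set
    caseB y = Leaf F' (ι x) × Leaf F' (ι y) × Reach F' (ι x) (ι y)
      × ¬ InCherry F' x × ¬ InCherry F' y
      × ( (G' ≈G F' × cutxy y)
        ⊎ (G ≈G F × ∃[ u ] ∃[ t ] Adj F' (ι x) u × Adj F' u t
             × (∀ P → Path F' (ι x) (ι y) P → ¬ Consec u t P)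
             × MinusEdge F' u t G'))

    caseC : X k → Set
    caseC y = ι x ∈V F' × ι y ∈V F' × ¬ Reach F' (ι x) (ι y)
      × deg F' (ι x) ≢ 0 × deg F' (ι y) ≢ 0
      × ¬ InCherry F' x × ¬ InCherry F' y
      × G' ≈G F' × cutxy y

  C2 : X k → Graph k → Graph k → Graph k → Graph k → Set
  C2 x F F' G G' = C2-one x F F' G G' ⊎ C2-one x F' F G' G

  SingleVertex : Graph k → X k → Set
  SingleVertex F x = (∀ v → v ∈V F ⇔ v ≡ ι x) × edges F ≡ []

  data Seq : Graph k → Graph k → List (X k) → ℕ → Set where
    done : ∀ {F F' x} → SingleVertex F x → SingleVertex F' x → Seq F F' [ x ] 0
    c1   : ∀ {F F' G G' x σ w} → C1 x F F' G G' → Seq G G' σ w → Seq F F' (x ∷ σ) w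
    c3   : ∀ {F F' G G' x σ w} → C3 x F F' G G' → Seq G G' σ w → Seq F F' (x ∷ σ) w
    c2   : ∀ {F F' G G' x σ w} → C2 x F F' G G' → Seq G G' σ w → Seq F F' (x ∷ σ) (suc w)

  CherryPickingSeq : Graph k → Graph k → List (X k) → ℕ → Set
  CherryPickingSeq F F' σ w = suc k ≤ length σ × Seq F F' σ w

  Iso : Graph k → Graph k → Set
  Iso G H = Σ (V k → V k) λ f → Σ (V k → V k) λ g →
      (∀ v → v ∈V G → f v ∈V H) × (∀ v → v ∈V H → g v ∈V G)
    × (∀ v → v ∈V G → g (f v) ≡ v) × (∀ v → v ∈V H → f (g v) ≡ v)
    × (∀ (x : X k) → ι x ∈V G → f (ι x) ≡ ι x)
    × (∀ (x : X k) → ι x ∈V H → g (ι x) ≡ ι x)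
    × (∀ a b → a ∈V G → b ∈V G → mult H (f a) (f b) ≡ mult G a b)

  Subgraph : Graph k → Graph k → Set
  Subgraph S N = (∀ v → v ∈V S → v ∈V N) × (∀ a b → mult S a b ≤ mult N a b)

  -- N displays F: there are pairwise vertex-disjoint subtrees N[T]
  -- (their union S, an acyclic subgraph of N whose components are the
  -- N[T]) such that suppressing degree-two vertices yields F
  Displays : Graph k → Graph k → Set
  Displays N F = ∃[ S ] Subgraph S N × Acyclic S
               × (∃[ T ] SuppressAll S T × Iso T F)

{-# OPTIONS --safe #-}

-- Let S and S' be the subforests of N displaying F and F', and colour every label by its component
-- in S ∩ S'.  The colour classes span disjoint subtrees of F and of F', and no quartet inside a class
-- is resolved differently by F and F'.  A count over the edges of N gives
--   r(N) ≥ |colours| + |J| - |F| - |F'|,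
-- where J is the join of the partitions of the labels into components of F and of F'.
-- The sequence is built by induction so that  w(σ) + |F| + |F'| ≤ |colours| + |J|.  Steps (C1) and (C3)
-- preserve this.  Cutting an edge that no class crosses increases |F| + |F'| by one and is paid for as
-- long as J does not change.  If J changes, then one side of the cut is a smaller set W of labels that
-- is a union of components of both forests up to a single edge.  In a set W that cannot be made smaller
-- in this way, a cherry of maximal depth that avoids the exceptional edge admits one of the cuts allowed
-- by (C2) along an edge that no class crosses.
--
-- A component of a forest is stored as an edge joining two rooted binary trees, so that rerooting,
-- cutting an edge and deleting a leaf are computations on lists of components.

module Submission where

open import Defs
open import Data.Bool using (Bool; true; false; if_then_else_; _∧_; _∨_; not; _xor_)
open import Data.Bool.Properties using (∨-comm; ∨-assoc)
open import Data.Empty using (⊥; ⊥-elim)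
open import Data.Fin using () renaming (zero to fz)
open import Data.Fin.Properties using () renaming (_≟_ to _≟F_)
import Data.Integer as ℤ
import Data.Integer.Properties as ℤ
import Data.Integer.Tactic.RingSolver as ℤ
open import Data.List using (List; []; _∷_; [_]; _++_; length; map; concatMap; filter; cartesianProduct; allFin)
open import Data.List.Membership.Propositional using (_∈_; _∉_)
open import Data.List.Membership.Propositional.Properties using (∈-++⁺ˡ; ∈-++⁺ʳ; ∈-++⁻; ∈-∃++; ∈-concatMap⁺; ∈-concatMap⁻; ∈-filter⁺; ∈-filter⁻; ∈-cartesianProduct⁺; ∈-cartesianProduct⁻; ∈-map⁺; ∈-map⁻)
import Data.List.Membership.DecPropositional as DecMem
open import Data.List.Properties using (map-++; length-++; ++-identityʳ; length-map; length-tabulate)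
open import Data.List.Relation.Binary.Permutation.Propositional using (_↭_; ↭-refl; ↭-sym; ↭-trans; ↭-reflexive; ↭⇒↭ₛ; prep; swap)
open import Data.List.Relation.Binary.Permutation.Propositional.Properties using (∈-resp-↭; Any-resp-↭; All-resp-↭; ↭-length; shift; shifts; ++⁺ˡ; ++⁺ʳ; ++-comm) renaming (++⁺ to ↭-++)
import Data.List.Relation.Binary.Permutation.Setoid.Properties as PermS
open import Data.List.Relation.Unary.All using (All; []; _∷_)
import Data.List.Relation.Unary.All as All
import Data.List.Relation.Unary.All.Properties as All
open import Data.List.Relation.Unary.AllPairs using ([]; _∷_)
open import Data.List.Relation.Unary.Any using (Any; here; there)
import Data.List.Relation.Unary.Any as Any
open import Data.List.Relation.Unary.Unique.Propositional using (Unique)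
open import Data.List.Relation.Unary.Unique.Propositional.Properties using (Unique[x∷xs]⇒x∉xs; allFin⁺; map⁻)
open import Data.Nat using (ℕ; zero; suc; _+_; _≤_; _<_; _≤?_; z≤n; s≤s; s≤s⁻¹)
open import Data.Nat.ListAction using (sum)
open import Data.Nat.ListAction.Properties using (sum-++)
open import Data.Nat.Properties using (+-comm; +-assoc; +-identityʳ; +-suc; +-cancelˡ-≡; +-cancelʳ-≤; +-mono-≤; +-monoʳ-≤; +-monoˡ-≤; +-mono-<-≤; +-mono-≤-<; ≤-refl; ≤-reflexive; ≤-trans; m≤m+n; m≤n+m; n≤1+n; m≤n⇒∃[o]m+o≡n; module ≤-Reasoning)
open import Data.Nat.Tactic.RingSolver using (solve-∀)
open import Data.Product using (Σ; ∃-syntax; _×_; _,_; proj₁; proj₂)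
open import Data.Product.Properties using () renaming (≡-dec to ×-≡-dec)
open import Data.Sum using (_⊎_; inj₁; inj₂)
open import Data.Sum.Properties using (inj₁-injective)
open import Data.Unit using (tt)
open import Function using (id)
open import Function.Bundles using (mk⇔)
open import Relation.Binary.Construct.Closure.ReflexiveTransitive using (Star; ε; _◅_; _◅◅_)
open import Relation.Binary.Definitions using (DecidableEquality)
open import Relation.Binary.PropositionalEquality using (_≡_; _≢_; refl; sym; trans; cong; cong₂; subst; setoid; module ≡-Reasoning)
open import Relation.Nullary using (¬_; Dec; yes; no; ⌊_⌋)
open import Relation.Nullary.Decidable using (_×-dec_; _⊎-dec_)

pattern at₀ = here refl
pattern at₁ = there at₀
pattern at₂ = there at₁
pattern at₃ = there at₂
pattern at₄ = there at₃
pattern at₅ = there at₄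
pattern at₆ = there at₅

unique-↭ : ∀ {A : Set} {xs ys : List A} → xs ↭ ys → Unique xs → Unique ys
unique-↭ p u = PermS.Unique-resp-↭ (setoid _) (↭⇒↭ₛ p) u

module _ {A : Set} where

  uniqueˡ : ∀ (xs : List A) {ys} → Unique (xs ++ ys) → Unique xs
  uniqueˡ [] u = []
  uniqueˡ (x ∷ xs) (px ∷ u) = All.++⁻ˡ xs px ∷ uniqueˡ xs u

  uniqueʳ : ∀ (xs : List A) {ys} → Unique (xs ++ ys) → Unique ys
  uniqueʳ [] u = u
  uniqueʳ (x ∷ xs) (_ ∷ u) = uniqueʳ xs u

  disjoint : ∀ (xs : List A) {ys v} → Unique (xs ++ ys) → v ∈ xs → v ∈ ys → ⊥
  disjoint (x ∷ xs) (px ∷ u) at₀ q = All.lookup (All.++⁻ʳ xs px) q refl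
  disjoint (x ∷ xs) (px ∷ u) (there p) q = disjoint xs u p q

  remove∈ : ∀ {x : A} {xs} → x ∈ xs → ∃[ ys ] xs ↭ x ∷ ys
  remove∈ x∈ with ∈-∃++ x∈
  ... | ys , zs , refl = ys ++ zs , shift _ ys zs

module _ {k : ℕ} where

  Edges : Set
  Edges = List (V k × V k)

  ΣE : (V k → V k → ℕ) → Edges → ℕ
  ΣE f E = sum (map (λ e → f (proj₁ e) (proj₂ e)) E)

  Sym : (V k → V k → ℕ) → Set
  Sym f = ∀ u v → f u v ≡ f v u

  ΣE-++ : ∀ f (E E' : Edges) → ΣE f (E ++ E') ≡ ΣE f E + ΣE f E'
  ΣE-++ f E E' = trans (cong sum (map-++ _ E E')) (sum-++ (map _ E) _)

  ΣE-zero : ∀ {f} {E : Edges} → All (λ e → f (proj₁ e) (proj₂ e) ≡ 0) E → ΣE f E ≡ 0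
  ΣE-zero [] = refl
  ΣE-zero (p ∷ ps) = cong₂ _+_ p (ΣE-zero ps)

  ΣE-∈ : ∀ {f} {E : Edges} {a b} → (a , b) ∈ E → f a b ≤ ΣE f E
  ΣE-∈ at₀ = m≤m+n _ _
  ΣE-∈ {f} {e ∷ E} (there p) = ≤-trans (ΣE-∈ {f} p) (m≤n+m _ (f (proj₁ e) (proj₂ e)))

  ΣE-pos : ∀ {f} {E : Edges} → 1 ≤ ΣE f E → ∃[ a ] ∃[ b ] (a , b) ∈ E × 1 ≤ f a b
  ΣE-pos {f} {(a , b) ∷ E} p with f a b in eq
  ... | suc n = a , b , at₀ , subst (1 ≤_) (sym eq) (s≤s z≤n)
  ... | zero with ΣE-pos {f} {E} p
  ... | a' , b' , m , q = a' , b' , there m , q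

  eqb-refl : ∀ (a : V k) → eqb a a ≡ true
  eqb-refl a with a ≟V a
  ... | yes _ = refl
  ... | no n = ⊥-elim (n refl)

  eqb-≢ : ∀ {a b : V k} → a ≢ b → eqb a b ≡ false
  eqb-≢ {a} {b} n with a ≟V b
  ... | yes p = ⊥-elim (n p)
  ... | no _ = refl

  eqb-true : ∀ {a b : V k} → eqb a b ≡ true → a ≡ b
  eqb-true {a} {b} e with a ≟V b
  ... | yes p = p
  ... | no _ with () ← e

  Link : V k → V k → V k × V k → Set
  Link a b e = e ≡ (a , b) ⊎ e ≡ (b , a)

  ind-link : ∀ {a b u v : V k} → 1 ≤ ind a b u v → Link a b (u , v)
  ind-link {a} {b} {u} {v} p with a ≟V u | b ≟V v | a ≟V v | b ≟V u
  ... | yes refl | yes refl | _ | _ = inj₁ refl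
  ... | yes refl | no _ | yes refl | yes refl = inj₁ refl
  ... | no _ | _ | yes refl | yes refl = inj₂ refl
  ... | yes refl | no _ | yes refl | no _ with () ← p
  ... | yes refl | no _ | no _ | _ with () ← p
  ... | no _ | _ | yes refl | no _ with () ← p
  ... | no _ | _ | no _ | _ with () ← p

  link-ind : ∀ {a b u v : V k} → Link a b (u , v) → ind a b u v ≡ 1
  link-ind {a} {b} (inj₁ refl) rewrite eqb-refl a | eqb-refl b = refl
  link-ind {a} {b} (inj₂ refl) rewrite eqb-refl a | eqb-refl b with eqb a b ∧ eqb b a
  ... | true = refl
  ... | false = refl

  ind-sym : ∀ (a b : V k) → Sym (ind a b)
  ind-sym a b u v rewrite ∨-comm (eqb a u ∧ eqb b v) (eqb a v ∧ eqb b u) = refl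

  ind-≢₁ : ∀ {a b u v : V k} → a ≢ u → b ≢ u → ind a b u v ≡ 0
  ind-≢₁ {a} {b} {u} {v} p q rewrite eqb-≢ p | eqb-≢ q with eqb a v
  ... | true = refl
  ... | false = refl

  inc : V k → V k → V k → ℕ
  inc a u v = if eqb a u ∨ eqb a v then 1 else 0

  inc-sym : ∀ (a : V k) → Sym (inc a)
  inc-sym a u v rewrite ∨-comm (eqb a u) (eqb a v) = refl

  inc-≢ : ∀ {a u v : V k} → a ≢ u → a ≢ v → inc a u v ≡ 0
  inc-≢ p q rewrite eqb-≢ p | eqb-≢ q = refl

-- Forests as lists of components

data Tree (k : ℕ) : Set where
  leaf : X k → Tree k
  node : ℕ → Tree k → Tree k → Tree k

-- "join s t" is the unrooted tree obtained by connecting the roots of s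
-- and t by an edge; "tree t" is t itself, whose root may have degree two.
data Comp (k : ℕ) : Set where
  tree : Tree k → Comp k
  join : Tree k → Tree k → Comp k

Forest : ℕ → Set
Forest k = List (Comp k)

module _ {k : ℕ} where

  data Proper : Comp k → Set where
    iso : ∀ {x} → Proper (tree (leaf x))
    jn  : ∀ {s t} → Proper (join s t)

  rt : Tree k → V k
  rt (leaf x) = ι x
  rt (node v l r) = inj₂ v

  vsT : Tree k → List (V k)
  vsT (leaf x) = [ ι x ]
  vsT (node v l r) = inj₂ v ∷ vsT l ++ vsT r

  esT : Tree k → Edges {k}
  esT (leaf x) = []
  esT (node v l r) = (inj₂ v , rt l) ∷ (inj₂ v , rt r) ∷ esT l ++ esT r

  vsC : Comp k → List (V k)
  vsC (tree t) = vsT t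
  vsC (join s t) = vsT s ++ vsT t

  esC : Comp k → Edges {k}
  esC (tree t) = esT t
  esC (join s t) = (rt s , rt t) ∷ esT s ++ esT t

  vs : Forest k → List (V k)
  vs = concatMap vsC

  es : Forest k → Edges {k}
  es = concatMap esC

  record Distinct (φ : Forest k) : Set where
    constructor distinct
    field un : Unique (vs φ)

  open Distinct public

  -- the component left of a tree once its root is suppressed
  ⟨_⟩ : Tree k → Comp k
  ⟨ leaf x ⟩ = tree (leaf x)
  ⟨ node v l r ⟩ = join l r

  rt∈ : ∀ t → rt t ∈ vsT t
  rt∈ (leaf x) = at₀
  rt∈ (node v l r) = at₀

  label : Tree k → X k
  label (leaf x) = x
  label (node v l r) = label l

  label∈ : ∀ t → ι (label t) ∈ vsT t
  label∈ (leaf x) = at₀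
  label∈ (node v l r) = there (∈-++⁺ˡ (label∈ l))

  Within : List (V k) → V k × V k → Set
  Within xs e = proj₁ e ∈ xs × proj₂ e ∈ xs

  within-⊆ : ∀ {xs ys E} → (∀ {v} → v ∈ xs → v ∈ ys) → All (Within xs) E → All (Within ys) E
  within-⊆ f = All.map (λ { (p , q) → f p , f q })

  esT-within : ∀ t → All (Within (vsT t)) (esT t)
  esT-within (leaf x) = []
  esT-within (node v l r) = (at₀ , there (∈-++⁺ˡ (rt∈ l))) ∷ (at₀ , there (∈-++⁺ʳ (vsT l) (rt∈ r)))
    ∷ All.++⁺ (within-⊆ (λ p → there (∈-++⁺ˡ p)) (esT-within l)) (within-⊆ (λ p → there (∈-++⁺ʳ (vsT l) p)) (esT-within r))

  esC-within : ∀ c → All (Within (vsC c)) (esC c)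
  esC-within (tree t) = esT-within t
  esC-within (join s t) = (∈-++⁺ˡ (rt∈ s) , ∈-++⁺ʳ (vsT s) (rt∈ t))
    ∷ All.++⁺ (within-⊆ ∈-++⁺ˡ (esT-within s)) (within-⊆ (∈-++⁺ʳ (vsT s)) (esT-within t))

  es-within : ∀ φ → All (Within (vs φ)) (es φ)
  es-within [] = []
  es-within (c ∷ φ) = All.++⁺ (within-⊆ ∈-++⁺ˡ (esC-within c)) (within-⊆ (∈-++⁺ʳ (vsC c)) (es-within φ))

  Loopless : V k × V k → Set
  Loopless e = proj₁ e ≢ proj₂ e

  ∉-≢ : ∀ {a b : V k} {xs} → a ∉ xs → b ∈ xs → a ≢ b
  ∉-≢ n m refl = n m

  esT-loopless : ∀ t → Unique (vsT t) → All Loopless (esT t)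
  esT-loopless (leaf x) u = []
  esT-loopless (node v l r) (n ∷ u) = ∉-≢ nv (∈-++⁺ˡ (rt∈ l)) ∷ ∉-≢ nv (∈-++⁺ʳ (vsT l) (rt∈ r))
      ∷ All.++⁺ (esT-loopless l (uniqueˡ (vsT l) u)) (esT-loopless r (uniqueʳ (vsT l) u))
    where
    nv : inj₂ v ∉ (vsT l ++ vsT r)
    nv = Unique[x∷xs]⇒x∉xs (n ∷ u)

  esC-loopless : ∀ c → Unique (vsC c) → All Loopless (esC c)
  esC-loopless (tree t) u = esT-loopless t u
  esC-loopless (join s t) u = (λ e → disjoint (vsT s) u (rt∈ s) (subst (_∈ vsT t) (sym e) (rt∈ t)))
    ∷ All.++⁺ (esT-loopless s (uniqueˡ (vsT s) u)) (esT-loopless t (uniqueʳ (vsT s) u))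

  es-loopless : ∀ φ → Unique (vs φ) → All Loopless (es φ)
  es-loopless [] u = []
  es-loopless (c ∷ φ) u = All.++⁺ (esC-loopless c (uniqueˡ (vsC c) u)) (es-loopless φ (uniqueʳ (vsC c) u))

  ⟦_⟧ : (φ : Forest k) → Distinct φ → Graph k
  ⟦ φ ⟧ u = record
    { verts = vs φ ; edges = es φ ; verts-unique = un u
    ; edges-ok = All.zipWith (λ { ((p , q) , n) → p , q , n }) (es-within φ , es-loopless φ (un u)) }

  record Rep (F : Graph k) (φ : Forest k) : Set where
    field
      vF : ∀ {v} → v ∈V F → v ∈ vs φ
      vφ : ∀ {v} → v ∈ vs φ → v ∈V F
      sums : ∀ f → Sym f → ΣE f (edges F) ≡ ΣE f (es φ)

  open Rep public

  rep-⟦⟧ : ∀ φ u → Rep (⟦ φ ⟧ u) φ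
  rep-⟦⟧ φ u = record { vF = id ; vφ = id ; sums = λ _ _ → refl }

  infix 4 _⊑_ _⊑C_

  data _⊑_ (u : Tree k) : Tree k → Set where
    self : u ⊑ u
    inl  : ∀ {v l r} → u ⊑ l → u ⊑ node v l r
    inr  : ∀ {v l r} → u ⊑ r → u ⊑ node v l r

  data _⊑C_ (u : Tree k) : Comp k → Set where
    left  : ∀ {s t} → u ⊑ s → u ⊑C join s t
    right : ∀ {s t} → u ⊑ t → u ⊑C join s t

  ⊑-vs : ∀ {u t} → u ⊑ t → ∀ {v} → v ∈ vsT u → v ∈ vsT t
  ⊑-vs self p = p
  ⊑-vs (inl s) p = there (∈-++⁺ˡ (⊑-vs s p))
  ⊑-vs (inr {l = l} s) p = there (∈-++⁺ʳ (vsT l) (⊑-vs s p))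

  Side : Comp k → Tree k → (a b p q : V k) → Set
  Side c u a b p q = (a ∈ vsT u × b ∈ vsT u) × (p ∈ vsC c × p ∉ vsT u) × (q ∈ vsC c × q ∉ vsT u)

  -- some edge of the component separates {a,b} from {p,q}
  ConfC : Comp k → (a b p q : V k) → Set
  ConfC c a b p q = ∃[ u ] u ⊑C c × (Side c u a b p q ⊎ Side c u p q a b)

  SameC : Comp k → (a b : V k) → Set
  SameC c a b = a ∈ vsC c × b ∈ vsC c

  Same : Forest k → (a b : V k) → Set
  Same φ a b = Any (λ c → SameC c a b) φ

  Conf : Forest k → (a b p q : V k) → Set
  Conf φ a b p q = Any (λ c → ConfC c a b p q) φ

  infix 4 _≃C_ _≃_

  record _≃C_ (c c' : Comp k) : Set where
    field
      ve   : vsC c ↭ vsC c'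
      sumC : ∀ f → Sym f → ΣE f (esC c) ≡ ΣE f (esC c')
      prop : Proper c → Proper c'
      conf : Unique (vsC c) → ∀ {a b p q} → (ConfC c a b p q → ConfC c' a b p q) × (ConfC c' a b p q → ConfC c a b p q)

  open _≃C_ public

  ≃C-trans : ∀ {c c' c''} → c ≃C c' → c' ≃C c'' → c ≃C c''
  ≃C-trans p q = record
    { ve = ↭-trans (ve p) (ve q)
    ; sumC = λ f s → trans (sumC p f s) (sumC q f s)
    ; prop = λ x → prop q (prop p x)
    ; conf = λ u → (λ x → proj₁ (conf q (unique-↭ (ve p) u)) (proj₁ (conf p u) x))
                 , (λ x → proj₂ (conf p u) (proj₂ (conf q (unique-↭ (ve p) u)) x)) }

  side-⊆ : ∀ {c c' u u' a b p q} → (∀ {v} → v ∈ vsC c → v ∈ vsC c') → (∀ {v} → v ∈ vsT u → v ∈ vsT u')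
    → (∀ {v} → v ∈ vsT u' → v ∈ vsT u) → Side c u a b p q → Side c' u' a b p q
  side-⊆ f g h ((a , b) , (p , np) , (q , nq)) = (g a , g b) , (f p , (λ x → np (h x))) , (f q , (λ x → nq (h x)))

  -- the same edge seen from its other end
  side-co : ∀ {c c' u u' a b p q} → (∀ {v} → v ∈ vsC c → v ∈ vsC c') → (∀ {v} → v ∈ vsT u → v ∈ vsC c)
    → (∀ {v} → v ∈ vsC c → v ∉ vsT u → v ∈ vsT u') → (∀ {v} → v ∈ vsT u → v ∉ vsT u')
    → Side c u a b p q → Side c' u' p q a b
  side-co f i g d ((a , b) , (p , np) , (q , nq)) = (g p np , g q nq) , (f (i a) , d a) , (f (i b) , d b)

  conf-keep : ∀ {c c' u u' a b p q} → u' ⊑C c' → (∀ {v} → v ∈ vsC c → v ∈ vsC c') → (∀ {v} → v ∈ vsT u → v ∈ vsT u')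
    → (∀ {v} → v ∈ vsT u' → v ∈ vsT u) → Side c u a b p q ⊎ Side c u p q a b → ConfC c' a b p q
  conf-keep {c} {c'} {u} {u'} s f g h (inj₁ x) = u' , s , inj₁ (side-⊆ {c} {c'} {u} {u'} f g h x)
  conf-keep {c} {c'} {u} {u'} s f g h (inj₂ x) = u' , s , inj₂ (side-⊆ {c} {c'} {u} {u'} f g h x)

  conf-co : ∀ {c c' u u' a b p q} → u' ⊑C c' → (∀ {v} → v ∈ vsC c → v ∈ vsC c') → (∀ {v} → v ∈ vsT u → v ∈ vsC c)
    → (∀ {v} → v ∈ vsC c → v ∉ vsT u → v ∈ vsT u') → (∀ {v} → v ∈ vsT u → v ∉ vsT u')
    → Side c u a b p q ⊎ Side c u p q a b → ConfC c' a b p q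
  conf-co {c} {c'} {u} {u'} s f i g d (inj₁ x) = u' , s , inj₂ (side-co {c} {c'} {u} {u'} f i g d x)
  conf-co {c} {c'} {u} {u'} s f i g d (inj₂ x) = u' , s , inj₁ (side-co {c} {c'} {u} {u'} f i g d x)

  sw : ∀ {s t} → join s t ≃C join t s
  sw {s} {t} = record
    { ve = ++-comm (vsT s) (vsT t)
    ; sumC = λ f sy → cong₂ _+_ (sy (rt s) (rt t)) (trans (ΣE-++ f (esT s) (esT t)) (trans (+-comm (ΣE f (esT s)) _) (sym (ΣE-++ f (esT t) (esT s)))))
    ; prop = λ _ → jn
    ; conf = λ _ → (λ { (u , left p , x) → conf-keep {join s t} (right p) (∈-resp-↭ (++-comm (vsT s) (vsT t))) id id x
                      ; (u , right p , x) → conf-keep {join s t} (left p) (∈-resp-↭ (++-comm (vsT s) (vsT t))) id id x })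
                 , (λ { (u , left p , x) → conf-keep {join t s} (right p) (∈-resp-↭ (++-comm (vsT t) (vsT s))) id id x
                      ; (u , right p , x) → conf-keep {join t s} (left p) (∈-resp-↭ (++-comm (vsT t) (vsT s))) id id x }) }

  fl : ∀ {s v l r} → join s (node v l r) ≃C join s (node v r l)
  fl {s} {v} {l} {r} = record
    { ve = pm l r
    ; sumC = λ f sy → cong (f (rt s) (inj₂ v) +_) (lem f)
    ; prop = λ _ → jn
    ; conf = λ _ → go l r , go r l }
    where
    pm : ∀ l r → vsC (join s (node v l r)) ↭ vsC (join s (node v r l))
    pm l r = ++⁺ˡ (vsT s) (prep _ (++-comm (vsT l) (vsT r)))
    arith : ∀ a b c d e → a + (b + (c + (d + e))) ≡ a + (c + (b + (e + d)))
    arith = solve-∀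
    ex : ∀ f l r → ΣE f (esT s ++ esT (node v l r)) ≡ ΣE f (esT s) + (f (inj₂ v) (rt l) + (f (inj₂ v) (rt r) + (ΣE f (esT l) + ΣE f (esT r))))
    ex f l r = trans (ΣE-++ f (esT s) _) (cong (λ z → ΣE f (esT s) + (f (inj₂ v) (rt l) + (f (inj₂ v) (rt r) + z))) (ΣE-++ f (esT l) (esT r)))
    lem : ∀ f → ΣE f (esT s ++ esT (node v l r)) ≡ ΣE f (esT s ++ esT (node v r l))
    lem f = trans (ex f l r) (trans (arith (ΣE f (esT s)) (f (inj₂ v) (rt l)) (f (inj₂ v) (rt r)) (ΣE f (esT l)) (ΣE f (esT r))) (sym (ex f r l)))
    go : ∀ l r {a b p q} → ConfC (join s (node v l r)) a b p q → ConfC (join s (node v r l)) a b p q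
    go l r (u , left p , x) = conf-keep {join s (node v l r)} (left p) (∈-resp-↭ (pm l r)) id id x
    go l r (u , right self , x) = conf-keep {join s (node v l r)} {u = node v l r} (right self) (∈-resp-↭ (pm l r))
      (∈-resp-↭ (prep _ (++-comm (vsT l) (vsT r)))) (∈-resp-↭ (prep _ (++-comm (vsT r) (vsT l)))) x
    go l r (u , right (inl p) , x) = conf-keep {join s (node v l r)} (right (inr p)) (∈-resp-↭ (pm l r)) id id x
    go l r (u , right (inr p) , x) = conf-keep {join s (node v l r)} (right (inl p)) (∈-resp-↭ (pm l r)) id id x

  mv : ∀ {s v l r} → join s (node v l r) ≃C join (node v s l) r
  mv {s} {v} {l} {r} = record
    { ve = pm
    ; sumC = λ f sy → lem f sy
    ; prop = λ _ → jn
    ; conf = λ u → go u , og u }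
    where
    c c' : Comp k
    c = join s (node v l r)
    c' = join (node v s l) r
    pm : vsC c ↭ vsC c'
    pm = ↭-trans (shift _ (vsT s) (vsT l ++ vsT r)) (prep _ (↭-reflexive (sym (Data.List.Properties.++-assoc (vsT s) (vsT l) (vsT r)))))
    f→ : ∀ {v} → v ∈ vsC c → v ∈ vsC c'
    f→ = ∈-resp-↭ pm
    f← : ∀ {v} → v ∈ vsC c' → v ∈ vsC c
    f← = ∈-resp-↭ (↭-sym pm)
    arith : ∀ a b c d e g → a + (d + (b + (c + (e + g)))) ≡ c + (a + (b + (d + e)) + g)
    arith = solve-∀
    lem : ∀ f → Sym f → ΣE f (esC c) ≡ ΣE f (esC c')
    lem f sy = begin
      f (rt s) (inj₂ v) + ΣE f (esT s ++ esT (node v l r))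
        ≡⟨ cong (f (rt s) (inj₂ v) +_) (trans (ΣE-++ f (esT s) _) (cong (λ z → ΣE f (esT s) + (f (inj₂ v) (rt l) + (f (inj₂ v) (rt r) + z))) (ΣE-++ f (esT l) (esT r)))) ⟩
      f (rt s) (inj₂ v) + (ΣE f (esT s) + (f (inj₂ v) (rt l) + (f (inj₂ v) (rt r) + (ΣE f (esT l) + ΣE f (esT r)))))
        ≡⟨ arith (f (rt s) (inj₂ v)) (f (inj₂ v) (rt l)) (f (inj₂ v) (rt r)) (ΣE f (esT s)) (ΣE f (esT l)) (ΣE f (esT r)) ⟩
      f (inj₂ v) (rt r) + (f (rt s) (inj₂ v) + (f (inj₂ v) (rt l) + (ΣE f (esT s) + ΣE f (esT l))) + ΣE f (esT r))
        ≡⟨ cong (λ z → f (inj₂ v) (rt r) + (z + (f (inj₂ v) (rt l) + (ΣE f (esT s) + ΣE f (esT l))) + ΣE f (esT r))) (sy (rt s) (inj₂ v)) ⟩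
      f (inj₂ v) (rt r) + (f (inj₂ v) (rt s) + (f (inj₂ v) (rt l) + (ΣE f (esT s) + ΣE f (esT l))) + ΣE f (esT r))
        ≡⟨ cong (f (inj₂ v) (rt r) +_) (sym (trans (ΣE-++ f (esT (node v s l)) (esT r)) (cong (λ z → f (inj₂ v) (rt s) + (f (inj₂ v) (rt l) + z) + ΣE f (esT r)) (ΣE-++ f (esT s) (esT l))))) ⟩
      f (inj₂ v) (rt r) + ΣE f (esT (node v s l) ++ esT r) ∎
      where open ≡-Reasoning
    go : Unique (vsC c) → ∀ {a b p q} → ConfC c a b p q → ConfC c' a b p q
    go u (w , left p , x) = conf-keep {c} (left (inl p)) f→ id id x
    go u (w , right self , x) = conf-co {c} {u = node v l r} (left (inl self)) f→ (∈-++⁺ʳ (vsT s))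
      (λ m n → Data.Sum.fromInj₁ (λ z → ⊥-elim (n z)) (∈-++⁻ (vsT s) m)) (λ p q → disjoint (vsT s) u q p) x
    go u (w , right (inl p) , x) = conf-keep {c} (left (inr p)) f→ id id x
    go u (w , right (inr p) , x) = conf-keep {c} (right p) f→ id id x
    og : Unique (vsC c) → ∀ {a b p q} → ConfC c' a b p q → ConfC c a b p q
    og u (w , left self , x) = conf-co {c'} {u = node v s l} (right (inr self)) f← ∈-++⁺ˡ
      (λ m n → Data.Sum.fromInj₂ (λ z → ⊥-elim (n z)) (∈-++⁻ (vsT (node v s l)) m)) (λ p q → disjoint (vsT (node v s l)) (unique-↭ pm u) p q) x
    og u (w , left (inl p) , x) = conf-keep {c'} (left p) f← id id x
    og u (w , left (inr p) , x) = conf-keep {c'} (right (inl p)) f← id id x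
    og u (w , right p , x) = conf-keep {c'} (right (inr p)) f← id id x

  mv' : ∀ {s v l r} → join s (node v l r) ≃C join (node v s r) l
  mv' = ≃C-trans fl mv

  expose : ∀ {u} t → u ⊑ t → ∀ s → ∃[ K ] join s t ≃C join u K × (∀ {v} → v ∈ vsT s → v ∈ vsT K)
  expose t self s = s , sw , id
  expose (node v l r) (inl p) s with expose l p (node v s r)
  ... | K , e , i = K , ≃C-trans mv' e , (λ q → i (there (∈-++⁺ˡ q)))
  expose (node v l r) (inr p) s with expose r p (node v s l)
  ... | K , e , i = K , ≃C-trans mv e , (λ q → i (there (∈-++⁺ˡ q)))

  exposeC : ∀ {u c} → u ⊑C c → ∃[ K ] c ≃C join u K
  exposeC (left {s} {t} p) with expose s p t
  ... | K , e , _ = K , ≃C-trans sw e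
  exposeC (right {s} {t} p) with expose t p s
  ... | K , e , _ = K , e

  record _≃_ (φ ψ : Forest k) : Set where
    field
      vsE   : vs φ ↭ vs ψ
      sumE  : ∀ f → Sym f → ΣE f (es φ) ≡ ΣE f (es ψ)
      lenE  : length φ ≡ length ψ
      propE : All Proper φ → All Proper ψ
      same→ : ∀ {a b} → Same φ a b → Same ψ a b
      same← : ∀ {a b} → Same ψ a b → Same φ a b
      conf→ : ∀ {a b p q} → Conf φ a b p q → Conf ψ a b p q
      conf← : ∀ {a b p q} → Conf ψ a b p q → Conf φ a b p q

  open _≃_ public

  ≃-refl : ∀ {φ} → φ ≃ φ
  ≃-refl = record { vsE = ↭-refl ; sumE = λ _ _ → refl ; lenE = refl ; propE = id ; same→ = id ; same← = id ; conf→ = id ; conf← = id }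

  ≃-trans : ∀ {φ ψ χ} → φ ≃ ψ → ψ ≃ χ → φ ≃ χ
  ≃-trans p q = record { vsE = ↭-trans (vsE p) (vsE q) ; sumE = λ f s → trans (sumE p f s) (sumE q f s) ; lenE = trans (lenE p) (lenE q)
    ; propE = λ x → propE q (propE p x) ; same→ = λ x → same→ q (same→ p x) ; same← = λ x → same← p (same← q x)
    ; conf→ = λ x → conf→ q (conf→ p x) ; conf← = λ x → conf← p (conf← q x) }

  ≃-head : ∀ {c c' φ} → Distinct (c ∷ φ) → c ≃C c' → (c ∷ φ) ≃ (c' ∷ φ)
  ≃-head {c} {c'} {φ} (distinct u) e = record
    { vsE = ++⁺ʳ (vs φ) (ve e)
    ; sumE = λ f s → trans (ΣE-++ f (esC c) (es φ)) (trans (cong (_+ ΣE f (es φ)) (sumC e f s)) (sym (ΣE-++ f (esC c') (es φ))))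
    ; lenE = refl
    ; propE = λ { (p ∷ ps) → prop e p ∷ ps }
    ; same→ = λ { (here (p , q)) → here (∈-resp-↭ (ve e) p , ∈-resp-↭ (ve e) q) ; (there x) → there x }
    ; same← = λ { (here (p , q)) → here (∈-resp-↭ (↭-sym (ve e)) p , ∈-resp-↭ (↭-sym (ve e)) q) ; (there x) → there x }
    ; conf→ = λ { (here x) → here (proj₁ (conf e (uniqueˡ (vsC c) u)) x) ; (there x) → there x }
    ; conf← = λ { (here x) → here (proj₂ (conf e (uniqueˡ (vsC c) u)) x) ; (there x) → there x } }

  concatMap-↭ : ∀ {φ ψ} {B : Set} (g : Comp k → List B) → φ ↭ ψ → concatMap g φ ↭ concatMap g ψ
  concatMap-↭ g _↭_.refl = ↭-refl
  concatMap-↭ g (prep x p) = ++⁺ˡ (g x) (concatMap-↭ g p)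
  concatMap-↭ {φ = _ ∷ _ ∷ φ} g (swap x y p) = ↭-trans (shifts (g x) (g y) {concatMap g φ}) (++⁺ˡ (g y) (++⁺ˡ (g x) (concatMap-↭ g p)))
  concatMap-↭ g (_↭_.trans p q) = ↭-trans (concatMap-↭ g p) (concatMap-↭ g q)

  ΣE-↭ : ∀ f {E E' : Edges {k}} → E ↭ E' → ΣE f E ≡ ΣE f E'
  ΣE-↭ f _↭_.refl = refl
  ΣE-↭ f (prep (a , b) p) = cong (f a b +_) (ΣE-↭ f p)
  ΣE-↭ f {_ ∷ _ ∷ E} {_ ∷ _ ∷ E'} (swap (a , b) (c , d) p) = trans (sym (+-assoc (f a b) (f c d) (ΣE f E)))
    (trans (cong₂ _+_ (+-comm (f a b) (f c d)) (ΣE-↭ f p)) (+-assoc (f c d) (f a b) (ΣE f E')))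
  ΣE-↭ f (_↭_.trans p q) = trans (ΣE-↭ f p) (ΣE-↭ f q)

  ≃-perm : ∀ {φ ψ} → φ ↭ ψ → φ ≃ ψ
  ≃-perm p = record
    { vsE = concatMap-↭ vsC p ; sumE = λ f _ → ΣE-↭ f (concatMap-↭ esC p) ; lenE = ↭-length p ; propE = All-resp-↭ p
    ; same→ = Any-resp-↭ p ; same← = Any-resp-↭ (↭-sym p) ; conf→ = Any-resp-↭ p ; conf← = Any-resp-↭ (↭-sym p) }

  rep-≃ : ∀ {F φ ψ} → φ ≃ ψ → Rep F φ → Rep F ψ
  rep-≃ e r = record { vF = λ p → ∈-resp-↭ (vsE e) (vF r p) ; vφ = λ p → vφ r (∈-resp-↭ (↭-sym (vsE e)) p) ; sums = λ f s → trans (sums r f s) (sumE e f s) }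

  uniq-≃ : ∀ {φ ψ} → φ ≃ ψ → Distinct φ → Distinct ψ
  uniq-≃ e u = distinct (unique-↭ (vsE e) (un u))

  comp-front : ∀ {φ} {a : V k} → a ∈ vs φ → ∃[ c ] ∃[ ψ ] φ ↭ c ∷ ψ × a ∈ vsC c
  comp-front {φ} p with find∈ (∈-concatMap⁻ vsC {xs = φ} p)
    where
    find∈ : ∀ {φ} {a : V k} → Any (λ c → a ∈ vsC c) φ → ∃[ c ] c ∈ φ × a ∈ vsC c
    find∈ (here q) = _ , at₀ , q
    find∈ (there q) with find∈ q
    ... | c , m , x = c , there m , x
  ... | c , m , x with remove∈ m
  ... | ψ , e = c , ψ , e , x

  leaf⊑ : ∀ {x} t → ι x ∈ vsT t → leaf x ⊑ t
  leaf⊑ (leaf y) at₀ = self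
  leaf⊑ (node v l r) (there p) with ∈-++⁻ (vsT l) p
  ... | inj₁ q = inl (leaf⊑ l q)
  ... | inj₂ q = inr (leaf⊑ r q)

  expose-leaf : ∀ {φ x} → Distinct φ → All Proper φ → ι x ∈ vs φ
    → (∃[ ψ ] φ ≃ (tree (leaf x) ∷ ψ)) ⊎ (∃[ t ] ∃[ ψ ] φ ≃ (join (leaf x) t ∷ ψ))
  expose-leaf u pr p with comp-front p
  ... | c , ψ , e , m with All.head (All-resp-↭ e pr)
  expose-leaf u pr p | _ , ψ , e , at₀ | iso = inj₁ (ψ , ≃-perm e)
  expose-leaf {x = x} u pr p | join s t , ψ , e , m | jn with exposeC {leaf x} {join s t} (sub (∈-++⁻ (vsT s) m))
    where
    sub : ι x ∈ vsT s ⊎ ι x ∈ vsT t → leaf x ⊑C join s t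
    sub (inj₁ q) = left (leaf⊑ s q)
    sub (inj₂ q) = right (leaf⊑ t q)
  ... | K , e' = inj₂ (K , ψ , ≃-trans (≃-perm e) (≃-head (uniq-≃ (≃-perm e) u) e'))

module _ {k : ℕ} where

  adj-link : ∀ {F : Graph k} {φ} a b → Rep F φ → Adj F a b → ∃[ u ] ∃[ v ] (u , v) ∈ es φ × Link a b (u , v)
  adj-link a b r p with ΣE-pos {f = ind a b} (subst (1 ≤_) (sums r (ind a b) (ind-sym a b)) p)
  ... | u , v , m , q = u , v , m , ind-link q

  link-adj : ∀ {F : Graph k} {φ a b u v} → Rep F φ → (u , v) ∈ es φ → Link a b (u , v) → Adj F a b
  link-adj {a = a} {b} r m l = subst (1 ≤_) (sym (sums r (ind a b) (ind-sym a b)))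
    (≤-trans (≤-reflexive (sym (link-ind l))) (ΣE-∈ {f = ind a b} m))

  link-sym : ∀ {a b : V k} {e} → Link a b e → Link b a e
  link-sym = Data.Sum.swap

  adj-sym : ∀ {F : Graph k} {φ} a b → Rep F φ → Adj F a b → Adj F b a
  adj-sym a b r p with adj-link a b r p
  ... | u , v , m , l = link-adj r m (link-sym l)

  module _ {F : Graph k} {φ : Forest k} (r : Rep F φ) where

    adj-verts : ∀ a b → Adj F a b → a ∈ vs φ × b ∈ vs φ
    adj-verts a b p with adj-link a b r p
    ... | u , v , m , inj₁ refl = All.lookup (es-within φ) m
    ... | u , v , m , inj₂ refl = let x , y = All.lookup (es-within φ) m in y , x

    reach-trans : ∀ {a b c} → Reach F a b → Reach F b c → Reach F a c
    reach-trans (here _) q = q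
    reach-trans (there p ps) q = there p (reach-trans ps q)

    reach-adj : ∀ a b → Adj F a b → Reach F a b
    reach-adj a b p = there p (here (vφ r (proj₂ (adj-verts a b p))))

    reach-sym : ∀ {a b} → Reach F a b → Reach F b a
    reach-sym (here p) = here p
    reach-sym (there {a} {b} p ps) = reach-trans (reach-sym ps) (reach-adj b a (adj-sym a b r p))

    reachT : ∀ t → (∀ {e} → e ∈ esT t → e ∈ es φ) → (∀ {v} → v ∈ vsT t → v ∈ vs φ) → ∀ {a} → a ∈ vsT t → Reach F a (rt t)
    reachT (leaf x) f g at₀ = here (vφ r (g at₀))
    reachT (node v l r') f g at₀ = here (vφ r (g at₀))
    reachT (node v l r') f g (there p) with ∈-++⁻ (vsT l) p
    ... | inj₁ q = reach-trans (reachT l (λ e → f (there (there (∈-++⁺ˡ e)))) (λ e → g (there (∈-++⁺ˡ e))) q)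
                     (reach-adj _ _ (link-adj r (f at₀) (inj₂ refl)))
    ... | inj₂ q = reach-trans (reachT r' (λ e → f (there (there (∈-++⁺ʳ (esT l) e)))) (λ e → g (there (∈-++⁺ʳ (vsT l) e))) q)
                     (reach-adj _ _ (link-adj r (f at₁) (inj₂ refl)))

    reachC : ∀ c → (∀ {e} → e ∈ esC c → e ∈ es φ) → (∀ {v} → v ∈ vsC c → v ∈ vs φ) → ∀ {a b} → a ∈ vsC c → b ∈ vsC c → Reach F a b
    reachC (tree t) f g p q = reach-trans (reachT t f g p) (reach-sym (reachT t f g q))
    reachC (join s t) f g p q = reach-trans (toS p) (reach-sym (toS q))
      where
      toS : ∀ {a} → a ∈ vsC (join s t) → Reach F a (rt s)
      toS p with ∈-++⁻ (vsT s) p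
      ... | inj₁ m = reachT s (λ e → f (there (∈-++⁺ˡ e))) (λ e → g (∈-++⁺ˡ e)) m
      ... | inj₂ m = reach-trans (reachT t (λ e → f (there (∈-++⁺ʳ (esT s) e))) (λ e → g (∈-++⁺ʳ (vsT s) e)) m)
                       (reach-adj _ _ (link-adj r (f at₀) (inj₂ refl)))

    same-reach : ∀ {a b} → Same φ a b → Reach F a b
    same-reach = go φ id id
      where
      go : ∀ ψ → (∀ {e} → e ∈ es ψ → e ∈ es φ) → (∀ {v} → v ∈ vs ψ → v ∈ vs φ) → ∀ {a b} → Same ψ a b → Reach F a b
      go (c ∷ ψ) f g (here (p , q)) = reachC c (λ e → f (∈-++⁺ˡ e)) (λ e → g (∈-++⁺ˡ e)) p q
      go (c ∷ ψ) f g (there x) = go ψ (λ e → f (∈-++⁺ʳ (esC c) e)) (λ e → g (∈-++⁺ʳ (vsC c) e)) x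

  same-sym : ∀ {φ : Forest k} {a b} → Same φ a b → Same φ b a
  same-sym = Any.map (λ { (p , q) → q , p })

  same∈ : ∀ {φ : Forest k} {a b} → Same φ a b → a ∈ vs φ
  same∈ {φ} s = ∈-concatMap⁺ vsC (Any.map proj₁ s)

  same∈ʳ : ∀ {φ : Forest k} {a b} → Same φ a b → b ∈ vs φ
  same∈ʳ s = same∈ (same-sym s)

  same-refl : ∀ {φ : Forest k} {a} → a ∈ vs φ → Same φ a a
  same-refl {φ} p = Any.map (λ q → q , q) (∈-concatMap⁻ vsC {xs = φ} p)

  same-trans : ∀ {φ : Forest k} {a b c} → Distinct φ → Same φ a b → Same φ b c → Same φ a c
  same-trans u (here (p , q)) (here (p' , q')) = here (p , q')
  same-trans {c ∷ φ} (distinct u) (here (p , q)) (there y) = ⊥-elim (disjoint (vsC c) u q (same∈ y))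
  same-trans {c ∷ φ} (distinct u) (there x) (here (p' , q')) = ⊥-elim (disjoint (vsC c) u p' (same∈ʳ x))
  same-trans {c ∷ φ} u (there x) (there y) = there (same-trans (distinct (uniqueʳ (vsC c) (un u))) x y)

  edge-same : ∀ φ {u v : V k} → (u , v) ∈ es φ → Same φ u v
  edge-same (c ∷ φ) m with ∈-++⁻ (esC c) m
  ... | inj₁ p = here (All.lookup (esC-within c) p)
  ... | inj₂ p = there (edge-same φ p)

  reach-same : ∀ {F : Graph k} {φ a b} → Rep F φ → Distinct φ → Reach F a b → Same φ a b
  reach-same r u (here p) = same-refl (vF r p)
  reach-same {φ = φ} r u (there {a} {b} p ps) with adj-link a b r p
  ... | _ , _ , m , inj₁ refl = same-trans u (edge-same φ m) (reach-same r u ps)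
  ... | _ , _ , m , inj₂ refl = same-trans u (same-sym (edge-same φ m)) (reach-same r u ps)

  arity : V k → ℕ
  arity (inj₁ _) = 1
  arity (inj₂ _) = 3

  isRt : V k → Tree k → ℕ
  isRt a t = if eqb a (rt t) then 1 else 0

  inc-out : ∀ {a : V k} {xs E} → a ∉ xs → All (Within xs) E → ΣE (inc a) E ≡ 0
  inc-out n w = ΣE-zero (All.map (λ { (p , q) → inc-≢ (∉-≢ n p) (∉-≢ n q) }) w)

  isRt-∉ : ∀ {a t} → a ∉ vsT t → isRt a t ≡ 0
  isRt-∉ {a} {t} n rewrite eqb-≢ (∉-≢ n (rt∈ t)) = refl

  inc-rt : ∀ {a b} t → a ≢ b → inc a b (rt t) ≡ isRt a t
  inc-rt t n rewrite eqb-≢ n = refl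

  degT : ∀ t → Unique (vsT t) → ∀ {a} → a ∈ vsT t → ΣE (inc a) (esT t) + isRt a t ≡ arity a
  degT (leaf x) u at₀ rewrite eqb-refl (ι {k} x) = refl
  degT (node v l r) u at₀
    rewrite eqb-refl {k} (inj₂ v)
      | ΣE-++ (inc (inj₂ v)) (esT l) (esT r)
      | inc-out {inj₂ v} (λ p → Unique[x∷xs]⇒x∉xs u (∈-++⁺ˡ p)) (esT-within l)
      | inc-out {inj₂ v} (λ p → Unique[x∷xs]⇒x∉xs u (∈-++⁺ʳ (vsT l) p)) (esT-within r) = refl
  degT (node v l r) u@(_ ∷ u') {a} (there p) with ∈-++⁻ (vsT l) p
  ... | inj₁ q
    rewrite inc-rt {a} {inj₂ v} l (λ { refl → Unique[x∷xs]⇒x∉xs u p })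
      | inc-rt {a} {inj₂ v} r (λ { refl → Unique[x∷xs]⇒x∉xs u p })
      | isRt-∉ {a} {r} (disjoint (vsT l) u' q)
      | eqb-≢ {a = a} {inj₂ v} (λ { refl → Unique[x∷xs]⇒x∉xs u p })
      | ΣE-++ (inc a) (esT l) (esT r)
      | inc-out {a} (disjoint (vsT l) u' q) (esT-within r)
      = trans (arith (isRt a l) _) (degT l (uniqueˡ (vsT l) u') q)
    where
    arith : ∀ m n → m + (n + 0) + 0 ≡ n + m
    arith = solve-∀
  ... | inj₂ q
    rewrite inc-rt {a} {inj₂ v} l (λ { refl → Unique[x∷xs]⇒x∉xs u p })
      | inc-rt {a} {inj₂ v} r (λ { refl → Unique[x∷xs]⇒x∉xs u p })
      | isRt-∉ {a} {l} (λ m → disjoint (vsT l) u' m q)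
      | eqb-≢ {a = a} {inj₂ v} (λ { refl → Unique[x∷xs]⇒x∉xs u p })
      | ΣE-++ (inc a) (esT l) (esT r)
      | inc-out {a} (λ m → disjoint (vsT l) u' m q) (esT-within l)
      = trans (arith (isRt a r) _) (degT r (uniqueʳ (vsT l) u') q)
    where
    arith : ∀ m n → m + n + 0 ≡ n + m
    arith = solve-∀

  degJoin : ∀ s t → Unique (vsC (join s t)) → ∀ {a} → a ∈ vsC (join s t) → ΣE (inc a) (esC (join s t)) ≡ arity a
  degJoin s t u {a} p with ∈-++⁻ (vsT s) p
  ... | inj₁ q
    rewrite ∨-comm (eqb a (rt s)) (eqb a (rt t))
      | inc-rt {a} {rt t} s (λ { refl → disjoint (vsT s) u q (rt∈ t) })
      | ΣE-++ (inc a) (esT s) (esT t) | inc-out {a} (disjoint (vsT s) u q) (esT-within t)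
      = trans (arith (isRt a s) _) (degT s (uniqueˡ (vsT s) u) q)
    where
    arith : ∀ m n → m + (n + 0) ≡ n + m
    arith = solve-∀
  ... | inj₂ q
    rewrite inc-rt {a} {rt s} t (λ { refl → disjoint (vsT s) u (rt∈ s) q })
      | ΣE-++ (inc a) (esT s) (esT t) | inc-out {a} (λ m → disjoint (vsT s) u m q) (esT-within s)
      = trans (+-comm (isRt a t) _) (degT t (uniqueʳ (vsT s) u) q)

  deg-head : ∀ {F : Graph k} {c ψ a} → Rep F (c ∷ ψ) → Distinct (c ∷ ψ) → a ∈ vsC c → deg F a ≡ ΣE (inc a) (esC c)
  deg-head {c = c} {ψ} {a} r (distinct u) p = trans (sums r (inc a) (inc-sym a)) (trans (ΣE-++ (inc a) (esC c) (es ψ))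
    (trans (cong (ΣE (inc a) (esC c) +_) (inc-out (disjoint (vsC c) u p) (es-within ψ))) (+-identityʳ _)))

  deg-join : ∀ {F : Graph k} {s t ψ a} → Rep F (join s t ∷ ψ) → Distinct (join s t ∷ ψ) → a ∈ vsC (join s t) → deg F a ≡ arity a
  deg-join {s = s} {t} r u p = trans (deg-head r u p) (degJoin s t (uniqueˡ (vsC (join s t)) (un u)) p)

  deg-proper : ∀ {F : Graph k} {φ a} → Rep F φ → Distinct φ → All Proper φ → a ∈ vs φ → deg F a ≡ arity a ⊎ (deg F a ≡ 0 × Labelled a)
  deg-proper r u pr p with comp-front p
  ... | c , ψ , e , m with All.head (All-resp-↭ e pr)
  deg-proper r u pr p | _ , ψ , e , m | jn = inj₁ (deg-join (rep-≃ (≃-perm e) r) (uniq-≃ (≃-perm e) u) m)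
  deg-proper r u pr p | _ , ψ , e , at₀ | iso = inj₂ (deg-head (rep-≃ (≃-perm e) r) (uniq-≃ (≃-perm e) u) at₀ , _ , refl)

  deg≢2 : ∀ {F : Graph k} {φ} → Rep F φ → Distinct φ → All Proper φ → ∀ v → v ∈V F → deg F v ≢ 2
  deg≢2 r u pr (inj₁ x) p e with deg-proper r u pr (vF r p)
  ... | inj₁ d with () ← trans (sym e) d
  ... | inj₂ (d , _) with () ← trans (sym e) d
  deg≢2 r u pr (inj₂ x) p e with deg-proper r u pr (vF r p)
  ... | inj₁ d with () ← trans (sym e) d
  ... | inj₂ (d , _) with () ← trans (sym e) d

  leaf-label : ∀ {F : Graph k} {φ x} → Rep F φ → Distinct φ → All Proper φ → ι x ∈ vs φ → Leaf F (ι x)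
  leaf-label r u pr p = vφ r p , go (deg-proper r u pr p)
    where
    go : ∀ {n} → n ≡ 1 ⊎ (n ≡ 0 × _) → n ≤ 1
    go (inj₁ refl) = s≤s z≤n
    go (inj₂ (refl , _)) = z≤n

  -- Suppression and deletion

  ⟨⟩-proper : ∀ (t : Tree k) → Proper ⟨ t ⟩
  ⟨⟩-proper (leaf x) = iso
  ⟨⟩-proper (node v l r) = jn

  ⟨⟩-unique : ∀ t {ψ : Forest k} → Distinct (tree t ∷ ψ) → Distinct (⟨ t ⟩ ∷ ψ)
  ⟨⟩-unique (leaf x) u = u
  ⟨⟩-unique (node v l r) (distinct (_ ∷ u)) = distinct u

  split-↭ : ∀ s t {ψ : Forest k} → vs (join s t ∷ ψ) ↭ vs (tree s ∷ tree t ∷ ψ)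
  split-↭ s t {ψ} = ↭-reflexive (Data.List.Properties.++-assoc (vsT s) (vsT t) (vs ψ))

  split-unique : ∀ s t {ψ : Forest k} → Distinct (join s t ∷ ψ) → Distinct (tree s ∷ tree t ∷ ψ)
  split-unique s t {ψ} u = distinct (unique-↭ (split-↭ s t {ψ}) (un u))

  swap≃ : ∀ {c d : Comp k} {ψ} → (c ∷ d ∷ ψ) ≃ (d ∷ c ∷ ψ)
  swap≃ = ≃-perm (swap _ _ ↭-refl)

  cut-unique : ∀ s t {ψ : Forest k} → Distinct (join s t ∷ ψ) → Distinct (⟨ s ⟩ ∷ ⟨ t ⟩ ∷ ψ)
  cut-unique s t u = uniq-≃ (swap≃ {⟨ t ⟩} {⟨ s ⟩}) (⟨⟩-unique t (uniq-≃ (swap≃ {⟨ s ⟩} {tree t}) (⟨⟩-unique s (split-unique s t u))))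

  suppressNode : ∀ {G H : Graph k} {v l r ψ} → Rep G (tree (node v l r) ∷ ψ) → Distinct (tree (node v l r) ∷ ψ) → Rep H (join l r ∷ ψ) → SuppressStep G H
  suppressNode {G} {H} {v} {l} {r} {ψ} rG u rH = inj₂ v , rt l , rt r
    , vφ rG at₀
    , trans (deg-head rG u at₀) (two (uniqueˡ (vsT (node v l r)) (un u)))
    , (λ e → disjoint (vsT l) (uniqueˡ (vsT l ++ vsT r) (tail (un u))) (rt∈ l) (subst (_∈ vsT r) (sym e) (rt∈ r)))
    , link-adj rG at₀ (inj₂ refl)
    , link-adj rG at₁ (inj₁ refl)
    , (λ a → mk⇔ (λ m → vφ rG (there (vF rH m)) , (λ { refl → Unique[x∷xs]⇒x∉xs (un u) (vF rH m) }))
                 (λ { (m , n) → vφ rH (tl (vF rG m) n) }))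
    , multEq
    where
    tail : ∀ {A : Set} {x : A} {xs} → Unique (x ∷ xs) → Unique xs
    tail (_ ∷ u) = u
    tl : ∀ {a} {xs : List (V k)} → a ∈ inj₂ v ∷ xs → a ≢ inj₂ v → a ∈ xs
    tl at₀ n = ⊥-elim (n refl)
    tl (there p) _ = p
    two : Unique (vsT (node v l r)) → ΣE (inc (inj₂ v)) (esT (node v l r)) ≡ 2
    two u' rewrite eqb-refl {k} (inj₂ v) | ΣE-++ (inc (inj₂ v)) (esT l) (esT r)
      | inc-out {inj₂ v} (λ p → Unique[x∷xs]⇒x∉xs u' (∈-++⁺ˡ p)) (esT-within l)
      | inc-out {inj₂ v} (λ p → Unique[x∷xs]⇒x∉xs u' (∈-++⁺ʳ (vsT l) p)) (esT-within r) = refl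
    arith : ∀ a b c d → a + b + c + d ≡ c + (d + b) + a
    arith = solve-∀
    multEq : ∀ a b → mult H a b + ind a b (rt l) (inj₂ v) + ind a b (inj₂ v) (rt r) ≡ mult G a b + ind a b (rt l) (rt r)
    multEq a b rewrite sums rG (ind a b) (ind-sym a b) | sums rH (ind a b) (ind-sym a b) | ind-sym a b (rt l) (inj₂ v) =
      arith (ind a b (rt l) (rt r)) (ΣE (ind a b) ((esT l ++ esT r) ++ es ψ)) (ind a b (inj₂ v) (rt l)) (ind a b (inj₂ v) (rt r))

  suppressHead : ∀ t {G : Graph k} {ψ} → Rep G (tree t ∷ ψ) → Distinct (tree t ∷ ψ) → ∃[ H ] Star SuppressStep G H × Rep H (⟨ t ⟩ ∷ ψ)
  suppressHead (leaf x) {G} r u = G , ε , r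
  suppressHead (node v l r') {G} {ψ} r u = H , suppressNode r u rH ◅ ε , rH
    where
    H = ⟦ join l r' ∷ ψ ⟧ (⟨⟩-unique (node v l r') u)
    rH = rep-⟦⟧ (join l r' ∷ ψ) (⟨⟩-unique (node v l r') u)

  ≈G-refl : ∀ {G : Graph k} → G ≈G G
  ≈G-refl = (λ v → mk⇔ id id) , (λ a b → refl)

  minusEdge : ∀ {F : Graph k} {s t ψ} → Rep F (join s t ∷ ψ) → Distinct (join s t ∷ ψ) → All Proper ψ
    → ∃[ G ] MinusEdge F (rt s) (rt t) G × Rep G (⟨ s ⟩ ∷ ⟨ t ⟩ ∷ ψ)
  minusEdge {F} {s} {t} {ψ} r u pr =
    let u₀ = split-unique s t u
        r₀ = rep-⟦⟧ (tree s ∷ tree t ∷ ψ) u₀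
        H₁ , st₁ , r₁ = suppressHead s r₀ u₀
        u₁ = uniq-≃ (swap≃ {⟨ s ⟩} {tree t}) (⟨⟩-unique s u₀)
        H₂ , st₂ , r₂ = suppressHead t (rep-≃ (swap≃ {⟨ s ⟩} {tree t}) r₁) u₁
        r₃ = rep-≃ (swap≃ {⟨ t ⟩} {⟨ s ⟩}) r₂
    in H₂ , (⟦ tree s ∷ tree t ∷ ψ ⟧ u₀
            , (link-adj r at₀ (inj₁ refl)
              , (λ v → mk⇔ (λ m → vφ r (∈-resp-↭ (↭-sym (split-↭ s t {ψ})) m)) (λ m → ∈-resp-↭ (split-↭ s t {ψ}) (vF r m)))
              , multEq u₀)
            , H₂ , st₁ ◅◅ st₂ , ≈G-refl {H₂} , deg≢2 r₃ (cut-unique s t u) (⟨⟩-proper s ∷ ⟨⟩-proper t ∷ pr))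
         , r₃
    where
    multEq : ∀ u₀ c d → mult (⟦ tree s ∷ tree t ∷ ψ ⟧ u₀) c d + ind c d (rt s) (rt t) ≡ mult F c d
    multEq u₀ c d = trans (+-comm (ΣE (ind c d) (es (tree s ∷ tree t ∷ ψ))) _)
      (trans (cong (ind c d (rt s) (rt t) +_) (cong (ΣE (ind c d)) (sym (Data.List.Properties.++-assoc (esT s) (esT t) (es ψ)))))
             (sym (sums r (ind c d) (ind-sym c d))))

  minusLeaf : ∀ {F : Graph k} {x t ψ} → Rep F (join (leaf x) t ∷ ψ) → Distinct (join (leaf x) t ∷ ψ) → All Proper ψ
    → ∃[ G ] MinusLeaf F x G × Rep G (⟨ t ⟩ ∷ ψ)
  minusLeaf {F} {x} {t} {ψ} r (distinct u@(_ ∷ u₁)) pr =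
    let u₀ = distinct u₁
        r₀ = rep-⟦⟧ (tree t ∷ ψ) u₀
        H , st , rH = suppressHead t r₀ u₀
    in H , (⟦ tree t ∷ ψ ⟧ u₀
           , (vφ r at₀
             , (λ a → mk⇔ (λ m → vφ r (there m) , (λ { refl → Unique[x∷xs]⇒x∉xs u m }))
                          (λ { (m , n) → tl (vF r m) n }))
             , (λ a b n n' → sym (trans (sums r (ind a b) (ind-sym a b)) (cong (_+ ΣE (ind a b) (es (tree t ∷ ψ))) (ind-≢₁ n n')))))
           , H , st , ≈G-refl {H} , deg≢2 rH (⟨⟩-unique t u₀) (⟨⟩-proper t ∷ pr))
         , rH
    where
    tl : ∀ {a b} {xs : List (V k)} → a ∈ b ∷ xs → a ≢ b → a ∈ xs
    tl at₀ n = ⊥-elim (n refl)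
    tl (there p) _ = p

  minusIso : ∀ {F : Graph k} {x ψ} → Rep F (tree (leaf x) ∷ ψ) → Distinct (tree (leaf x) ∷ ψ) → All Proper ψ
    → ∃[ G ] MinusLeaf F x G × Rep G ψ
  minusIso {F} {x} {ψ} r (distinct u@(_ ∷ u₁)) pr = H , (H
           , (vφ r at₀
             , (λ a → mk⇔ (λ m → vφ r (there m) , (λ { refl → Unique[x∷xs]⇒x∉xs u m }))
                          (λ { (m , n) → tl (vF r m) n }))
             , (λ a b n n' → sym (sums r (ind a b) (ind-sym a b))))
           , H , ε , ≈G-refl {H} , deg≢2 (rep-⟦⟧ ψ u₀) u₀ pr) , rep-⟦⟧ ψ u₀
    where
    u₀ : Distinct ψ
    u₀ = distinct u₁
    H = ⟦ ψ ⟧ u₀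
    tl : ∀ {a b} {xs : List (V k)} → a ∈ b ∷ xs → a ≢ b → a ∈ xs
    tl at₀ n = ⊥-elim (n refl)
    tl (there p) _ = p

module _ {k : ℕ} where

  record Models (F : Graph k) (φ : Forest k) : Set where
    field
      rep : Rep F φ
      dis : Distinct φ
      pro : All Proper φ

  open Models public

  models-≃ : ∀ {F φ ψ} → φ ≃ ψ → Models F φ → Models F ψ
  models-≃ e m = record { rep = rep-≃ e (rep m) ; dis = uniq-≃ e (dis m) ; pro = propE e (pro m) }

  proTail : ∀ {c : Comp k} {ψ} → All Proper (c ∷ ψ) → All Proper ψ
  proTail (_ ∷ p) = p

  cutEdge : ∀ {F s t ψ} → Models F (join s t ∷ ψ) → ∃[ G ] MinusEdge F (rt s) (rt t) G × Models G (⟨ s ⟩ ∷ ⟨ t ⟩ ∷ ψ)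
  cutEdge {s = s} {t} m = let G , e , r = minusEdge (rep m) (dis m) (proTail (pro m)) in
    G , e , record { rep = r ; dis = cut-unique s t (dis m) ; pro = ⟨⟩-proper s ∷ ⟨⟩-proper t ∷ proTail (pro m) }

  cutLeaf : ∀ {F x t ψ} → Models F (join (leaf x) t ∷ ψ) → ∃[ G ] MinusLeaf F x G × Models G (⟨ t ⟩ ∷ ψ)
  cutLeaf {t = t} m@record { dis = distinct (_ ∷ u) } = let G , e , r = minusLeaf (rep m) (dis m) (proTail (pro m)) in
    G , e , record { rep = r ; dis = ⟨⟩-unique t (distinct u) ; pro = ⟨⟩-proper t ∷ proTail (pro m) }

  cutIso : ∀ {F x ψ} → Models F (tree (leaf x) ∷ ψ) → ∃[ G ] MinusLeaf F x G × Models G ψ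
  cutIso m@record { dis = distinct (_ ∷ u) } = let G , e , r = minusIso (rep m) (dis m) (proTail (pro m)) in
    G , e , record { rep = r ; dis = distinct u ; pro = proTail (pro m) }

  cutLeafEdge : ∀ {F x t ψ} → Models F (join (leaf x) t ∷ ψ) → ∃[ G ] MinusLeafEdge F x G × Models G (tree (leaf x) ∷ ⟨ t ⟩ ∷ ψ)
  cutLeafEdge {t = t} m = let G , e , mG = cutEdge m in G , (rt t , link-adj (rep m) at₀ (inj₁ refl) , e) , mG

  data Ch (φ : Forest k) (x y : X k) : Set where
    pair : ∀ {ψ} → φ ≃ (join (leaf x) (leaf y) ∷ ψ) → Ch φ x y
    cher : ∀ {v g ψ} → φ ≃ (join (leaf x) (node v (leaf y) g) ∷ ψ) → Ch φ x y

  data NoCh (φ : Forest k) (x : X k) : Set where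
    noch : ∀ {v v₁ a b v₂ c d ψ} → φ ≃ (join (leaf x) (node v (node v₁ a b) (node v₂ c d)) ∷ ψ) → NoCh φ x

  reroot : ∀ {φ : Forest k} {c d ψ} → Distinct φ → φ ≃ (c ∷ ψ) → c ≃C d → φ ≃ (d ∷ ψ)
  reroot u p e = ≃-trans p (≃-head (uniq-≃ p u) e)

  cherryC : ∀ {v x y} {K : Tree k} → join (node v (leaf x) (leaf y)) K ≃C join (leaf x) (node v (leaf y) K)
  cherryC = ≃C-trans sw (≃C-trans mv' (≃C-trans sw fl))

  ch-sym : ∀ {φ x y} → Distinct φ → Ch φ x y → Ch φ y x
  ch-sym u (pair e) = pair (reroot u e sw)
  ch-sym u (cher e) = cher (reroot u e (≃C-trans mv' sw))

  chStatus : ∀ {φ x t ψ} → Distinct φ → φ ≃ (join (leaf x) t ∷ ψ) → (∃[ z ] Ch φ x z) ⊎ NoCh φ x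
  chStatus {t = leaf z} u e = inj₁ (z , pair e)
  chStatus {t = node v (leaf z) g} u e = inj₁ (z , cher e)
  chStatus {t = node v (node _ _ _) (leaf z)} u e = inj₁ (z , cher (reroot u e fl))
  chStatus {t = node v (node _ _ _) (node _ _ _)} u e = inj₂ (noch e)

  ch-≢ : ∀ {φ x y} → Distinct φ → Ch φ x y → x ≢ y
  ch-≢ u (pair e) refl with uniq-≃ e u
  ... | distinct u' = Unique[x∷xs]⇒x∉xs u' at₀
  ch-≢ u (cher e) refl with uniq-≃ e u
  ... | distinct u' = Unique[x∷xs]⇒x∉xs u' at₁

  ch-∈ : ∀ {φ x y} → Ch φ x y → Same φ (ι x) (ι y)
  ch-∈ (pair e) = same← e (here (at₀ , at₁))
  ch-∈ (cher e) = same← e (here (at₀ , at₂))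

  cherry : ∀ {F φ x y} → Models F φ → Ch φ x y → Cherry F x y
  cherry {F} {φ} {x} {y} m c = ch-≢ (dis m) c , leaf-label (rep m) (dis m) (pro m) (same∈ (ch-∈ c))
      , leaf-label (rep m) (dis m) (pro m) (same∈ʳ (ch-∈ c)) , go c
    where
    go : Ch φ x y → Adj F (ι x) (ι y) ⊎ (∃[ w ] Adj F (ι x) w × Adj F (ι y) w)
    go (pair e) = inj₁ (link-adj (rep (models-≃ e m)) at₀ (inj₁ refl))
    go (cher {v} e) = inj₂ (inj₂ v , link-adj (rep (models-≃ e m)) at₀ (inj₁ refl)
      , link-adj (rep (models-≃ e m)) at₁ (inj₂ refl))

  adj-among : ∀ {F : Graph k} {φ E E' xs} a b → Rep F φ → es φ ≡ E ++ E' → All (Within xs) E' → a ∉ xs → Adj F a b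
    → ∃[ u ] ∃[ v ] (u , v) ∈ E × Link a b (u , v)
  adj-among {E = E} a b r e w n p with adj-link a b r p
  ... | u , v , m , l with ∈-++⁻ E (subst ((u , v) ∈_) e m)
  ... | inj₁ q = u , v , q , l
  ... | inj₂ q with All.lookup w q | l
  ... | p₁ , p₂ | inj₁ refl = ⊥-elim (n p₁)
  ... | p₁ , p₂ | inj₂ refl = ⊥-elim (n p₂)

  nbr-leaf : ∀ {F x t ψ} b → Models F (join (leaf x) t ∷ ψ) → Adj F (ι x) b → b ≡ rt t
  nbr-leaf {x = x} {t} {ψ} b m p with adj-among {E = (ι x , rt t) ∷ []} (ι x) b (rep m) refl (es-within (tree t ∷ ψ)) (Unique[x∷xs]⇒x∉xs (un (dis m))) p
  ... | _ , _ , at₀ , inj₁ refl = refl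
  ... | _ , _ , at₀ , inj₂ e with cong proj₁ e | cong proj₂ e
  ... | refl | q = sym q

  module _ {F : Graph k} {x v h g ψ} (m : Models F (join (leaf x) (node v h g) ∷ ψ)) where

    private
      rest : List (V k)
      rest = (vsT h ++ vsT g) ++ vs ψ

      u₁ : Unique (inj₂ v ∷ rest)
      u₁ with dis m
      ... | distinct (_ ∷ u) = u

      x∉ : ι x ∉ inj₂ v ∷ rest
      x∉ = Unique[x∷xs]⇒x∉xs (un (dis m))

      v∉ : inj₂ v ∉ rest
      v∉ = Unique[x∷xs]⇒x∉xs u₁

      u₂ : Unique rest
      u₂ with u₁
      ... | _ ∷ u = u

      within-rest : All (Within rest) ((esT h ++ esT g) ++ es ψ)
      within-rest = All.++⁺ (within-⊆ ∈-++⁺ˡ (All.++⁺ (within-⊆ ∈-++⁺ˡ (esT-within h)) (within-⊆ (∈-++⁺ʳ (vsT h)) (esT-within g))))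
        (within-⊆ (∈-++⁺ʳ (vsT h ++ vsT g)) (es-within ψ))

    nbr-node : ∀ b → Adj F b (inj₂ v) → b ≡ ι x ⊎ b ≡ rt h ⊎ b ≡ rt g
    nbr-node b p = go b (adj-among {E = E₃} (inj₂ v) b (rep m) refl within-rest v∉ (adj-sym b (inj₂ v) (rep m) p))
      where
      E₃ : List (V k × V k)
      E₃ = (ι x , inj₂ v) ∷ (inj₂ v , rt h) ∷ (inj₂ v , rt g) ∷ []
      other : ∀ {a b c d : V k} → Link a b (c , d) → a ≡ c → b ≡ d
      other (inj₁ e) refl = sym (cong proj₂ e)
      other (inj₂ e) q = trans (sym (cong proj₁ e)) (trans (sym q) (sym (cong proj₂ e)))
      go : ∀ b → (∃[ u ] ∃[ w ] (u , w) ∈ E₃ × Link (inj₂ v) b (u , w)) → b ≡ ι x ⊎ b ≡ rt h ⊎ b ≡ rt g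
      go b (_ , _ , at₀ , l) = inj₁ (other (Data.Sum.map (cong Data.Product.swap) (cong Data.Product.swap) (link-sym l)) refl)
      go b (_ , _ , at₁ , l) = inj₂ (inj₁ (other l refl))
      go b (_ , _ , at₂ , l) = inj₂ (inj₂ (other l refl))

    nbr-branch : ∀ a b → a ∈ vsT h → Adj F a b → b ∈ vsT h ⊎ b ≡ inj₂ v
    nbr-branch a b a∈ p with adj-link a b (rep m) p
    ... | u , w , q , l = go q l
      where
      a∈r : a ∈ rest
      a∈r = ∈-++⁺ˡ (∈-++⁺ˡ a∈)
      a≢x : a ≢ ι x
      a≢x refl = x∉ (there a∈r)
      a∉g : a ∉ vsT g ++ vs ψ
      a∉g n = disjoint (vsT h) (subst Unique (Data.List.Properties.++-assoc (vsT h) (vsT g) (vs ψ)) u₂) a∈ n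
      go : ∀ {u w} → (u , w) ∈ es (join (leaf x) (node v h g) ∷ ψ) → Link a b (u , w) → b ∈ vsT h ⊎ b ≡ inj₂ v
      go at₀ (inj₁ e) = ⊥-elim (a≢x (sym (cong proj₁ e)))
      go at₀ (inj₂ e) = ⊥-elim (v∉ (subst (_∈ rest) (sym (cong proj₂ e)) a∈r))
      go at₁ (inj₁ e) = ⊥-elim (v∉ (subst (_∈ rest) (sym (cong proj₁ e)) a∈r))
      go at₁ (inj₂ e) = inj₂ (sym (cong proj₁ e))
      go at₂ (inj₁ e) = ⊥-elim (v∉ (subst (_∈ rest) (sym (cong proj₁ e)) a∈r))
      go at₂ (inj₂ e) = inj₂ (sym (cong proj₁ e))
      go (there (there (there q))) l with ∈-++⁻ (esT h) (subst (_ ∈_) (Data.List.Properties.++-assoc (esT h) (esT g) (es ψ)) q)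
      go (there (there (there q))) (inj₁ refl) | inj₁ q' = inj₁ (proj₂ (All.lookup (esT-within h) q'))
      go (there (there (there q))) (inj₂ refl) | inj₁ q' = inj₁ (proj₁ (All.lookup (esT-within h) q'))
      go (there (there (there q))) (inj₁ refl) | inj₂ q' = ⊥-elim (a∉g (proj₁ (All.lookup (es-within (tree g ∷ ψ)) q')))
      go (there (there (there q))) (inj₂ refl) | inj₂ q' = ⊥-elim (a∉g (proj₂ (All.lookup (es-within (tree g ∷ ψ)) q')))

    branch-closed : ∀ {a y P} → Walk F a y P → a ∈ vsT h → inj₂ v ∉ P → y ∈ vsT h
    branch-closed (stop _) p n = p
    branch-closed (step {a} {b} e w) p n with nbr-branch a b p e
    ... | inj₁ q = branch-closed w q (λ z → n (there z))
    ... | inj₂ refl = ⊥-elim (n (there (start w)))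
      where
      start : ∀ {a y P} → Walk F a y P → a ∈ P
      start (stop _) = at₀
      start (step _ _) = at₀

    consec∈ : ∀ {u t : V k} {P} → Consec u t P → u ∈ P
    consec∈ (now (inj₁ (refl , _))) = at₀
    consec∈ (now (inj₂ (_ , refl))) = at₁
    consec∈ (next c) = there (consec∈ c)

    off-path : ∀ {y} → ι y ∈ vsT g → ∀ P → Path F (ι x) (ι y) P → ¬ Consec (inj₂ v) (rt h) P
    off-path y∈ _ (stop _ , _) _ = x∉ (there (∈-++⁺ˡ (∈-++⁺ʳ (vsT h) y∈)))
    off-path y∈ _ (step {w = w} e w₁ , _ ∷ u) c with nbr-leaf w m e
    off-path y∈ _ (step e (step {w = b} e' w₂) , _ ∷ u) (now (inj₂ (q , _))) | refl = x∉ (there (subst (_∈ rest) (sym q) (∈-++⁺ˡ (∈-++⁺ˡ (rt∈ h)))))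
    off-path y∈ _ (step e (step {w = b} e' w₂) , _ ∷ u) (next (next c)) | refl = Unique[x∷xs]⇒x∉xs u (consec∈ c)
    off-path y∈ _ (step e (step {w = b} e' w₂) , _ ∷ u) (next (now (inj₂ (q , _)))) | refl = v∉ (subst (_∈ rest) (sym q) (∈-++⁺ˡ (∈-++⁺ˡ (rt∈ h))))
    off-path y∈ _ (step e (step {w = b} e' (stop _)) , _ ∷ u) (next (now (inj₁ (_ , q)))) | refl = disjoint (vsT h) (uniqueˡ (vsT h ++ vsT g) u₂) (subst (_∈ vsT h) (sym q) (rt∈ h)) y∈
    off-path y∈ _ (step e (step {w = b} e' w₂@(step _ _)) , _ ∷ u) (next (now (inj₁ (_ , refl)))) | refl =
      disjoint (vsT h) (uniqueˡ (vsT h ++ vsT g) u₂) (branch-closed w₂ (rt∈ h) (Unique[x∷xs]⇒x∉xs u)) y∈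

  no-cherry : ∀ {F φ x} → Models F φ → NoCh φ x → ¬ InCherry F x
  no-cherry {F} {x = x} m (noch {v} {v₁} {a} {b} {v₂} {c} {d} e) (z , n , _ , _ , near) = go near
    where
    m' = models-≃ e m
    end : ι z ≡ ι x ⊎ ι z ≡ inj₂ v₁ ⊎ ι z ≡ inj₂ v₂ → ⊥
    end (inj₁ refl) = n refl
    end (inj₂ (inj₁ ()))
    end (inj₂ (inj₂ ()))
    go : Adj F (ι x) (ι z) ⊎ (∃[ w ] Adj F (ι x) w × Adj F (ι z) w) → ⊥
    go (inj₁ p) = lab (nbr-leaf (ι z) m' p)
      where
      lab : ι z ≡ inj₂ v → ⊥
      lab ()
    go (inj₂ (w , p , q)) = end (nbr-node m' (ι z) (subst (Adj F (ι z)) (nbr-leaf w m' p) q))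

  comp-leaves : ∀ {G c ψ x L} → Models G (c ∷ ψ) → ι x ∈ vsC c → (∀ {l} → ι l ∈ vsC c → l ∈ L) → (∀ {l} → l ∈ L → ι l ∈ vsC c) → CompLeaves G x L
  comp-leaves {c = c} {ψ} {x} m p f g l = mk⇔ (λ q → f (to (reach-same (rep m) (dis m) q))) (λ q → same-reach (rep m) (here (p , g q)))
    where
    to : ∀ {b} → Same (c ∷ ψ) (ι x) b → b ∈ vsC c
    to (here (_ , q)) = q
    to (there s) = ⊥-elim (disjoint (vsC c) (un (dis m)) p (same∈ s))

  pendant3 : ∀ {F φ w v x y p K ψ} → Models F φ → φ ≃ (join (node w (node v (leaf x) (leaf y)) (leaf p)) K ∷ ψ)
    → Pendant3 F x y p (inj₂ w) (rt K)
  pendant3 {F} {φ} {w} {v} {x} {y} {p} {K} {ψ} m₀ e = d₁ , d₂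
      , link-adj (rep m) at₀ (inj₁ refl)
      , same-reach (rep m) (here (at₂ , at₀))
      , G , me , comp-leaves mG at₁ f g , cherry mG (cher (reroot (dis mG) ≃-refl cherryC))
    where
    m = models-≃ e m₀
    cut = cutEdge m
    G = proj₁ cut
    me = proj₁ (proj₂ cut)
    mG = proj₂ (proj₂ cut)
    uu : Unique (inj₂ v ∷ ι x ∷ ι y ∷ ι p ∷ [])
    uu = uniqueˡ (inj₂ v ∷ ι x ∷ ι y ∷ ι p ∷ []) (un (dis mG))
    d₁ : p ≢ x
    d₁ refl with uu
    ... | _ ∷ u' = Unique[x∷xs]⇒x∉xs u' at₁
    d₂ : p ≢ y
    d₂ refl with uu
    ... | _ ∷ _ ∷ u' = Unique[x∷xs]⇒x∉xs u' at₀
    f : ∀ {l} → ι l ∈ inj₂ v ∷ ι x ∷ ι y ∷ ι p ∷ [] → l ∈ x ∷ y ∷ p ∷ []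
    f at₁ = at₀
    f at₂ = at₁
    f at₃ = at₂
    g : ∀ {l} → l ∈ x ∷ y ∷ p ∷ [] → ι l ∈ inj₂ v ∷ ι x ∷ ι y ∷ ι p ∷ []
    g at₀ = at₁
    g at₁ = at₂
    g at₂ = at₃

  pendant4 : ∀ {F φ w v x y d p q K ψ} → Models F φ → φ ≃ (join (node w (node v (leaf x) (leaf y)) (node d (leaf p) (leaf q))) K ∷ ψ)
    → Pendant4 F x y p q (inj₂ w) (rt K)
  pendant4 {F} {φ} {w} {v} {x} {y} {d} {p} {q} {K} {ψ} m₀ e = d₁ , d₂ , d₃ , d₄ , d₅
      , link-adj (rep m) at₀ (inj₁ refl)
      , same-reach (rep m) (here (at₂ , at₀))
      , G , me , comp-leaves mG at₁ f g , cherry mG (cher (reroot (dis mG) ≃-refl cherryC))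
      , cherry mG (cher (reroot (dis mG) ≃-refl (≃C-trans sw cherryC)))
    where
    m = models-≃ e m₀
    cut = cutEdge m
    G = proj₁ cut
    me = proj₁ (proj₂ cut)
    mG = proj₂ (proj₂ cut)
    VV : List (V k)
    VV = inj₂ v ∷ ι x ∷ ι y ∷ inj₂ d ∷ ι p ∷ ι q ∷ []
    uu : Unique VV
    uu = uniqueˡ VV (un (dis mG))
    d₁ : p ≢ x
    d₁ refl with uu
    ... | _ ∷ u' = Unique[x∷xs]⇒x∉xs u' at₂
    d₂ : p ≢ y
    d₂ refl with uu
    ... | _ ∷ _ ∷ u' = Unique[x∷xs]⇒x∉xs u' at₁
    d₃ : q ≢ x
    d₃ refl with uu
    ... | _ ∷ u' = Unique[x∷xs]⇒x∉xs u' at₃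
    d₄ : q ≢ y
    d₄ refl with uu
    ... | _ ∷ _ ∷ u' = Unique[x∷xs]⇒x∉xs u' at₂
    d₅ : p ≢ q
    d₅ refl with uu
    ... | _ ∷ _ ∷ _ ∷ _ ∷ u' = Unique[x∷xs]⇒x∉xs u' at₀
    f : ∀ {l} → ι l ∈ VV → l ∈ x ∷ y ∷ p ∷ q ∷ []
    f at₁ = at₀
    f at₂ = at₁
    f at₄ = at₂
    f at₅ = at₃
    g : ∀ {l} → l ∈ x ∷ y ∷ p ∷ q ∷ [] → ι l ∈ VV
    g at₀ = at₁
    g at₁ = at₂
    g at₂ = at₄
    g at₃ = at₅

  pendant2 : ∀ {F φ d p q K ψ} → Models F φ → φ ≃ (join (node d (leaf p) (leaf q)) K ∷ ψ) → Pendant2 F p q (inj₂ d) (rt K)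
  pendant2 {F} {φ} {d} {p} {q} {K} {ψ} m₀ e =
      link-adj (rep m) at₀ (inj₁ refl)
      , same-reach (rep m) (here (at₁ , at₀))
      , G , me , comp-leaves mG at₀ f g , cherry mG (pair ≃-refl)
    where
    m = models-≃ e m₀
    cut = cutEdge m
    G = proj₁ cut
    me = proj₁ (proj₂ cut)
    mG = proj₂ (proj₂ cut)
    f : ∀ {l} → ι l ∈ ι p ∷ ι q ∷ [] → l ∈ p ∷ q ∷ []
    f at₀ = at₀
    f at₁ = at₁
    g : ∀ {l} → l ∈ p ∷ q ∷ [] → ι l ∈ ι p ∷ ι q ∷ []
    g at₀ = at₀
    g at₁ = at₁

module _ {A : Set} where

  data Conn (P : List (A × A)) : A → A → Set where
    stay : ∀ {z} → Conn P z z
    move : ∀ {a b w} → ((a , b) ∈ P ⊎ (b , a) ∈ P) → Conn P b w → Conn P a w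

  conn-trans : ∀ {P a b c} → Conn P a b → Conn P b c → Conn P a c
  conn-trans stay q = q
  conn-trans (move m p) q = move m (conn-trans p q)

  conn-sym : ∀ {P a b} → Conn P a b → Conn P b a
  conn-sym stay = stay
  conn-sym (move m p) = conn-trans (conn-sym p) (move (Data.Sum.swap m) stay)

  conn-⊆ : ∀ {P Q a b} → (∀ {e} → e ∈ P → e ∈ Q) → Conn P a b → Conn Q a b
  conn-⊆ f stay = stay
  conn-⊆ f (move m p) = move (Data.Sum.map f f m) (conn-⊆ f p)

  conn-const : ∀ {B : Set} (κ : A → B) {P a b} → (∀ {a b} → (a , b) ∈ P → κ a ≡ κ b) → Conn P a b → κ a ≡ κ b
  conn-const κ h stay = refl
  conn-const κ h (move (inj₁ m) p) = trans (h m) (conn-const κ h p)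
  conn-const κ h (move (inj₂ m) p) = trans (sym (h m)) (conn-const κ h p)

-- Colourings and the number of colours

module _ {k : ℕ} {A : Set} where

  has : (A → V k) → V k → List A → Bool
  has f c [] = false
  has f c (x ∷ xs) = eqb (f x) c ∨ has f c xs

  cnt : (A → V k) → List A → ℕ
  cnt f [] = 0
  cnt f (x ∷ xs) = (if has f (f x) xs then 0 else 1) + cnt f xs

  has-∈ : ∀ f {c y} xs → y ∈ xs → f y ≡ c → has f c xs ≡ true
  has-∈ f {y = y} (x ∷ xs) at₀ refl rewrite eqb-refl (f y) = refl
  has-∈ f {c} (x ∷ xs) (there p) e with eqb (f x) c
  ... | true = refl
  ... | false = has-∈ f xs p e

  has-true : ∀ f {c} xs → has f c xs ≡ true → ∃[ y ] y ∈ xs × f y ≡ c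
  has-true f {c} (x ∷ xs) e with f x ≟V c
  ... | yes p = x , at₀ , p
  ... | no _ with has-true f xs e
  ... | y , m , q = y , there m , q

  cnt-coarser : ∀ (f g : A → V k) xs → (∀ {z w} → z ∈ xs → w ∈ xs → f z ≡ f w → g z ≡ g w) → cnt g xs ≤ cnt f xs
  cnt-coarser f g [] h = z≤n
  cnt-coarser f g (x ∷ xs) h with has f (f x) xs in eq
  ... | false = +-mono-≤ {y = 1} (bit (has g (g x) xs)) (cnt-coarser f g xs (λ p q → h (there p) (there q)))
    where
    bit : ∀ b → (if b then 0 else 1) ≤ 1
    bit true = z≤n
    bit false = s≤s z≤n
  ... | true with has-true f xs eq
  ... | y , m , q rewrite has-∈ g xs m (sym (h at₀ (there m) (sym q))) = cnt-coarser f g xs (λ p q → h (there p) (there q))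

  cnt-∷-≤ : ∀ (f : A → V k) x xs → cnt f xs ≤ cnt f (x ∷ xs)
  cnt-∷-≤ f x xs = m≤n+m _ _

  cnt-∷-new : ∀ (f : A → V k) x xs → (∀ {y} → y ∈ xs → f y ≢ f x) → cnt f (x ∷ xs) ≡ suc (cnt f xs)
  cnt-∷-new f x xs n with has f (f x) xs in eq
  ... | false = refl
  ... | true with has-true f xs eq
  ... | y , m , q = ⊥-elim (n m q)

  cnt-∷-old : ∀ (f : A → V k) x xs {y} → y ∈ xs → f y ≡ f x → cnt f (x ∷ xs) ≡ cnt f xs
  cnt-∷-old f x xs m q rewrite has-∈ f xs m q = refl

  has-↭ : ∀ f c {xs ys} → xs ↭ ys → has f c xs ≡ has f c ys
  has-↭ f c _↭_.refl = refl
  has-↭ f c (prep x p) = cong (eqb (f x) c ∨_) (has-↭ f c p)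
  has-↭ f c {xs = _ ∷ _ ∷ xs} {_ ∷ _ ∷ ys} (swap x y p) rewrite has-↭ f c p | sym (∨-assoc (eqb (f x) c) (eqb (f y) c) (has f c ys))
    | sym (∨-assoc (eqb (f y) c) (eqb (f x) c) (has f c ys)) | ∨-comm (eqb (f x) c) (eqb (f y) c) = refl
  has-↭ f c (_↭_.trans p q) = trans (has-↭ f c p) (has-↭ f c q)

  cnt-↭ : ∀ f {xs ys} → xs ↭ ys → cnt f xs ≡ cnt f ys
  cnt-↭ f _↭_.refl = refl
  cnt-↭ f (prep x p) rewrite has-↭ f (f x) p | cnt-↭ f p = refl
  cnt-↭ f {xs = _ ∷ _ ∷ xs} {_ ∷ _ ∷ ys} (swap x y p) with f x ≟V f y
  ... | yes e rewrite e | eqb-refl (f y) | has-↭ f (f y) p | cnt-↭ f p = refl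
  ... | no n rewrite eqb-≢ (λ z → n (sym z)) | has-↭ f (f x) p | has-↭ f (f y) p | cnt-↭ f p =
    ar (if has f (f x) ys then 0 else 1) (if has f (f y) ys then 0 else 1) (cnt f ys)
    where
    ar : ∀ a b c → a + (b + c) ≡ b + (a + c)
    ar = solve-∀
  cnt-↭ f (_↭_.trans p q) = trans (cnt-↭ f p) (cnt-↭ f q)

  recolour : (A → V k) → V k → V k → A → V k
  recolour f c d z = if eqb (f z) d then c else f z

  recolour-cong : ∀ f c d {z w : A} → f z ≡ f w → recolour f c d z ≡ recolour f c d w
  recolour-cong f c d e rewrite e = refl

  recolour-eq : ∀ f c d {z w : A} → f z ≡ c → f w ≡ d → recolour f c d z ≡ recolour f c d w
  recolour-eq f c d {z} {w} refl refl rewrite eqb-refl (f w) with eqb (f z) (f w)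
  ... | true = refl
  ... | false = refl

  private
    has-c : ∀ f c d xs → has (recolour f c d) c xs ≡ has f c xs ∨ has f d xs
    has-c f c d [] = refl
    has-c f c d (x ∷ xs) rewrite has-c f c d xs with f x ≟V d | f x ≟V c
    ... | yes _ | yes _ rewrite eqb-refl c = refl
    ... | yes _ | no _ rewrite eqb-refl c with has f c xs
    ... | true = refl
    ... | false = refl
    has-c f c d (x ∷ xs) | no _ | yes p rewrite p | eqb-refl c = refl
    has-c f c d (x ∷ xs) | no _ | no n rewrite eqb-≢ n = refl

    has-e : ∀ f c d e xs → e ≢ c → e ≢ d → has (recolour f c d) e xs ≡ has f e xs
    has-e f c d e [] n n' = refl
    has-e f c d e (x ∷ xs) n n' rewrite has-e f c d e xs n n' with f x ≟V d
    ... | yes p rewrite eqb-≢ {a = c} {e} (λ q → n (sym q)) | eqb-≢ {a = f x} {e} (λ q → n' (trans (sym q) p)) = refl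
    ... | no _ = refl

    both : Bool → Bool → ℕ
    both true true = 1
    both _ _ = 0

    new : Bool → ℕ
    new b = if b then 0 else 1

    cnt-recolour : ∀ f c d xs → c ≢ d → cnt f xs ≡ cnt (recolour f c d) xs + both (has f c xs) (has f d xs)
    cnt-recolour f c d [] n = refl
    cnt-recolour f c d (x ∷ xs) n with f x ≟V d
    ... | yes p rewrite p | eqb-≢ {a = d} {c} (λ q → n (sym q)) | has-c f c d xs | cnt-recolour f c d xs n
      = ar (has f c xs) (has f d xs) _
      where
      ar : ∀ C D m → new D + (m + both C D) ≡ new (C ∨ D) + m + both C true
      ar true true m = refl
      ar true false m = trans (cong suc (+-identityʳ m)) (sym (+-comm m 1))
      ar false true m = refl
      ar false false m = refl
    ... | no q with f x ≟V c
    ... | yes p rewrite p | has-c f c d xs | cnt-recolour f c d xs n = ar (has f c xs) (has f d xs) _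
      where
      ar : ∀ C D m → new C + (m + both C D) ≡ new (C ∨ D) + m + both true D
      ar true true m = refl
      ar true false m = refl
      ar false true m = trans (cong suc (+-identityʳ m)) (sym (+-comm m 1))
      ar false false m = refl
    ... | no p rewrite has-e f c d (f x) xs p q | cnt-recolour f c d xs n = sym (+-assoc (new (has f (f x) xs)) _ _)

  recolour-same : ∀ f c xs → cnt f xs ≤ cnt (recolour f c c) xs
  recolour-same f c xs = cnt-coarser (recolour f c c) f xs (λ {z} {w} _ _ e → trans (sym (same z)) (trans e (same w)))
    where
    same : ∀ z → recolour f c c z ≡ f z
    same z with f z ≟V c
    ... | yes p = sym p
    ... | no _ = refl

  recolour-≤ : ∀ f c d xs → cnt f xs ≤ suc (cnt (recolour f c d) xs)
  recolour-≤ f c d xs with c ≟V d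
  ... | yes refl = ≤-trans (recolour-same f c xs) (n≤1+n _)
  ... | no n = begin
      cnt f xs ≡⟨ cnt-recolour f c d xs n ⟩
      cnt (recolour f c d) xs + both (has f c xs) (has f d xs) ≤⟨ +-monoʳ-≤ (cnt (recolour f c d) xs) (bit (has f c xs) (has f d xs)) ⟩
      cnt (recolour f c d) xs + 1 ≡⟨ +-comm _ 1 ⟩
      suc (cnt (recolour f c d) xs) ∎
    where
    open ≤-Reasoning
    bit : ∀ C D → both C D ≤ 1
    bit true true = s≤s z≤n
    bit true false = z≤n
    bit false D = z≤n

  recolour-< : ∀ f {a b} xs → a ∈ xs → b ∈ xs → f a ≢ f b → suc (cnt (recolour f (f a) (f b)) xs) ≤ cnt f xs
  recolour-< f {a} {b} xs p q n = ≤-reflexive (sym (trans (cnt-recolour f (f a) (f b) xs n) (trans (cong (cnt (recolour f (f a) (f b)) xs +_) one) (+-comm _ 1))))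
    where
    one : both (has f (f a) xs) (has f (f b) xs) ≡ 1
    one rewrite has-∈ f xs p refl | has-∈ f xs q refl = refl

  recolour-coarser : ∀ f c d xs → cnt (recolour f c d) xs ≤ cnt f xs
  recolour-coarser f c d xs = cnt-coarser f (recolour f c d) xs (λ _ _ → recolour-cong f c d)

  cnt-const : ∀ (f : A → V k) xs → (∀ {z w} → z ∈ xs → w ∈ xs → f z ≡ f w) → cnt f xs ≤ 1
  cnt-const f [] h = z≤n
  cnt-const f (x ∷ []) h = s≤s z≤n
  cnt-const f (x ∷ y ∷ xs) h = ≤-trans (≤-reflexive (cnt-∷-old f x (y ∷ xs) {y} at₀ (h at₁ at₀)))
    (cnt-const f (y ∷ xs) (λ p q → h (there p) (there q)))

  cnt-length : ∀ (f : A → V k) xs cs → (∀ {z} → z ∈ xs → f z ∈ cs) → cnt f xs ≤ length cs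
  cnt-length f [] cs h = z≤n
  cnt-length f (x ∷ xs) cs h with has f (f x) xs in eq
  ... | true = cnt-length f xs cs (λ p → h (there p))
  ... | false with remove∈ (h at₀)
  ... | cs' , e = ≤-trans (s≤s (cnt-length f xs cs' (λ p → go p (∈-resp-↭ e (h (there p)))))) (≤-reflexive (sym (↭-length e)))
    where
    go : ∀ {z} → z ∈ xs → f z ∈ f x ∷ cs' → f z ∈ cs'
    go p (here q) with () ← trans (sym eq) (has-∈ f xs p q)
    go p (there q) = q

  module _ (e : A → V k) (e-inj : ∀ {z w} → e z ≡ e w → z ≡ w) where

    clos : List (A × A) → A → V k
    clos [] = e
    clos ((a , b) ∷ P) = recolour (clos P) (clos P a) (clos P b)

    clos-edge : ∀ P {a b} → (a , b) ∈ P → clos P a ≡ clos P b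
    clos-edge ((a , b) ∷ P) at₀ = recolour-eq (clos P) (clos P a) (clos P b) {a} {b} refl refl
    clos-edge ((a , b) ∷ P) (there m) = recolour-cong (clos P) (clos P a) (clos P b) (clos-edge P m)

    clos-conn : ∀ P {z w} → clos P z ≡ clos P w → Conn P z w
    clos-conn [] q with refl ← e-inj q = stay
    clos-conn ((a , b) ∷ P) {z} {w} q with clos P z ≟V clos P b | clos P w ≟V clos P b
    ... | yes p | yes p' = conn-⊆ there (clos-conn P (trans p (sym p')))
    ... | yes p | no _ = conn-trans (conn-⊆ there (clos-conn P p)) (move (inj₂ at₀) (conn-⊆ there (clos-conn P q)))
    ... | no _ | yes p = conn-trans (conn-⊆ there (clos-conn P q)) (move (inj₁ at₀) (conn-⊆ there (clos-conn P (sym p))))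
    ... | no _ | no _ = conn-⊆ there (clos-conn P q)

    conn-clos : ∀ P {z w} → Conn P z w → clos P z ≡ clos P w
    conn-clos P = conn-const (clos P) (clos-edge P)

  record Join (xs : List A) (R : A → A → Set) (γ : A → V k) : Set where
    field
      closed : ∀ {z w} → z ∈ xs → w ∈ xs → R z w → γ z ≡ γ w
      least  : ∀ (κ : A → Bool) → (∀ {z w} → z ∈ xs → w ∈ xs → R z w → κ z ≡ κ w)
             → ∀ {z w} → z ∈ xs → w ∈ xs → γ z ≡ γ w → κ z ≡ κ w

  open Join public

  join-exists : ∀ (e : A → V k) (e-inj : ∀ {z w} → e z ≡ e w → z ≡ w) xs {R : A → A → Set} → (∀ z w → Dec (R z w)) → ∃[ γ ] Join xs R γ
  join-exists e e-inj xs {R} R? = clos e e-inj P , record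
    { closed = λ p q r → clos-edge e e-inj P (∈-filter⁺ R'? (∈-cartesianProduct⁺ p q) r)
    ; least = λ κ h p q eq → conn-const κ (λ m → let m₁ , r = ∈-filter⁻ R'? {xs = cartesianProduct xs xs} m ; p₁ , p₂ = ∈-cartesianProduct⁻ xs xs m₁ in h p₁ p₂ r) (clos-conn e e-inj P eq) }
    where
    R'? : ∀ (e : A × A) → Dec (R (proj₁ e) (proj₂ e))
    R'? (z , w) = R? z w
    P = filter R'? (cartesianProduct xs xs)

  least-colour : ∀ {xs R γ} → Join xs R γ → (δ : A → V k) → (∀ {z w} → z ∈ xs → w ∈ xs → R z w → δ z ≡ δ w)
    → ∀ {z w} → z ∈ xs → w ∈ xs → γ z ≡ γ w → δ z ≡ δ w
  least-colour J δ h {z} {w} p q e = sym (eqb-true (trans (sym (least J (λ v → eqb (δ v) (δ z)) (λ p q r → cong (λ c → eqb c (δ z)) (h p q r)) p q e)) (eqb-refl (δ z))))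

  join-≤ : ∀ {xs R γ} → Join xs R γ → (δ : A → V k) → (∀ {z w} → z ∈ xs → w ∈ xs → R z w → δ z ≡ δ w) → cnt δ xs ≤ cnt γ xs
  join-≤ {xs} {γ = γ} J δ h = cnt-coarser γ δ xs (least-colour J δ h)

  module _ (_≟A_ : DecidableEquality A) {x xs R γ} (J : Join (x ∷ xs) R γ) (x∉ : x ∉ xs) (δ : A → V k)
    (hδ : ∀ {z w} → z ∈ xs → w ∈ xs → R z w → δ z ≡ δ w) where

    join-remove : ∀ c → (∀ {z} → z ∈ xs → R x z → δ z ≡ c) → (∀ {z} → z ∈ xs → R z x → δ z ≡ c) → cnt δ xs ≤ cnt γ xs
    join-remove c h₁ h₂ = cnt-coarser γ δ xs (λ {z} {w} p q e → trans (sym (ext-≢ p)) (trans (least-colour J ext hext (there p) (there q) e) (ext-≢ q)))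
      where
      ext : A → V k
      ext z with z ≟A x
      ... | yes _ = c
      ... | no _ = δ z
      ext-≢ : ∀ {z} → z ∈ xs → ext z ≡ δ z
      ext-≢ {z} p with z ≟A x
      ... | yes refl = ⊥-elim (x∉ p)
      ... | no _ = refl
      ext-x : ext x ≡ c
      ext-x with x ≟A x
      ... | yes _ = refl
      ... | no n = ⊥-elim (n refl)
      hext : ∀ {z w} → z ∈ x ∷ xs → w ∈ x ∷ xs → R z w → ext z ≡ ext w
      hext at₀ at₀ r = refl
      hext at₀ (there q) r = trans ext-x (sym (trans (ext-≢ q) (h₁ q r)))
      hext (there p) at₀ r = trans (trans (ext-≢ p) (h₂ p r)) (sym ext-x)
      hext (there p) (there q) r = trans (ext-≢ p) (trans (hδ p q r) (sym (ext-≢ q)))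

    join-remove-iso : (∀ {z} → z ∈ xs → ¬ R x z) → (∀ {z} → z ∈ xs → ¬ R z x) → suc (cnt δ xs) ≤ cnt γ (x ∷ xs)
    join-remove-iso n₁ n₂ = ≤-trans (s≤s (join-remove (γ x) (λ p r → ⊥-elim (n₁ p r)) (λ p r → ⊥-elim (n₂ p r))))
      (≤-reflexive (sym (cnt-∷-new γ x xs alone)))
      where
      isx : A → Bool
      isx z = ⌊ z ≟A x ⌋
      isx-no : ∀ {z} → z ∈ xs → isx z ≡ false
      isx-no {z} p with z ≟A x
      ... | yes refl = ⊥-elim (x∉ p)
      ... | no _ = refl
      isx-yes : isx x ≡ true
      isx-yes with x ≟A x
      ... | yes _ = refl
      ... | no n = ⊥-elim (n refl)
      hx : ∀ {z w} → z ∈ x ∷ xs → w ∈ x ∷ xs → R z w → isx z ≡ isx w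
      hx at₀ at₀ r = refl
      hx at₀ (there q) r = ⊥-elim (n₁ q r)
      hx (there p) at₀ r = ⊥-elim (n₂ p r)
      hx (there p) (there q) r = trans (isx-no p) (sym (isx-no q))
      alone : ∀ {y} → y ∈ xs → γ y ≢ γ x
      alone p e with () ← trans (sym (isx-no p)) (trans (least J isx hx (there p) at₀ e) isx-yes)

module _ {k : ℕ} where

  open DecMem (_≟V_ {k}) using (_∈?_)

  same? : ∀ (φ : Forest k) a b → Dec (Same φ a b)
  same? φ a b = Any.any? (λ c → (a ∈? vsC c) ×-dec (b ∈? vsC c)) φ

  -- Agreement

  record Respects (col : X k → V k) (φ : Forest k) : Set where
    field
      conn : ∀ {x y} → ι x ∈ vs φ → ι y ∈ vs φ → col x ≡ col y → Same φ (ι x) (ι y)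
      disj : ∀ {x y z w} → Conf φ (ι x) (ι z) (ι y) (ι w) → col x ≡ col y → col z ≡ col w → col x ≡ col z

  open Respects public

  record State (F F' : Graph k) (φ φ' : Forest k) (col : X k → V k) : Set where
    field
      mod   : Models F φ
      mod'  : Models F' φ'
      lab   : ∀ {x} → ι x ∈ vs φ → ι x ∈ vs φ'
      lab'  : ∀ {x} → ι x ∈ vs φ' → ι x ∈ vs φ
      res   : Respects col φ
      res'  : Respects col φ'
      agree : ∀ {x y z w} → Conf φ (ι x) (ι y) (ι z) (ι w) → Conf φ' (ι x) (ι z) (ι y) (ι w)
            → col x ≡ col y → col x ≡ col z → col x ≡ col w → ⊥

  open State public

  state-sym : ∀ {F F' φ φ' col} → State F F' φ φ' col → State F' F φ' φ col
  state-sym s = record { mod = mod' s ; mod' = mod s ; lab = lab' s ; lab' = lab s ; res = res' s ; res' = res s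
    ; agree = λ c c' p q r → agree s c' c q p r }

  Linked : Forest k → Forest k → X k → X k → Set
  Linked φ φ' x y = Same φ (ι x) (ι y) ⊎ Same φ' (ι x) (ι y)

  record Enum (φ : Forest k) (L : List (X k)) : Set where
    field
      toL   : ∀ {x} → ι x ∈ vs φ → x ∈ L
      fromL : ∀ {x} → x ∈ L → ι x ∈ vs φ
      uniqL : Unique L

  open Enum public

  Result : (F F' : Graph k) (φ φ' : Forest k) (col : X k → V k) (L : List (X k)) (γ : X k → V k) → Set
  Result F F' φ φ' col L γ = ∃[ σ ] ∃[ w ] Seq F F' σ w × length L ≤ length σ × w + (length φ + length φ') ≤ cnt col L + cnt γ L

  Goal : (F F' : Graph k) (φ φ' : Forest k) (col : X k → V k) → Set
  Goal F F' φ φ' col = ∀ L γ {x₀} → x₀ ∈ L → Enum φ L → Join L (Linked φ φ') γ → Result F F' φ φ' col L γ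

  seq-sym : ∀ {F F' : Graph k} {σ w} → Seq F F' σ w → Seq F' F σ w
  seq-sym (done a b) = done b a
  seq-sym (c1 ((y , a , b) , c , d) s) = c1 ((y , b , a) , d , c) (seq-sym s)
  seq-sym (c3 (a , c , d) s) = c3 (Data.Sum.swap a , d , c) (seq-sym s)
  seq-sym (c2 a s) = c2 (Data.Sum.swap a) (seq-sym s)

  result-sym : ∀ {F F' φ φ' col L γ} → Result F F' φ φ' col L γ → Result F' F φ' φ col L γ
  result-sym {φ = φ} {φ'} {col} {L} {γ} (σ , w , s , l , i) = σ , w , seq-sym s , l , subst (λ n → w + n ≤ cnt col L + cnt γ L) (+-comm (length φ) (length φ')) i

  join-sym : ∀ {φ φ' L} {γ : X k → V k} → Join L (Linked φ φ') γ → Join L (Linked φ' φ) γ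
  join-sym {φ} {φ'} J = record { closed = λ p q r → closed J p q (Data.Sum.swap r)
                      ; least = λ κ h → least J κ (λ p q r → h p q (Data.Sum.swap r)) }

  one : V k → V k → ℕ
  one _ _ = 1

  wt : Forest k → ℕ
  wt φ = ΣE one (es φ) + length (vs φ)

  wt-≃ : ∀ {φ ψ} → φ ≃ ψ → wt φ ≡ wt ψ
  wt-≃ e = cong₂ _+_ (sumE e one (λ _ _ → refl)) (↭-length (vsE e))

  wt-∷ : ∀ c ψ → wt (c ∷ ψ) ≡ (ΣE one (esC c) + length (vsC c)) + wt ψ
  wt-∷ c ψ rewrite ΣE-++ one (esC c) (es ψ) | length-++ (vsC c) {vs ψ} = ar (ΣE one (esC c)) (ΣE one (es ψ)) (length (vsC c)) (length (vs ψ))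
    where
    ar : ∀ a b c d → a + b + (c + d) ≡ a + c + (b + d)
    ar = solve-∀

  wt-⟨⟩ : ∀ t ψ → wt (⟨ t ⟩ ∷ ψ) ≤ wt (tree t ∷ ψ)
  wt-⟨⟩ (leaf x) ψ = ≤-refl
  wt-⟨⟩ (node v l r) ψ = +-mono-≤ (n≤1+n (ΣE one (es (join l r ∷ ψ)))) (n≤1+n (length (vs (join l r ∷ ψ))))

  wt-split : ∀ s t (ψ : Forest k) → wt (join s t ∷ ψ) ≡ suc (wt (tree s ∷ tree t ∷ ψ))
  wt-split s t ψ rewrite Data.List.Properties.++-assoc (esT s) (esT t) (es ψ) | Data.List.Properties.++-assoc (vsT s) (vsT t) (vs ψ) = refl

  wt-cut : ∀ s t (ψ : Forest k) → wt (⟨ s ⟩ ∷ ⟨ t ⟩ ∷ ψ) < wt (join s t ∷ ψ)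
  wt-cut s t ψ rewrite wt-split s t ψ = s≤s (begin
    wt (⟨ s ⟩ ∷ ⟨ t ⟩ ∷ ψ) ≤⟨ wt-⟨⟩ s (⟨ t ⟩ ∷ ψ) ⟩
    wt (tree s ∷ ⟨ t ⟩ ∷ ψ) ≡⟨ wt-∷ (tree s) (⟨ t ⟩ ∷ ψ) ⟩
    ΣE one (esT s) + length (vsT s) + wt (⟨ t ⟩ ∷ ψ) ≤⟨ +-monoʳ-≤ (ΣE one (esT s) + length (vsT s)) (wt-⟨⟩ t ψ) ⟩
    ΣE one (esT s) + length (vsT s) + wt (tree t ∷ ψ) ≡⟨ wt-∷ (tree s) (tree t ∷ ψ) ⟨
    wt (tree s ∷ tree t ∷ ψ) ∎)
    where open ≤-Reasoning

  wt-leaf : ∀ x t (ψ : Forest k) → wt (⟨ t ⟩ ∷ ψ) < wt (join (leaf x) t ∷ ψ)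
  wt-leaf x t ψ = s≤s (≤-trans (wt-⟨⟩ t ψ) (+-monoʳ-≤ (ΣE one (es (tree t ∷ ψ))) (n≤1+n _)))

  wt-iso : ∀ x (ψ : Forest k) → wt ψ < wt (tree (leaf x) ∷ ψ)
  wt-iso x ψ = ≤-reflexive (sym (+-suc (ΣE one (es ψ)) _))

  ⟨⟩-∈ : ∀ (t : Tree k) {v : V k} → v ∈ vsC ⟨ t ⟩ → v ∈ vsT t
  ⟨⟩-∈ (leaf x) p = p
  ⟨⟩-∈ (node v l r) p = there p

  ∈-⟨⟩ : ∀ (t : Tree k) {x} → ι x ∈ vsT t → ι x ∈ vsC ⟨ t ⟩
  ∈-⟨⟩ (leaf x) p = p
  ∈-⟨⟩ (node v l r) (there p) = p

  ⟨⟩-⊑ : ∀ (t : Tree k) {u} → u ⊑C ⟨ t ⟩ → u ⊑ t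
  ⟨⟩-⊑ (node v l r) (left p) = inl p
  ⟨⟩-⊑ (node v l r) (right p) = inr p

  confC-⊆ : ∀ {c d : Comp k} {a b p q} → (∀ {u} → u ⊑C c → u ⊑C d) → (∀ {v} → v ∈ vsC c → v ∈ vsC d) → ConfC c a b p q → ConfC d a b p q
  confC-⊆ {c} f g (u , s , x) = conf-keep {c = c} (f s) g id id x

  conf-∈ : ∀ {c : Comp k} {a b p q} → ConfC c a b p q → a ∈ vsC c
  conf-∈ (u , left s , inj₁ ((p , _) , _)) = ∈-++⁺ˡ (⊑-vs s p)
  conf-∈ (u , right {s = s'} s , inj₁ ((p , _) , _)) = ∈-++⁺ʳ (vsT s') (⊑-vs s p)
  conf-∈ (u , _ , inj₂ (_ , (p , _) , _)) = p

  confRoot : ∀ {φ s t ψ} {a b p q : V k} → Distinct φ → φ ≃ (join s t ∷ ψ) → a ∈ vsT s → b ∈ vsT s → p ∈ vsT t → q ∈ vsT t → Conf φ a b p q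
  confRoot {s = s} {t} u e a b p q = conf← e (here (s , left self , inj₁ ((a , b) , (∈-++⁺ʳ (vsT s) p , out p) , (∈-++⁺ʳ (vsT s) q , out q))))
    where
    out : ∀ {v} → v ∈ vsT t → v ∉ vsT s
    out p m = disjoint (vsT s) (uniqueˡ (vsT s ++ vsT t) (un (uniq-≃ e u))) m p

  Uncrossed : (X k → V k) → Tree k → Tree k → Set
  Uncrossed col s t = ∀ {x y} → ι x ∈ vsT s → ι y ∈ vsT t → col x ≢ col y

  respects-⊆ : ∀ {col φ φ₁} → (∀ {x} → ι x ∈ vs φ₁ → ι x ∈ vs φ)
    → (∀ {x y} → ι x ∈ vs φ₁ → ι y ∈ vs φ₁ → col x ≡ col y → Same φ (ι x) (ι y) → Same φ₁ (ι x) (ι y))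
    → (∀ {a b p q} → Conf φ₁ a b p q → Conf φ a b p q) → Respects col φ → Respects col φ₁
  respects-⊆ f g h r = record { conn = λ p q e → g p q e (conn r (f p) (f q) e) ; disj = λ c → disj r (h c) }

  module _ {φ ψ : Forest k} {s t : Tree k} (e : φ ≃ (join s t ∷ ψ)) where

    cut-back : ∀ {v} → v ∈ vs (⟨ s ⟩ ∷ ⟨ t ⟩ ∷ ψ) → v ∈ vs φ
    cut-back p with ∈-++⁻ (vsC ⟨ s ⟩) p
    ... | inj₁ q = ∈-resp-↭ (↭-sym (vsE e)) (∈-++⁺ˡ (∈-++⁺ˡ (⟨⟩-∈ s q)))
    ... | inj₂ q with ∈-++⁻ (vsC ⟨ t ⟩) q
    ... | inj₁ q' = ∈-resp-↭ (↭-sym (vsE e)) (∈-++⁺ˡ (∈-++⁺ʳ (vsT s) (⟨⟩-∈ t q')))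
    ... | inj₂ q' = ∈-resp-↭ (↭-sym (vsE e)) (∈-++⁺ʳ (vsT s ++ vsT t) q')

    cut-forth : ∀ {x} → ι x ∈ vs φ → ι x ∈ vs (⟨ s ⟩ ∷ ⟨ t ⟩ ∷ ψ)
    cut-forth p with ∈-++⁻ (vsT s ++ vsT t) (∈-resp-↭ (vsE e) p)
    ... | inj₂ q = ∈-++⁺ʳ (vsC ⟨ s ⟩) (∈-++⁺ʳ (vsC ⟨ t ⟩) q)
    ... | inj₁ q with ∈-++⁻ (vsT s) q
    ... | inj₁ q' = ∈-++⁺ˡ (∈-⟨⟩ s q')
    ... | inj₂ q' = ∈-++⁺ʳ (vsC ⟨ s ⟩) (∈-++⁺ˡ (∈-⟨⟩ t q'))

    cut-conf : ∀ {a b p q} → Conf (⟨ s ⟩ ∷ ⟨ t ⟩ ∷ ψ) a b p q → Conf φ a b p q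
    cut-conf (here c) = conf← e (here (confC-⊆ {⟨ s ⟩} (λ p → left (⟨⟩-⊑ s p)) (λ p → ∈-++⁺ˡ (⟨⟩-∈ s p)) c))
    cut-conf (there (here c)) = conf← e (here (confC-⊆ {⟨ t ⟩} (λ p → right (⟨⟩-⊑ t p)) (λ p → ∈-++⁺ʳ (vsT s) (⟨⟩-∈ t p)) c))
    cut-conf (there (there c)) = conf← e (there c)

    data SameCut (x y : X k) : Set where
      kept   : Same (⟨ s ⟩ ∷ ⟨ t ⟩ ∷ ψ) (ι x) (ι y) → SameCut x y
      across : ι x ∈ vsT s → ι y ∈ vsT t → SameCut x y
      back   : ι x ∈ vsT t → ι y ∈ vsT s → SameCut x y

    same-cut : ∀ {x y} → Same φ (ι x) (ι y) → SameCut x y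
    same-cut p with same→ e p
    ... | there q = kept (there (there q))
    ... | here (a , b) with ∈-++⁻ (vsT s) a | ∈-++⁻ (vsT s) b
    ... | inj₁ a' | inj₁ b' = kept (here (∈-⟨⟩ s a' , ∈-⟨⟩ s b'))
    ... | inj₁ a' | inj₂ b' = across a' b'
    ... | inj₂ a' | inj₁ b' = back a' b'
    ... | inj₂ a' | inj₂ b' = kept (there (here (∈-⟨⟩ t a' , ∈-⟨⟩ t b')))

    state-cut : ∀ {F F' φ' G col} → State F F' φ φ' col → Uncrossed col s t → Models G (⟨ s ⟩ ∷ ⟨ t ⟩ ∷ ψ) → State G F' (⟨ s ⟩ ∷ ⟨ t ⟩ ∷ ψ) φ' col
    state-cut {col = col} st un' m = record { mod = m ; mod' = mod' st ; lab = λ p → lab st (cut-back p) ; lab' = λ p → cut-forth (lab' st p)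
      ; res = respects-⊆ cut-back (λ _ _ q r → go q (same-cut r)) cut-conf (res st) ; res' = res' st ; agree = λ c c' → agree st (cut-conf c) c' }
      where
      go : ∀ {x y} → col x ≡ col y → SameCut x y → Same (⟨ s ⟩ ∷ ⟨ t ⟩ ∷ ψ) (ι x) (ι y)
      go q (kept r) = r
      go q (across a b) = ⊥-elim (un' a b q)
      go q (back a b) = ⊥-elim (un' b a (sym q))

  -- Removing a label

  data Mate (φ φ₁ : Forest k) (x : X k) : Set where
    alone : length φ ≡ suc (length φ₁) → (∀ {z} → Same φ (ι x) (ι z) → z ≡ x) → Mate φ φ₁ x
    mate  : ∀ m → m ≢ x → Same φ (ι x) (ι m) → ι m ∈ vs φ₁ → length φ ≡ length φ₁ → (∀ {z} → z ≢ x → Same φ (ι x) (ι z) → Same φ₁ (ι m) (ι z)) → Mate φ φ₁ x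

  record Removed (F : Graph k) (φ : Forest k) (x : X k) : Set where
    field
      G    : Graph k
      φ₁   : Forest k
      ml   : MinusLeaf F x G
      modG : Models G φ₁
      rvB  : ∀ {z} → ι z ∈ vs φ₁ → ι z ∈ vs φ × z ≢ x
      rvF  : ∀ {z} → ι z ∈ vs φ → z ≢ x → ι z ∈ vs φ₁
      rvS  : ∀ {z w} → z ≢ x → w ≢ x → Same φ (ι z) (ι w) → Same φ₁ (ι z) (ι w)
      rvC  : ∀ {a b p q} → Conf φ₁ a b p q → Conf φ a b p q
      rvW  : wt φ₁ < wt φ
      rvM  : Mate φ φ₁ x

  open Removed public

  removeIso : ∀ {F φ x ψ} → Models F φ → φ ≃ (tree (leaf x) ∷ ψ) → Removed F φ x
  removeIso {F} {φ} {x} {ψ} m e = record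
    { G = proj₁ cut ; φ₁ = ψ ; ml = proj₁ (proj₂ cut) ; modG = proj₂ (proj₂ cut)
    ; rvB = λ p → ∈-resp-↭ (↭-sym (vsE e)) (there p) , (λ { refl → x∉ p })
    ; rvF = λ p n → tl (∈-resp-↭ (vsE e) p) n
    ; rvS = λ n n' s → sm n (same→ e s)
    ; rvC = λ c → conf← e (there c)
    ; rvW = subst (wt ψ <_) (sym (wt-≃ e)) (wt-iso x ψ)
    ; rvM = alone (lenE e) (λ s → al (same→ e s)) }
    where
    cut = cutIso (models-≃ e m)
    x∉ : ι x ∉ vs ψ
    x∉ = Unique[x∷xs]⇒x∉xs (un (uniq-≃ e (dis m)))
    tl : ∀ {z} → ι z ∈ ι x ∷ vs ψ → z ≢ x → ι z ∈ vs ψ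
    tl at₀ n = ⊥-elim (n refl)
    tl (there p) n = p
    sm : ∀ {z w} → z ≢ x → Same (tree (leaf x) ∷ ψ) (ι z) w → Same ψ (ι z) w
    sm n (here (at₀ , _)) = ⊥-elim (n refl)
    sm n (there s) = s
    al : ∀ {z} → Same (tree (leaf x) ∷ ψ) (ι x) (ι z) → z ≡ x
    al (here (_ , at₀)) = refl
    al (there s) = ⊥-elim (x∉ (same∈ s))

  removeLeaf : ∀ {F φ x t ψ} y → Models F φ → φ ≃ (join (leaf x) t ∷ ψ) → ι y ∈ vsT t → Removed F φ x
  removeLeaf {F} {φ} {x} {t} {ψ} y m e y∈ = record
    { G = proj₁ cut ; φ₁ = ⟨ t ⟩ ∷ ψ ; ml = proj₁ (proj₂ cut) ; modG = proj₂ (proj₂ cut)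
    ; rvB = λ p → ∈-resp-↭ (↭-sym (vsE e)) (there (bk p)) , (λ { refl → x∉ (bk p) })
    ; rvF = λ p n → fw (tl (∈-resp-↭ (vsE e) p) n)
    ; rvS = λ n n' s → sm n n' (same→ e s)
    ; rvC = λ c → conf← e (cf c)
    ; rvW = subst (wt (⟨ t ⟩ ∷ ψ) <_) (sym (wt-≃ e)) (wt-leaf x t ψ)
    ; rvM = mate y (λ { refl → x∉ (∈-++⁺ˡ y∈) }) (same← e (here (at₀ , there y∈))) (∈-++⁺ˡ (∈-⟨⟩ t y∈)) (lenE e) (λ n s → mt n (same→ e s)) }
    where
    cut = cutLeaf (models-≃ e m)
    x∉ : ι x ∉ vsT t ++ vs ψ
    x∉ = Unique[x∷xs]⇒x∉xs (un (uniq-≃ e (dis m)))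
    bk : ∀ {v} → v ∈ vs (⟨ t ⟩ ∷ ψ) → v ∈ vsT t ++ vs ψ
    bk p with ∈-++⁻ (vsC ⟨ t ⟩) p
    ... | inj₁ q = ∈-++⁺ˡ (⟨⟩-∈ t q)
    ... | inj₂ q = ∈-++⁺ʳ (vsT t) q
    fw : ∀ {z} → ι z ∈ vsT t ++ vs ψ → ι z ∈ vs (⟨ t ⟩ ∷ ψ)
    fw p with ∈-++⁻ (vsT t) p
    ... | inj₁ q = ∈-++⁺ˡ (∈-⟨⟩ t q)
    ... | inj₂ q = ∈-++⁺ʳ (vsC ⟨ t ⟩) q
    tl : ∀ {z} {xs : List (V k)} → ι z ∈ ι x ∷ xs → z ≢ x → ι z ∈ xs
    tl at₀ n = ⊥-elim (n refl)
    tl (there p) n = p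
    sm : ∀ {z w} → z ≢ x → w ≢ x → Same (join (leaf x) t ∷ ψ) (ι z) (ι w) → Same (⟨ t ⟩ ∷ ψ) (ι z) (ι w)
    sm n n' (here (p , q)) = here (∈-⟨⟩ t (tl p n) , ∈-⟨⟩ t (tl q n'))
    sm n n' (there s) = there s
    cf : ∀ {a b p q} → Conf (⟨ t ⟩ ∷ ψ) a b p q → Conf (join (leaf x) t ∷ ψ) a b p q
    cf (here c) = here (confC-⊆ {⟨ t ⟩} (λ p → right (⟨⟩-⊑ t p)) (λ p → there (⟨⟩-∈ t p)) c)
    cf (there c) = there c
    mt : ∀ {z} → z ≢ x → Same (join (leaf x) t ∷ ψ) (ι x) (ι z) → Same (⟨ t ⟩ ∷ ψ) (ι y) (ι z)
    mt n (here (p , q)) = here (∈-⟨⟩ t y∈ , ∈-⟨⟩ t (tl q n))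
    mt n (there s) = ⊥-elim (x∉ (∈-++⁺ʳ (vsT t) (same∈ s)))

  Hyp : (φ φ' : Forest k) (col : X k → V k) → Set
  Hyp φ φ' col = ∀ {G G' ψ ψ'} → State G G' ψ ψ' col → wt ψ + wt ψ' < wt φ + wt φ' → Goal G G' ψ ψ' col

  hyp-sym : ∀ {φ φ' col} → Hyp φ φ' col → Hyp φ' φ col
  hyp-sym {φ} {φ'} h {ψ = ψ} {ψ'} st lt L γ x₀ en J = h st (subst (wt ψ + wt ψ' <_) (+-comm (wt φ') (wt φ)) lt) L γ x₀ en J

  module _ {F F' : Graph k} {φ φ' : Forest k} {col : X k → V k} (st : State F F' φ φ' col) (ih : Hyp φ φ' col)
    {L : List (X k)} {γ : X k → V k} {x₁ x : X k} (x₁∈ : x₁ ∈ L) (x₁≢ : x₁ ≢ x) (en : Enum φ L)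
    (J : Join L (Linked φ φ') γ) (x∈ : x ∈ L) (rm : Removed F φ x) (rm' : Removed F' φ' x)
    (put : ∀ {σ w} → Seq (G rm) (G rm') σ w → Seq F F' (x ∷ σ) w) where

    private
      ψ = φ₁ rm
      ψ' = φ₁ rm'

      st₁ : State (G rm) (G rm') ψ ψ' col
      st₁ = record { mod = modG rm ; mod' = modG rm'
        ; lab = λ p → let q , n = rvB rm p in rvF rm' (lab st q) n
        ; lab' = λ p → let q , n = rvB rm' p in rvF rm (lab' st q) n
        ; res = respects-⊆ (λ p → proj₁ (rvB rm p)) (λ p q _ → rvS rm (proj₂ (rvB rm p)) (proj₂ (rvB rm q))) (rvC rm) (res st)
        ; res' = respects-⊆ (λ p → proj₁ (rvB rm' p)) (λ p q _ → rvS rm' (proj₂ (rvB rm' p)) (proj₂ (rvB rm' q))) (rvC rm') (res' st)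
        ; agree = λ c c' → agree st (rvC rm c) (rvC rm' c') }

      L' : List (X k)
      L' = proj₁ (remove∈ x∈)

      pL : L ↭ x ∷ L'
      pL = proj₂ (remove∈ x∈)

      x∉ : x ∉ L'
      x∉ = Unique[x∷xs]⇒x∉xs (unique-↭ pL (uniqL en))

      ≢x : ∀ {z} → z ∈ L' → z ≢ x
      ≢x p refl = x∉ p

      up : ∀ {z} → z ∈ L' → z ∈ L
      up p = ∈-resp-↭ (↭-sym pL) (there p)

      down : ∀ {z} → z ∈ L → z ≢ x → z ∈ L'
      down p n with ∈-resp-↭ pL p
      ... | at₀ = ⊥-elim (n refl)
      ... | there q = q

      en' : Enum ψ L'
      en' = record { toL = λ p → down (toL en (proj₁ (rvB rm p))) (proj₂ (rvB rm p)) ; fromL = λ p → rvF rm (fromL en (up p)) (≢x p)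
        ; uniqL = tail' (unique-↭ pL (uniqL en)) }
        where
        tail' : ∀ {A : Set} {x : A} {xs} → Unique (x ∷ xs) → Unique xs
        tail' (_ ∷ u) = u

      γ₁J : ∃[ γ ] Join L' (Linked ψ ψ') γ
      γ₁J = join-exists ι inj₁-injective L' (λ z w → same? ψ (ι z) (ι w) ⊎-dec same? ψ' (ι z) (ι w))

      γ₁ : X k → V k
      γ₁ = proj₁ γ₁J

      J₁ : Join L' (Linked ψ ψ') γ₁
      J₁ = proj₂ γ₁J

      JL : Join (x ∷ L') (Linked φ φ') γ
      JL = record { closed = λ p q → closed J (∈-resp-↭ (↭-sym pL) p) (∈-resp-↭ (↭-sym pL) q)
        ; least = λ κ h p q → least J κ (λ p q → h (∈-resp-↭ pL p) (∈-resp-↭ pL q)) (∈-resp-↭ (↭-sym pL) p) (∈-resp-↭ (↭-sym pL) q) }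

      hδ : ∀ {z w} → z ∈ L' → w ∈ L' → Linked φ φ' z w → γ₁ z ≡ γ₁ w
      hδ p q (inj₁ s) = closed J₁ p q (inj₁ (rvS rm (≢x p) (≢x q) s))
      hδ p q (inj₂ s) = closed J₁ p q (inj₂ (rvS rm' (≢x p) (≢x q) s))

      toL' : ∀ {z} → ι z ∈ vs ψ' → z ∈ L'
      toL' p = toL en' (lab' st₁ p)

      lone : (∀ {z} → Same φ (ι x) (ι z) → z ≡ x) → suc (cnt col L') ≤ cnt col L
      lone h = ≤-reflexive (sym (trans (cnt-↭ col pL) (cnt-∷-new col x L' (λ p e → ≢x p (h (conn (res st) (fromL en x∈) (fromL en (up p)) (sym e)))))))

      lone' : (∀ {z} → Same φ' (ι x) (ι z) → z ≡ x) → suc (cnt col L') ≤ cnt col L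
      lone' h = ≤-reflexive (sym (trans (cnt-↭ col pL) (cnt-∷-new col x L' (λ p e → ≢x p (h (conn (res' st) (lab st (fromL en x∈)) (lab st (fromL en (up p))) (sym e)))))))

      shrink : cnt col L' ≤ cnt col L
      shrink = ≤-trans (cnt-∷-≤ col x L') (≤-reflexive (sym (cnt-↭ col pL)))

      viaMate : ∀ c → (∀ {z} → z ∈ L' → Linked φ φ' x z → γ₁ z ≡ c) → cnt γ₁ L' ≤ cnt γ L
      viaMate c h = ≤-trans (join-remove _≟F_ JL x∉ γ₁ hδ c h (λ p r → h p (Data.Sum.map same-sym same-sym r)))
        (≤-trans (cnt-∷-≤ γ x L') (≤-reflexive (sym (cnt-↭ γ pL))))

    removeBoth : (∀ {m m'} → m ≢ x → Same φ (ι x) (ι m) → m' ≢ x → Same φ' (ι x) (ι m') → ∃[ y ] y ≢ x × Same φ (ι x) (ι y) × Same φ' (ι x) (ι y))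
      → Result F F' φ φ' col L γ
    removeBoth common =
      let σ , w , s , l , i = ih st₁ (+-mono-<-≤ (rvW rm) (≤-trans (n≤1+n _) (rvW rm'))) L' γ₁ (down x₁∈ x₁≢) en' J₁
      in x ∷ σ , w , put s , ≤-trans (≤-reflexive (↭-length pL)) (s≤s l) , ineq {w} i (rvM rm) (rvM rm')
      where
      open ≤-Reasoning
      ar₂ : ∀ a b c → a + (suc b + suc c) ≡ suc (suc (a + (b + c)))
      ar₂ = solve-∀
      ar₁ : ∀ a b c → a + (suc b + c) ≡ suc (a + (b + c))
      ar₁ = solve-∀
      ar₀ : ∀ a b c → a + (b + suc c) ≡ suc (a + (b + c))
      ar₀ = solve-∀
      ineq : ∀ {w} → w + (length ψ + length ψ') ≤ cnt col L' + cnt γ₁ L' → Mate φ ψ x → Mate φ' ψ' x → w + (length φ + length φ') ≤ cnt col L + cnt γ L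
      ineq {w} i (alone l h) (alone l' h') rewrite l | l' = begin
        w + (suc (length ψ) + suc (length ψ')) ≡⟨ ar₂ w (length ψ) (length ψ') ⟩
        suc (suc (w + (length ψ + length ψ'))) ≤⟨ s≤s (s≤s i) ⟩
        suc (suc (cnt col L' + cnt γ₁ L')) ≡⟨ cong suc (sym (+-suc (cnt col L') _)) ⟩
        suc (cnt col L') + suc (cnt γ₁ L') ≤⟨ +-mono-≤ (lone h) (≤-trans (join-remove-iso _≟F_ JL x∉ γ₁ hδ n₁ n₂) (≤-reflexive (sym (cnt-↭ γ pL)))) ⟩
        cnt col L + cnt γ L ∎
        where
        n₁ : ∀ {z} → z ∈ L' → ¬ Linked φ φ' x z
        n₁ p (inj₁ s) = ≢x p (h s)
        n₁ p (inj₂ s) = ≢x p (h' s)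
        n₂ : ∀ {z} → z ∈ L' → ¬ Linked φ φ' z x
        n₂ p (inj₁ s) = ≢x p (h (same-sym s))
        n₂ p (inj₂ s) = ≢x p (h' (same-sym s))
      ineq {w} i (alone l h) (mate m n _ m∈ l' h') rewrite l | l' = begin
        w + (suc (length ψ) + length ψ') ≡⟨ ar₁ w (length ψ) (length ψ') ⟩
        suc (w + (length ψ + length ψ')) ≤⟨ s≤s i ⟩
        suc (cnt col L') + cnt γ₁ L' ≤⟨ +-mono-≤ (lone h) (viaMate (γ₁ m) go) ⟩
        cnt col L + cnt γ L ∎
        where
        go : ∀ {z} → z ∈ L' → Linked φ φ' x z → γ₁ z ≡ γ₁ m
        go p (inj₁ s) = ⊥-elim (≢x p (h s))
        go p (inj₂ s) = sym (closed J₁ (toL' m∈) p (inj₂ (h' (≢x p) s)))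
      ineq {w} i (mate m n _ m∈ l h) (alone l' h') rewrite l | l' = begin
        w + (length ψ + suc (length ψ')) ≡⟨ ar₀ w (length ψ) (length ψ') ⟩
        suc (w + (length ψ + length ψ')) ≤⟨ s≤s i ⟩
        suc (cnt col L') + cnt γ₁ L' ≤⟨ +-mono-≤ (lone' h') (viaMate (γ₁ m) go) ⟩
        cnt col L + cnt γ L ∎
        where
        go : ∀ {z} → z ∈ L' → Linked φ φ' x z → γ₁ z ≡ γ₁ m
        go p (inj₂ s) = ⊥-elim (≢x p (h' s))
        go p (inj₁ s) = sym (closed J₁ (toL en' m∈) p (inj₁ (h (≢x p) s)))
      ineq {w} i (mate m n sm m∈ l h) (mate m' n' sm' m∈' l' h') rewrite l | l' with common n sm n' sm'
      ... | y , y≢ , sy , sy' = ≤-trans i (+-mono-≤ shrink (viaMate (γ₁ y) go))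
        where
        y∈ : y ∈ L'
        y∈ = toL en' (same∈ʳ (h y≢ sy))
        go : ∀ {z} → z ∈ L' → Linked φ φ' x z → γ₁ z ≡ γ₁ y
        go p (inj₁ s) = trans (sym (closed J₁ (toL en' m∈) p (inj₁ (h (≢x p) s)))) (closed J₁ (toL en' m∈) y∈ (inj₁ (h y≢ sy)))
        go p (inj₂ s) = trans (sym (closed J₁ (toL' m∈') p (inj₂ (h' (≢x p) s)))) (closed J₁ (toL' m∈') y∈ (inj₂ (h' y≢ sy')))

module _ {k : ℕ} where

  record Move (x : X k) (F F' G G' : Graph k) : Set where
    constructor move₂
    field C2-of : C2 x F F' G G'

  open Move public

  Closed : (X k → Bool) → Forest k → Set
  Closed W φ = ∀ {x y} → Same φ (ι x) (ι y) → W x ≡ W y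

  -- W is a union of components of φ, possibly after cutting one edge of φ.
  data Half (W : X k → Bool) (φ : Forest k) : Set where
    uncut : Closed W φ → Half W φ
    cut-at  : ∀ {s t ψ} → φ ≃ (join s t ∷ ψ) → (∀ {x} → ι x ∈ vsT s → W x ≡ true) → (∀ {x} → ι x ∈ vsT t → W x ≡ false)
          → Closed W ψ → Half W φ

  Piece : (X k → Bool) → Forest k → Forest k → Set
  Piece W φ φ' = (Closed W φ × Half W φ') ⊎ (Half W φ × Closed W φ')

  size : (X k → Bool) → List (X k) → ℕ
  size W [] = 0
  size W (x ∷ xs) = (if W x then 1 else 0) + size W xs

  private
    bit : ∀ {a b : Bool} → (a ≡ true → b ≡ true) → (if a then 1 else 0) ≤ (if b then 1 else 0)
    bit {false} h = z≤n
    bit {true} {true} h = ≤-refl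
    bit {true} {false} h with () ← h refl

  size-≤ : ∀ {W W'} xs → (∀ x → W' x ≡ true → W x ≡ true) → size W' xs ≤ size W xs
  size-≤ [] h = z≤n
  size-≤ (x ∷ xs) h = +-mono-≤ (bit (h x)) (size-≤ xs h)

  size-< : ∀ {W W'} xs → (∀ x → W' x ≡ true → W x ≡ true) → ∀ {b} → b ∈ xs → W b ≡ true → W' b ≡ false → size W' xs < size W xs
  size-< (x ∷ xs) h at₀ p q rewrite p | q = s≤s (size-≤ xs h)
  size-< (x ∷ xs) h (there m) p q = +-mono-≤-< (bit (h x)) (size-< xs h m p q)

  findT : ∀ {P : X k → Set} → (∀ x → Dec (P x)) → (t : Tree k) → (∃[ x ] ι x ∈ vsT t × P x) ⊎ (∀ {x} → ι x ∈ vsT t → ¬ P x)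
  findT P? (leaf x) with P? x
  ... | yes p = inj₁ (x , at₀ , p)
  ... | no n = inj₂ (λ { at₀ → n })
  findT P? (node v l r) with findT P? l
  ... | inj₁ (x , m , p) = inj₁ (x , there (∈-++⁺ˡ m) , p)
  ... | inj₂ nl with findT P? r
  ... | inj₁ (x , m , p) = inj₁ (x , there (∈-++⁺ʳ (vsT l) m) , p)
  ... | inj₂ nr = inj₂ (λ { (there m) → go (∈-++⁻ (vsT l) m) })
    where
    go : ∀ {x} → ι x ∈ vsT l ⊎ ι x ∈ vsT r → ¬ _
    go (inj₁ m) = nl m
    go (inj₂ m) = nr m

  record Ctx (F F' : Graph k) (φ φ' : Forest k) (col : X k → V k) (L : List (X k)) (γ : X k → V k) : Set where
    field
      st   : State F F' φ φ' col
      ih   : Hyp φ φ' col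
      en   : Enum φ L
      jo   : Join L (Linked φ φ') γ
      noI  : ∀ {x} → ι x ∈ vs φ → ∃[ t ] ∃[ ψ ] φ ≃ (join (leaf x) t ∷ ψ)
      noI' : ∀ {x} → ι x ∈ vs φ' → ∃[ t ] ∃[ ψ ] φ' ≃ (join (leaf x) t ∷ ψ)

  open Ctx public

  ctx-sym : ∀ {F F' φ φ' col L γ} → Ctx F F' φ φ' col L γ → Ctx F' F φ' φ col L γ
  ctx-sym {φ = φ} {φ'} {L = L} c = record { st = state-sym (st c) ; ih = hyp-sym {φ = φ} {φ'} (ih c)
    ; en = record { toL = λ p → toL (en c) (lab' (st c) p) ; fromL = λ p → lab (st c) (fromL (en c) p) ; uniqL = uniqL (en c) }
    ; jo = join-sym {φ = φ} {φ'} (jo c) ; noI = noI' c ; noI' = noI c }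

  Smaller : ∀ {F F' φ φ' col L γ} → Ctx F F' φ φ' col L γ → (X k → Bool) → Set
  Smaller {F} {F'} {φ} {φ'} {col} {L} {γ} _ W = ∀ W' → size W' L < size W L → ∀ {x} → ι x ∈ vs φ → W' x ≡ true → Piece W' φ φ' → Result F F' φ φ' col L γ

  piece-sym : ∀ {W φ φ'} → Piece W φ φ' → Piece W φ' φ
  piece-sym (inj₁ (a , b)) = inj₂ (b , a)
  piece-sym (inj₂ (a , b)) = inj₁ (b , a)

  smaller-sym : ∀ {F F' φ φ' col L γ W} (c : Ctx F F' φ φ' col L γ) → Smaller c W → Smaller (ctx-sym c) W
  smaller-sym {φ = φ} {φ'} {col} {L} {γ} c sm W' lt p q pc = result-sym {φ = φ} {φ'} {col} {L} {γ} (sm W' lt (lab' (st c) p) q (piece-sym pc))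

  -- Cutting an edge of φ that no colour class crosses; W witnesses that the
  -- cut either leaves the join of the two forests unchanged or splits W.
  module _ {F F' : Graph k} {φ φ' : Forest k} {col : X k → V k} {L : List (X k)} {γ : X k → V k}
    (c : Ctx F F' φ φ' col L γ) {W : X k → Bool} (sm : Smaller c W) (pc : Piece W φ φ')
    {s t ψ} (e : φ ≃ (join s t ∷ ψ)) (uc : Uncrossed col s t) {a b} (a∈ : ι a ∈ vsT s) (b∈ : ι b ∈ vsT t) (Wa : W a ≡ true) (Wb : W b ≡ true)
    {x G} (stp : Move x F F' G F') (mG : Models G (⟨ s ⟩ ∷ ⟨ t ⟩ ∷ ψ))
    (γ₁ : X k → V k) (J₁ : Join L (Linked (⟨ s ⟩ ∷ ⟨ t ⟩ ∷ ψ) φ') γ₁) where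

    private
      φ₁ᶜ : Forest k
      φ₁ᶜ = ⟨ s ⟩ ∷ ⟨ t ⟩ ∷ ψ

      Res : Set
      Res = Result F F' φ φ' col L γ

      uφ : Distinct φ
      uφ = dis (mod (st c))

      inφ : ∀ {v} → v ∈ vsT s ++ vsT t → v ∈ vs φ
      inφ p = ∈-resp-↭ (↭-sym (vsE e)) (∈-++⁺ˡ p)

      aφ : ι a ∈ vs φ
      aφ = inφ (∈-++⁺ˡ a∈)

      bφ : ι b ∈ vs φ
      bφ = inφ (∈-++⁺ʳ (vsT s) b∈)

      toL₁ : ∀ {z} → ι z ∈ vs φ₁ᶜ → z ∈ L
      toL₁ p = toL (en c) (cut-back e p)

      keep : ∀ {z w} → Same φ₁ᶜ (ι z) (ι w) → γ₁ z ≡ γ₁ w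
      keep q = closed J₁ (toL₁ (same∈ q)) (toL₁ (same∈ʳ q)) (inj₁ q)

      keep' : ∀ {z w} → Same φ' (ι z) (ι w) → γ₁ z ≡ γ₁ w
      keep' q = closed J₁ (toL (en c) (lab' (st c) (same∈ q))) (toL (en c) (lab' (st c) (same∈ʳ q))) (inj₂ q)

      sameS : ∀ {z w} → ι z ∈ vsT s → ι w ∈ vsT s → Same φ₁ᶜ (ι z) (ι w)
      sameS p q = here (∈-⟨⟩ s p , ∈-⟨⟩ s q)

      sameT : ∀ {z w} → ι z ∈ vsT t → ι w ∈ vsT t → Same φ₁ᶜ (ι z) (ι w)
      sameT p q = there (here (∈-⟨⟩ t p , ∈-⟨⟩ t q))

      joined : γ₁ a ≡ γ₁ b → Res
      joined q =
        let σ , w , sq , l , i = ih c (state-cut e (st c) uc mG) (+-monoˡ-≤ (wt φ') (subst (wt φ₁ᶜ <_) (sym (wt-≃ e)) (wt-cut s t ψ))) L γ₁ (toL (en c) aφ)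
              (record { toL = toL₁ ; fromL = λ p → cut-forth e (fromL (en c) p) ; uniqL = uniqL (en c) }) J₁
        in x ∷ σ , suc w , c2 {F = F} {F'} {G} {F'} {x} (C2-of stp) sq , ≤-trans l (n≤1+n _) , (begin
          suc w + (length φ + length φ') ≡⟨ cong (λ n → suc w + (n + length φ')) (lenE e) ⟩
          suc w + (suc (length ψ) + length φ') ≡⟨ +-suc w _ ⟨
          w + (suc (suc (length ψ)) + length φ') ≤⟨ i ⟩
          cnt col L + cnt γ₁ L ≤⟨ +-monoʳ-≤ (cnt col L) (join-≤ (jo c) γ₁ hh) ⟩
          cnt col L + cnt γ L ∎)
        where
        open ≤-Reasoning
        go : ∀ {z w} → SameCut e z w → γ₁ z ≡ γ₁ w
        go (kept r) = keep r
        go (across p r) = trans (keep (sameS p a∈)) (trans q (keep (sameT b∈ r)))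
        go (back p r) = trans (keep (sameT p b∈)) (trans (sym q) (keep (sameS a∈ r)))
        hh : ∀ {z w} → z ∈ L → w ∈ L → Linked φ φ' z w → γ₁ z ≡ γ₁ w
        hh _ _ (inj₁ r) = go (same-cut e r)
        hh _ _ (inj₂ r) = keep' r

    module _ (nq : γ₁ a ≢ γ₁ b) where

      private
        U W₁ W₂ : X k → Bool
        U z = eqb (γ₁ z) (γ₁ a)
        W₁ z = W z ∧ U z
        W₂ z = W z ∧ not (U z)

        U₁ : Closed U φ₁ᶜ
        U₁ q = cong (λ g → eqb g (γ₁ a)) (keep q)

        U' : Closed U φ'
        U' q = cong (λ g → eqb g (γ₁ a)) (keep' q)

        Us : ∀ {z} → ι z ∈ vsT s → U z ≡ true
        Us p = trans (U₁ (sameS p a∈)) (eqb-refl (γ₁ a))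

        Ut : ∀ {z} → ι z ∈ vsT t → U z ≡ false
        Ut p = trans (U₁ (sameT p b∈)) (eqb-≢ (λ z → nq (sym z)))

        ∧₁ : ∀ {a b} → a ∧ b ≡ true → a ≡ true
        ∧₁ {true} _ = refl

        dead : ∀ {p q} → q ≡ false → p ∧ q ≡ false
        dead {true} refl = refl
        dead {false} refl = refl

        take₁ : (∀ {z} → ι z ∈ vsT s → W z ≡ true) → Closed W₁ ψ → Closed W₁ φ' → Res
        take₁ h c₁ c₂ = sm W₁ (size-< L (λ _ → ∧₁) (toL (en c) bφ) Wb (dead {W b} (Ut b∈))) aφ (cong₂ _∧_ Wa (Us a∈))
          (inj₂ (cut-at e (λ p → cong₂ _∧_ (h p) (Us p)) (λ {z} p → dead {W z} (Ut p)) c₁ , c₂))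

        take₂ : (∀ {z} → ι z ∈ vsT t → W z ≡ true) → Closed W₂ ψ → Closed W₂ φ' → Res
        take₂ h c₁ c₂ = sm W₂ (size-< L (λ _ → ∧₁) (toL (en c) aφ) Wa (dead {W a} (cong not (Us a∈)))) bφ (cong₂ _∧_ Wb (cong not (Ut b∈)))
          (inj₂ (cut-at (reroot uφ e sw) (λ p → cong₂ _∧_ (h p) (cong not (Ut p))) (λ {z} p → dead {W z} (cong not (Us p))) c₁ , c₂))

        Uψ : Closed U ψ
        Uψ q = U₁ (there (there q))

        ψφ : ∀ {p q} → Same ψ p q → Same φ p q
        ψφ q = same← e (there q)

        compφ : ∀ {p q} → p ∈ vsT s ++ vsT t → q ∈ vsT s ++ vsT t → Same φ p q
        compφ p q = same← e (here (p , q))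

      split₁ : Closed W φ → Half W φ' → Res
      split₁ Wc H = go H
        where
        onS : ∀ {z} → ι z ∈ vsT s → W z ≡ true
        onS p = trans (Wc (compφ (∈-++⁺ˡ p) (∈-++⁺ˡ a∈))) Wa
        onT : ∀ {z} → ι z ∈ vsT t → W z ≡ true
        onT p = trans (Wc (compφ (∈-++⁺ʳ (vsT s) p) (∈-++⁺ˡ a∈))) Wa
        go : Half W φ' → Res
        go (uncut Wc') = take₁ onS (λ q → cong₂ _∧_ (Wc (ψφ q)) (Uψ q)) (λ q → cong₂ _∧_ (Wc' q) (U' q))
        go (cut-at {s'} {t'} {ψ'} e' _ _ Wψ) with U (label s') in eq
        ... | true = take₂ onT (λ q → cong₂ _∧_ (Wc (ψφ q)) (cong not (Uψ q))) (λ q → cl q (same→ e' q))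
          where
          cl : ∀ {z w} → Same φ' (ι z) (ι w) → Same (join s' t' ∷ ψ') (ι z) (ι w) → W₂ z ≡ W₂ w
          cl {z} {w} q (here (p , p')) = trans (dead {W z} (cong not (ut p))) (sym (dead {W w} (cong not (ut p'))))
            where
            ut : ∀ {y} → ι y ∈ vsT s' ++ vsT t' → U y ≡ true
            ut p = trans (U' (same← e' (here (p , ∈-++⁺ˡ (label∈ s'))))) eq
          cl q (there r) = cong₂ _∧_ (Wψ r) (cong not (U' q))
        ... | false = take₁ onS (λ q → cong₂ _∧_ (Wc (ψφ q)) (Uψ q)) (λ q → cl q (same→ e' q))
          where
          cl : ∀ {z w} → Same φ' (ι z) (ι w) → Same (join s' t' ∷ ψ') (ι z) (ι w) → W₁ z ≡ W₁ w
          cl {z} {w} q (here (p , p')) = trans (dead {W z} (ut p)) (sym (dead {W w} (ut p')))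
            where
            ut : ∀ {y} → ι y ∈ vsT s' ++ vsT t' → U y ≡ false
            ut p = trans (U' (same← e' (here (p , ∈-++⁺ˡ (label∈ s'))))) eq
          cl q (there r) = cong₂ _∧_ (Wψ r) (U' q)

      split₂ : Half W φ → Closed W φ' → Res
      split₂ (uncut Wc) Wc' = split₁ Wc (uncut Wc')
      split₂ (cut-at {s'} {t'} {ψ'} e' Ws Wt Wψ) Wc' = go (same? φ (ι a) (ι c₀))
        where
        c₀ : X k
        c₀ = label t'
        headφ : ∀ {v} → v ∈ vsT s' ++ vsT t' → Same φ v (ι c₀)
        headφ p = same← e' (here (p , ∈-++⁺ʳ (vsT s') (label∈ t')))
        ψ∌ : ∀ {v} → v ∈ vsT s ++ vsT t → v ∉ vs ψ
        ψ∌ p q = disjoint (vsT s ++ vsT t) (un (uniq-≃ e uφ)) p q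
        ψ'∌ : ∀ {v} → v ∈ vsT s' ++ vsT t' → v ∉ vs ψ'
        ψ'∌ p q = disjoint (vsT s' ++ vsT t') (un (uniq-≃ e' uφ)) p q
        inComp : ∀ {v} → Same φ v (ι a) → v ∈ vsT s ++ vsT t
        inComp q with same→ e q
        ... | here (p , _) = p
        ... | there r = ⊥-elim (ψ∌ (∈-++⁺ˡ a∈) (same∈ʳ r))
        Wcl₁ : Closed W ψ → Closed W₁ ψ
        Wcl₁ h q = cong₂ _∧_ (h q) (Uψ q)
        Wcl₂ : Closed W ψ → Closed W₂ ψ
        Wcl₂ h q = cong₂ _∧_ (h q) (cong not (Uψ q))
        F₁ : Closed W₁ φ'
        F₁ q = cong₂ _∧_ (Wc' q) (U' q)
        F₂ : Closed W₂ φ'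
        F₂ q = cong₂ _∧_ (Wc' q) (cong not (U' q))
        go : Dec (Same φ (ι a) (ι c₀)) → Res
        go (yes ac) = go' (findT (λ z → W z Data.Bool.≟ false) s) (findT (λ z → W z Data.Bool.≟ false) t)
          where
          Wψ₀ : Closed W ψ
          Wψ₀ q with same→ e' (ψφ q)
          ... | there r = Wψ r
          ... | here (p , _) = ⊥-elim (ψ∌ (inComp (same-trans uφ (headφ p) (same-sym ac))) (same∈ q))
          nf : ∀ {z} → W z ≢ false → W z ≡ true
          nf {z} n with W z
          ... | true = refl
          ... | false = ⊥-elim (n refl)
          inHead : ∀ {z} → ι z ∈ vsT s ++ vsT t → ι z ∈ vsT s' ⊎ ι z ∈ vsT t'
          inHead p with same→ e' (same-trans uφ (compφ p (∈-++⁺ˡ a∈)) ac)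
          ... | here (q , _) = ∈-++⁻ (vsT s') q
          ... | there r = ⊥-elim (ψ'∌ (∈-++⁺ʳ (vsT s') (label∈ t')) (same∈ʳ r))
          pos : ∀ {z} → ι z ∈ vsT s ++ vsT t → W z ≡ true → ι z ∈ vsT s'
          pos p q with inHead p
          ... | inj₁ m = m
          ... | inj₂ m with () ← trans (sym q) (Wt m)
          neg : ∀ {z} → ι z ∈ vsT s ++ vsT t → W z ≡ false → ι z ∈ vsT t'
          neg p q with inHead p
          ... | inj₂ m = m
          ... | inj₁ m with () ← trans (sym q) (Ws m)
          nst : ∀ {v} → v ∈ vsT s → v ∉ vsT t
          nst p q = disjoint (vsT s) (uniqueˡ (vsT s ++ vsT t) (un (uniq-≃ e uφ))) p q
          refute : ∀ {c d} → ι c ∈ vsT s → ι d ∈ vsT t → Conf (join s t ∷ ψ) (ι a) (ι b) (ι c) (ι d) → ⊥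
          refute c∈ d∈ (there r) = ψ∌ (∈-++⁺ˡ a∈) (∈-concatMap⁺ vsC (Any.map conf-∈ r))
          refute c∈ d∈ (here (u , left p , inj₁ ((_ , q) , _))) = nst (⊑-vs p q) b∈
          refute c∈ d∈ (here (u , left p , inj₂ ((_ , q) , _))) = nst (⊑-vs p q) d∈
          refute c∈ d∈ (here (u , right p , inj₁ ((q , _) , _))) = nst a∈ (⊑-vs p q)
          refute c∈ d∈ (here (u , right p , inj₂ ((q , _) , _))) = nst c∈ (⊑-vs p q)
          go' : (∃[ z ] ι z ∈ vsT s × W z ≡ false) ⊎ (∀ {z} → ι z ∈ vsT s → W z ≢ false)
              → (∃[ z ] ι z ∈ vsT t × W z ≡ false) ⊎ (∀ {z} → ι z ∈ vsT t → W z ≢ false) → Res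
          go' (inj₂ h) _ = take₁ (λ p → nf (h p)) (Wcl₁ Wψ₀) F₁
          go' (inj₁ _) (inj₂ h) = take₂ (λ p → nf (h p)) (Wcl₂ Wψ₀) F₂
          go' (inj₁ (p , p∈ , Wp)) (inj₁ (q , q∈ , Wq)) = ⊥-elim (refute p∈ q∈ (conf→ e (confRoot uφ e'
            (pos (∈-++⁺ˡ a∈) Wa) (pos (∈-++⁺ʳ (vsT s) b∈) Wb) (neg (∈-++⁺ˡ p∈) Wp) (neg (∈-++⁺ʳ (vsT s) q∈) Wq))))
        go (no nac) with U c₀ in eq
        ... | true = take₂ (λ p → onC (∈-++⁺ʳ (vsT s) p)) (λ q → cl q (same→ e' (ψφ q))) F₂
          where
          onC : ∀ {z} → ι z ∈ vsT s ++ vsT t → W z ≡ true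
          onC p with same→ e' (compφ p (∈-++⁺ˡ a∈))
          ... | here (_ , q) = ⊥-elim (nac (headφ q))
          ... | there r = trans (Wψ r) Wa
          cl : ∀ {z w} → Same ψ (ι z) (ι w) → Same (join s' t' ∷ ψ') (ι z) (ι w) → W₂ z ≡ W₂ w
          cl q (there r) = cong₂ _∧_ (Wψ r) (cong not (Uψ q))
          cl {z} {w} q (here (p , p')) = trans (dead {W z} (cong not (ut p))) (sym (dead {W w} (cong not (ut p'))))
            where
            ut : ∀ {y} → ι y ∈ vsT s' ++ vsT t' → U y ≡ true
            ut p with same→ e (headφ p)
            ... | here (_ , q') = ⊥-elim (nac (compφ (∈-++⁺ˡ a∈) q'))
            ... | there r = trans (Uψ r) eq
        ... | false = take₁ (λ p → onC (∈-++⁺ˡ p)) (λ q → cl q (same→ e' (ψφ q))) F₁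
          where
          onC : ∀ {z} → ι z ∈ vsT s ++ vsT t → W z ≡ true
          onC p with same→ e' (compφ p (∈-++⁺ˡ a∈))
          ... | here (_ , q) = ⊥-elim (nac (headφ q))
          ... | there r = trans (Wψ r) Wa
          cl : ∀ {z w} → Same ψ (ι z) (ι w) → Same (join s' t' ∷ ψ') (ι z) (ι w) → W₁ z ≡ W₁ w
          cl q (there r) = cong₂ _∧_ (Wψ r) (Uψ q)
          cl {z} {w} q (here (p , p')) = trans (dead {W z} (ut p)) (sym (dead {W w} (ut p')))
            where
            ut : ∀ {y} → ι y ∈ vsT s' ++ vsT t' → U y ≡ false
            ut p with same→ e (headφ p)
            ... | here (_ , q') = ⊥-elim (nac (compφ (∈-++⁺ˡ a∈) q'))
            ... | there r = trans (Uψ r) eq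

    cutStep₁ : Dec (γ₁ a ≡ γ₁ b) → Result F F' φ φ' col L γ
    cutStep₁ (yes q) = joined q
    cutStep₁ (no nq) = go pc
      where
      go : Piece W φ φ' → Result F F' φ φ' col L γ
      go (inj₁ (Wc , H)) = split₁ nq Wc H
      go (inj₂ (H , Wc')) = split₂ nq H Wc'

  cutStep : ∀ {F F' φ φ' col L γ} (c : Ctx F F' φ φ' col L γ) {W} → Smaller c W → Piece W φ φ'
    → ∀ {s t ψ} → φ ≃ (join s t ∷ ψ) → Uncrossed col s t → ∀ {a b} → ι a ∈ vsT s → ι b ∈ vsT t → W a ≡ true → W b ≡ true
    → ∀ {x G} → Move x F F' G F' → Models G (⟨ s ⟩ ∷ ⟨ t ⟩ ∷ ψ) → Result F F' φ φ' col L γ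
  cutStep {φ' = φ'} {L = L} c sm pc {s} {t} {ψ} e uc {a} {b} a∈ b∈ Wa Wb stp mG =
    let γ₁ , J₁ = join-exists ι inj₁-injective L (λ z w → same? (⟨ s ⟩ ∷ ⟨ t ⟩ ∷ ψ) (ι z) (ι w) ⊎-dec same? φ' (ι z) (ι w))
    in cutStep₁ c sm pc e uc a∈ b∈ Wa Wb stp mG γ₁ J₁ (γ₁ a ≟V γ₁ b)

module _ {k : ℕ} where

  nodeC : ∀ {w} {A B K : Tree k} → join (node w A B) K ≃C join A (node w B K)
  nodeC = ≃C-trans sw (≃C-trans mv' (≃C-trans sw fl))

  nodeC' : ∀ {w} {A B K : Tree k} → join (node w A B) K ≃C join B (node w A K)
  nodeC' = ≃C-trans sw (≃C-trans mv (≃C-trans sw fl))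

  flip : ∀ {w} {A B K : Tree k} → join (node w A B) K ≃C join (node w B A) K
  flip = ≃C-trans sw (≃C-trans fl sw)

  chPres : ∀ {φ x y} → Ch {k} φ x y → ∃[ t ] ∃[ ψ ] φ ≃ (join (leaf x) t ∷ ψ) × ι y ∈ vsT t
  chPres (pair e) = _ , _ , e , at₀
  chPres (cher e) = _ , _ , e , at₁

  chConf : ∀ {φ x z y b} → Distinct {k} φ → Ch φ x z → Same φ (ι x) (ι y) → Same φ (ι x) (ι b)
    → y ≢ x → y ≢ z → b ≢ x → b ≢ z → Conf φ (ι x) (ι z) (ι y) (ι b)
  chConf {φ} {x} {z} {y} {b} u ch sy sb yx yz bx bz = go ch
    where
    go : Ch φ x z → Conf φ (ι x) (ι z) (ι y) (ι b)
    go (pair {ψ} e) = ⊥-elim (elsewhere (same→ e sy))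
      where
      x∉ = Unique[x∷xs]⇒x∉xs (un (uniq-≃ e u))
      elsewhere : Same (join (leaf x) (leaf z) ∷ ψ) (ι x) (ι y) → ⊥
      elsewhere (here (_ , at₀)) = yx refl
      elsewhere (here (_ , at₁)) = yz refl
      elsewhere (there s) = x∉ (there (same∈ s))
    go (cher {v} {g} {ψ} e) = confRoot u (reroot u e mv) at₁ at₂ (ing sy yx yz) (ing sb bx bz)
      where
      x∉ = Unique[x∷xs]⇒x∉xs (un (uniq-≃ e u))
      ing : ∀ {y} → Same φ (ι x) (ι y) → y ≢ x → y ≢ z → ι y ∈ vsT g
      ing {y} s n n' = f (same→ e s)
        where
        f : Same (join (leaf x) (node v (leaf z) g) ∷ ψ) (ι x) (ι y) → ι y ∈ vsT g
        f (here (_ , at₀)) = ⊥-elim (n refl)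
        f (here (_ , at₂)) = ⊥-elim (n' refl)
        f (here (_ , there (there (there p)))) = p
        f (there r) = ⊥-elim (x∉ (∈-++⁺ʳ (inj₂ v ∷ ι z ∷ vsT g) (same∈ r)))

  data Small : Tree k → Set where
    one-leaf : ∀ {p} → Small (leaf p)
    two-leaf : ∀ {d p q} → Small (node d (leaf p) (leaf q))

  data Shape (φ : Forest k) (x y : X k) : Set where
    two-leaves  : ∀ {ψ} → φ ≃ (join (leaf x) (leaf y) ∷ ψ) → Shape φ x y
    star-tree : ∀ {ρ v ψ} → φ ≃ (join (leaf ρ) (node v (leaf x) (leaf y)) ∷ ψ) → Shape φ x y
    deep-tree : ∀ {w v D K ψ} → Small D → φ ≃ (join (node w (node v (leaf x) (leaf y)) D) K ∷ ψ) → Shape φ x y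

  shape-ch : ∀ {φ x y} → Distinct φ → Shape φ x y → Ch φ x y
  shape-ch u (two-leaves e) = pair e
  shape-ch u (star-tree e) = cher (reroot u e (≃C-trans sw nodeC))
  shape-ch u (deep-tree _ e) = cher (reroot u e (≃C-trans nodeC nodeC))

  shape-sym : ∀ {φ x y} → Distinct φ → Shape φ x y → Shape φ y x
  shape-sym u (two-leaves e) = two-leaves (reroot u e sw)
  shape-sym u (star-tree e) = star-tree (reroot u e fl)
  shape-sym u (deep-tree d e) = deep-tree d (reroot u e (≃C-trans nodeC (≃C-trans flip mv)))

  -- Only such labels x may fail to be fine (below) when an edge is cut at the root of the tree.
  data Near (x : X k) : Tree k → Set where
    near₀ : Near x (leaf x)
    near₁ : ∀ {u q} → Near x (node u (leaf x) q)
    near₂ : ∀ {u q} → Near x (node u q (leaf x))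

  parent : ∀ {y : X k} {v a b} → ι y ∈ vsT (node v a b) → ∃[ u ] ∃[ h ] (node u (leaf y) h ⊑ node v a b ⊎ node u h (leaf y) ⊑ node v a b)
  parent {a = a} (there p) with ∈-++⁻ (vsT a) p
  parent {v = v} {leaf _} {b} _ | inj₁ at₀ = v , b , inj₁ self
  parent {v = v} {a} {leaf _} _ | inj₂ at₀ = v , a , inj₂ self
  parent {a = node _ _ _} _ | inj₁ q with parent q
  ... | u , h , inj₁ s = u , h , inj₁ (inl s)
  ... | u , h , inj₂ s = u , h , inj₂ (inl s)
  parent {b = node _ _ _} _ | inj₂ q with parent q
  ... | u , h , inj₁ s = u , h , inj₁ (inr s)
  ... | u , h , inj₂ s = u , h , inj₂ (inr s)

  module _ {F F' : Graph k} {φ φ' : Forest k} {col : X k → V k} {L : List (X k)} {γ : X k → V k} (c : Ctx F F' φ φ' col L γ) where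

    private
      S : State F F' φ φ' col
      S = st c
      m : Models F φ
      m = mod S
      m' : Models F' φ'
      m' = mod' S
      u : Distinct φ
      u = dis m
      u' : Distinct φ'
      u' = dis m'

      Res : Set
      Res = Result F F' φ φ' col L γ

      toφ : ∀ {s t ψ v} → φ ≃ (join s t ∷ ψ) → v ∈ vsT s ++ vsT t → v ∈ vs φ
      toφ e p = ∈-resp-↭ (↭-sym (vsE e)) (∈-++⁺ˡ p)

      status : ∀ {x} → ι x ∈ vs φ' → (∃[ z ] Ch φ' x z) ⊎ NoCh φ' x
      status p = let t , ψ , e = noI' c p in chStatus u' e

      deg≢0 : ∀ {x} → ι x ∈ vs φ' → deg F' (ι x) ≢ 0
      deg≢0 {x} p q = let t , ψ , e = noI' c p in contra (trans (sym q) (deg-join (rep (models-≃ e m')) (uniq-≃ e u') at₀))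
        where
        contra : 0 ≡ 1 → ⊥
        contra ()

    common : ∀ {x y} → Ch φ x y → Ch φ' x y → Res
    common {x} {y} ch ch' =
      let t , ψ , e , y∈ = chPres ch
          t' , ψ' , e' , y∈' = chPres ch'
          rm = removeLeaf y m e y∈
          rm' = removeLeaf y m' e' y∈'
          n = ch-≢ u ch
      in removeBoth S (ih c) {x₁ = y} (toL (en c) (same∈ʳ (ch-∈ ch))) (λ q → n (sym q)) (en c) (jo c) (toL (en c) (same∈ (ch-∈ ch))) rm rm'
           (λ sq → c1 {F = F} {F'} {G rm} {G rm'} {x} ((y , cherry m ch , cherry m' ch') , ml rm , ml rm') sq)
           (λ _ _ _ _ → y , (λ q → n (sym q)) , ch-∈ ch , ch-∈ ch')

    Allowed : X k → X k → Set
    Allowed x y = ∀ G → MinusLeafEdge F x G ⊎ MinusLeafEdge F y G → ∃[ x' ] Move x' F F' G F'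

    config : ∀ {x y} → Ch φ x y → Ch φ' x y ⊎ Allowed x y
    config {x} {y} ch = go (status x∈) (status y∈)
      where
      x∈ : ι x ∈ vs φ'
      x∈ = lab S (same∈ (ch-∈ ch))
      y∈ : ι y ∈ vs φ'
      y∈ = lab S (same∈ʳ (ch-∈ ch))
      go : (∃[ z ] Ch φ' x z) ⊎ NoCh φ' x → (∃[ z ] Ch φ' y z) ⊎ NoCh φ' y → Ch φ' x y ⊎ Allowed x y
      go (inj₁ (z , cz)) _ with z ≟F y
      ... | yes refl = inj₁ cz
      ... | no n = inj₂ (λ G mn → x , move₂ (inj₁ (y , cherry m ch , inj₁ ((z , cherry m' cz , n) , ≈G-refl {G = F'} , inj₁ mn))))
      go (inj₂ nx) (inj₁ (z , cz)) with z ≟F x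
      ... | yes refl = inj₁ (ch-sym u' cz)
      ... | no n = inj₂ (λ G mn → y , move₂ (inj₁ (x , cherry m (ch-sym u ch) , inj₁ ((z , cherry m' cz , n) , ≈G-refl {G = F'} , inj₁ (Data.Sum.swap mn)))))
      go (inj₂ nx) (inj₂ ny) with same? φ' (ι x) (ι y)
      ... | yes s = inj₂ (λ G mn → x , move₂ (inj₁ (y , cherry m ch , inj₂ (inj₁ (leaf-label (rep m') u' (pro m') x∈ , leaf-label (rep m') u' (pro m') y∈
              , same-reach (rep m') s , no-cherry m' nx , no-cherry m' ny , inj₁ (≈G-refl {G = F'} , mn))))))
      ... | no n = inj₂ (λ G mn → x , move₂ (inj₁ (y , cherry m ch , inj₂ (inj₂ (vφ (rep m') x∈ , vφ (rep m') y∈ , (λ r → n (reach-same (rep m') u' r))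
              , deg≢0 x∈ , deg≢0 y∈ , no-cherry m' nx , no-cherry m' ny , ≈G-refl {G = F'} , mn)))))

    module _ {W : X k → Bool} (sm : Smaller c W) (pc : Piece W φ φ') where

      leafCut : ∀ {x t ψ} → φ ≃ (join (leaf x) t ∷ ψ) → Uncrossed col (leaf x) t → W x ≡ true → ∀ {b} → ι b ∈ vsT t → W b ≡ true
        → (∀ G → MinusLeafEdge F x G → ∃[ x' ] Move x' F F' G F') → Res
      leafCut e uc Wx b∈ Wb ok =
        let G , mn , mG = cutLeafEdge (models-≃ e m)
            x' , mo = ok G mn
        in cutStep c sm pc e uc at₀ b∈ Wx Wb mo mG

      -- If classes crossed both pendant edges of the cherry, they would meet in its third edge.
      split-cherry : ∀ {x y} → Ch φ x y → col x ≢ col y → W x ≡ true → W y ≡ true → Res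
      split-cherry {x} {y} ch n Wx Wy = go (config ch)
        where
        go₂ : Allowed x y → Ch φ x y → Res
        go₂ al (pair e) = leafCut e (λ { at₀ at₀ → n }) Wx at₀ Wy (λ G mn → al G (inj₁ mn))
        go₂ al (cher {v} {g} e) = go₃ (findT (λ z → col z ≟V col x) g)
          where
          go₃ : (∃[ z ] ι z ∈ vsT g × col z ≡ col x) ⊎ (∀ {z} → ι z ∈ vsT g → col z ≢ col x) → Res
          go₃ (inj₂ none) = leafCut e uc Wx at₁ Wy (λ G mn → al G (inj₁ mn))
            where
            uc : Uncrossed col (leaf x) (node v (leaf y) g)
            uc at₀ at₁ q = n q
            uc at₀ (there (there p)) q = none p (sym q)
          go₃ (inj₁ (p , p∈ , pc')) = leafCut (reroot u e (≃C-trans mv' sw)) uc Wy at₁ Wx (λ G mn → al G (inj₂ mn))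
            where
            uc : Uncrossed col (leaf y) (node v (leaf x) g)
            uc at₀ at₁ q = n (sym q)
            uc at₀ (there (there r)) q = n (disj (res S)
              (confRoot u (reroot u e mv) at₁ at₂ p∈ r) (sym pc') q)
        go : Ch φ' x y ⊎ Allowed x y → Res
        go (inj₁ ch') = common ch ch'
        go (inj₂ al) = go₂ al ch

      Good : X k → Set
      Good x = ∀ {v h g ψ} → φ' ≃ (join (leaf x) (node v h g) ∷ ψ) → ∃[ a ] ι a ∈ vsT h × W a ≡ true

      branchCut : ∀ {x y} → Ch φ x y → col x ≡ col y → NoCh φ' x → NoCh φ' y → Good x → W x ≡ true
        → ∀ {v h g ψ} → φ' ≃ (join (leaf x) (node v h g) ∷ ψ) → ι y ∈ vsT g → (∀ {p} → ι p ∈ vsT h → col p ≢ col x) → Res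
      branchCut {x} {y} ch xy nx ny gd Wx {v} {h} {g} {ψ} e y∈ none =
        let a , a∈ , Wa = gd e
            G' , mn , mG' = cutEdge (models-≃ e₁ m')
            mo : Move x F' F G' F
            mo = move₂ (inj₂ (y , cherry m ch , inj₂ (inj₁ (leaf-label (rep m') u' (pro m') x∈ , leaf-label (rep m') u' (pro m') yφ'
              , same-reach (rep m') (same← e (here (at₀ , there (there (∈-++⁺ʳ (vsT h) y∈)))))
              , no-cherry m' nx , no-cherry m' ny
              , inj₂ (≈G-refl {G = F} , inj₂ v , rt h , link-adj (rep me) at₀ (inj₁ refl) , link-adj (rep me) at₁ (inj₁ refl)
                , off-path me y∈ , mn)))))
        in result-sym {φ = φ'} {φ} {col} {L} {γ} (cutStep (ctx-sym c) (smaller-sym c sm) (piece-sym pc) e₁ uc at₁ a∈ Wx Wa mo mG')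
        where
        me : Models F' (join (leaf x) (node v h g) ∷ ψ)
        me = models-≃ e m'
        e₁ : φ' ≃ (join (node v (leaf x) g) h ∷ ψ)
        e₁ = reroot u' e mv'
        x∈ : ι x ∈ vs φ'
        x∈ = lab S (same∈ (ch-∈ ch))
        yφ' : ι y ∈ vs φ'
        yφ' = lab S (same∈ʳ (ch-∈ ch))
        uc : Uncrossed col (node v (leaf x) g) h
        uc at₁ p q = none p (sym q)
        uc {z} {p} (there (there r)) p∈ q = none p∈ (disj (res' S)
          (confRoot u' (reroot u' e mv) (there (∈-++⁺ʳ (ι x ∷ []) p∈)) at₁ r y∈) (sym q) xy)

      -- The branches of φ' next to x and next to y do not both contain a leaf of the class of x,
      -- since φ and φ' would resolve the resulting quartet differently.
      no-cherries : ∀ {x y} → Ch φ x y → col x ≡ col y → NoCh φ' x → NoCh φ' y → Good x → Good y → W x ≡ true → W y ≡ true → Res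
      no-cherries {x} {y} ch xy nx ny gx gy Wx Wy = go nx
        where
        n : x ≢ y
        n = ch-≢ u ch
        x∈ : ι x ∈ vs φ'
        x∈ = lab S (same∈ (ch-∈ ch))
        y∈ : ι y ∈ vs φ'
        y∈ = lab S (same∈ʳ (ch-∈ ch))
        rooted : ∀ {v h v₂ a b ψ} → φ' ≃ (join (leaf x) (node v h (node v₂ a b)) ∷ ψ) → ι y ∈ vsT (node v₂ a b) → Res
        rooted {v} {h} {v₂} {a} {b} {ψ} e y∈g = go₁ (parent y∈g)
          where
          g = node v₂ a b
          uh : Unique (ι x ∷ inj₂ v ∷ (vsT h ++ vsT g) ++ vs ψ)
          uh = un (uniq-≃ e u')
          u₂ : Unique ((vsT h ++ vsT g) ++ vs ψ)
          u₂ with uh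
          ... | _ ∷ _ ∷ q = q
          h∌ : ∀ {w} → w ∈ vsT h → w ∉ vsT g
          h∌ p q = disjoint (vsT h) (uniqueˡ (vsT h ++ vsT g) u₂) p q
          x∌ : ∀ {w} → ι w ∈ vsT h ++ vsT g → w ≢ x
          x∌ p refl = Unique[x∷xs]⇒x∉xs uh (there (∈-++⁺ˡ p))
          finish : ∀ {u₃ h₂ K ψ'} → (∀ {w} → w ∈ vsT h₂ → w ∈ vsT g × w ≢ ι y) → ι x ∈ vsT K → (∀ {w} → w ∈ vsT h → w ∈ vsT K)
            → φ' ≃ (join (node u₃ (leaf y) h₂) K ∷ ψ') → Res
          finish {u₃} {h₂} {K} h₂g x∈K hK em = go₂ (findT (λ z → col z ≟V col x) h)
            where
            go₂ : (∃[ z ] ι z ∈ vsT h × col z ≡ col x) ⊎ (∀ {z} → ι z ∈ vsT h → col z ≢ col x) → Res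
            go₂ (inj₂ none) = branchCut ch xy nx ny gx Wx e y∈g none
            go₂ (inj₁ (p , p∈ , cp)) = go₃ (findT (λ z → col z ≟V col x) h₂)
              where
              in' : ∀ {w} → ι w ∈ vsT h ++ vsT g → ι w ∈ vs φ
              in' q = lab' S (∈-resp-↭ (↭-sym (vsE e)) (there (there (∈-++⁺ˡ q))))
              go₃ : (∃[ z ] ι z ∈ vsT h₂ × col z ≡ col x) ⊎ (∀ {z} → ι z ∈ vsT h₂ → col z ≢ col x) → Res
              go₃ (inj₂ none) = branchCut (ch-sym u ch) (sym xy) ny nx gy Wy (reroot u' em nodeC) x∈K (λ q r → none q (trans r (sym xy)))
              go₃ (inj₁ (q , q∈ , cq)) = ⊥-elim (agree S
                (chConf u ch (conn (res S) (lab' S x∈) (in' (∈-++⁺ˡ p∈)) (sym cp)) (conn (res S) (lab' S x∈) (in' (∈-++⁺ʳ (vsT h) q∈g)) (sym cq))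
                  (x∌ (∈-++⁺ˡ p∈)) (λ { refl → h∌ p∈ y∈g }) (x∌ (∈-++⁺ʳ (vsT h) q∈g)) (λ { refl → proj₂ (h₂g q∈) refl }))
                (confRoot u' (reroot u' em sw) x∈K (hK p∈) at₁ (there (there q∈)))
                xy (sym cp) (sym cq))
                where
                q∈g : ι q ∈ vsT g
                q∈g = proj₁ (h₂g q∈)
          go₁ : (∃[ u₃ ] ∃[ h₂ ] (node u₃ (leaf y) h₂ ⊑ g ⊎ node u₃ h₂ (leaf y) ⊑ g)) → Res
          go₁ (u₃ , h₂ , inj₁ s) =
            let K , eq , i = expose g s (node v (leaf x) h)
                em = reroot u' (reroot u' e mv) eq
                q = un (uniq-≃ em u')
            in finish (λ p → ⊑-vs s (there (there p)) , (λ { refl → y∉ h₂ (uniqueˡ (vsT (node u₃ (leaf y) h₂)) (uniqueˡ (vsT (node u₃ (leaf y) h₂) ++ vsT K) q)) p }))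
                 (i at₁) (λ p → i (there (there p))) em
            where
            y∉ : ∀ h₂ → Unique (inj₂ u₃ ∷ ι y ∷ vsT h₂) → ι y ∉ vsT h₂
            y∉ h₂ (_ ∷ q) = Unique[x∷xs]⇒x∉xs q
          go₁ (u₃ , h₂ , inj₂ s) =
            let K , eq , i = expose g s (node v (leaf x) h)
                em = reroot u' (reroot u' (reroot u' e mv) eq) flip
                q = un (uniq-≃ em u')
            in finish (λ p → ⊑-vs s (there (∈-++⁺ˡ p)) , (λ { refl → y∉ h₂ (uniqueˡ (vsT (node u₃ (leaf y) h₂)) (uniqueˡ (vsT (node u₃ (leaf y) h₂) ++ vsT K) q)) p }))
                 (i at₁) (λ p → i (there (there p))) em
            where
            y∉ : ∀ h₂ → Unique (inj₂ u₃ ∷ ι y ∷ vsT h₂) → ι y ∉ vsT h₂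
            y∉ h₂ (_ ∷ q) = Unique[x∷xs]⇒x∉xs q
        go : NoCh φ' x → Res
        go (noch {v} {v₁} {a} {b} {v₂} {a₂} {b₂} {ψ} e) = side (same→ e (conn (res' S) x∈ y∈ xy))
          where
          side : Same (join (leaf x) (node v (node v₁ a b) (node v₂ a₂ b₂)) ∷ ψ) (ι x) (ι y) → Res
          side (here (_ , at₀)) = ⊥-elim (n refl)
          side (there s) = ⊥-elim (Unique[x∷xs]⇒x∉xs (un (uniq-≃ e u')) (∈-++⁺ʳ (vsT (node v (node v₁ a b) (node v₂ a₂ b₂))) (same∈ s)))
          side (here (_ , there (there p))) with ∈-++⁻ (vsT (node v₁ a b)) p
          ... | inj₂ q = rooted e q
          ... | inj₁ q = rooted (reroot u' e fl) q

      -- A further leaf b of the class would give the quartets xy|zb in φ and xz|yb in φ'; this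
      -- leaves an edge near the cherry (x,y) that no class crosses.
      deep-cherry : Closed W φ → ∀ {x y z} → Shape φ x y → col x ≡ col y → Ch φ' x z → z ≢ y → col x ≡ col z → W x ≡ true → Res
      deep-cherry Wc {x} {y} {z} sh xy cz zy xz Wx = go sh
        where
        z≢x : z ≢ x
        z≢x q = ch-≢ u' cz (sym q)
        xφ : ι x ∈ vs φ
        xφ = lab' S (same∈ (ch-∈ cz))
        sxz : Same φ (ι x) (ι z)
        sxz = conn (res S) xφ (lab' S (same∈ʳ (ch-∈ cz))) xz
        y≢x : y ≢ x
        y≢x q = ch-≢ u (shape-ch u sh) (sym q)
        yφ : ι y ∈ vs φ
        yφ = same∈ʳ (ch-∈ (shape-ch u sh))
        quartet : ∀ {b} → ι b ∈ vs φ → b ≢ x → b ≢ y → b ≢ z → col x ≡ col b → Conf φ (ι x) (ι y) (ι z) (ι b) → ⊥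
        quartet b∈ bx by bz xb cf = agree S cf (chConf u' cz (conn (res' S) (lab S xφ) (lab S yφ) xy) (conn (res' S) (lab S xφ) (lab S b∈) xb)
          y≢x (λ q → zy (sym q)) bx bz) xy xz xb
        go : Shape φ x y → Res
        go (two-leaves {ψ} e) = ⊥-elim (elsewhere (same→ e sxz))
          where
          elsewhere : Same (join (leaf x) (leaf y) ∷ ψ) (ι x) (ι z) → ⊥
          elsewhere (here (_ , at₀)) = z≢x refl
          elsewhere (here (_ , at₁)) = zy refl
          elsewhere (there s) = Unique[x∷xs]⇒x∉xs (un (uniq-≃ e u)) (there (same∈ s))
        go (star-tree {ρ} {v} {ψ} e) = isρ (same→ e sxz)
          where
          isρ : Same (join (leaf ρ) (node v (leaf x) (leaf y)) ∷ ψ) (ι x) (ι z) → Res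
          isρ (here (_ , at₀)) = common (cher (reroot u e (≃C-trans sw (≃C-trans nodeC fl)))) cz
          isρ (here (_ , at₂)) = ⊥-elim (z≢x refl)
          isρ (here (_ , at₃)) = ⊥-elim (zy refl)
          isρ (there s) = ⊥-elim (disjoint (ι ρ ∷ inj₂ v ∷ ι x ∷ ι y ∷ []) (un (uniq-≃ e u)) at₂ (same∈ s))
        go (deep-tree {w} {v} {D} {K} {ψ} d e) = where-z (same→ e sxz)
          where
          C : Tree k
          C = node v (leaf x) (leaf y)
          eC : φ ≃ (join C (node w D K) ∷ ψ)
          eC = reroot u e nodeC
          eD : φ ≃ (join D (node w C K) ∷ ψ)
          eD = reroot u e nodeC'
          uu : Unique ((inj₂ w ∷ inj₂ v ∷ ι x ∷ ι y ∷ vsT D) ++ vsT K)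
          uu = uniqueˡ ((inj₂ w ∷ inj₂ v ∷ ι x ∷ ι y ∷ vsT D) ++ vsT K) (un (uniq-≃ e u))
          uxy : Unique (ι x ∷ ι y ∷ vsT D ++ vsT K)
          uxy with uu
          ... | _ ∷ _ ∷ q = q
          notx : ∀ {b} → ι b ∈ vsT D ++ vsT K → b ≢ x
          notx p refl = Unique[x∷xs]⇒x∉xs uxy (there p)
          noty : ∀ {b} → ι b ∈ vsT D ++ vsT K → b ≢ y
          noty p refl with uxy
          ... | _ ∷ q = Unique[x∷xs]⇒x∉xs q p
          DK : ∀ {b} → b ∈ vsT D → b ∉ vsT K
          DK p q with uxy
          ... | _ ∷ _ ∷ r = disjoint (vsT D) r p q
          inφ : ∀ {b} → ι b ∈ vsT D ++ vsT K → ι b ∈ vs φ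
          inφ p = toφ e (there (there (there (there p))))
          xyDK : ∀ {b b'} → ι b ∈ vsT D ++ vsT K → ι b' ∈ vsT D ++ vsT K → Conf φ (ι x) (ι y) (ι b) (ι b')
          xyDK p q = confRoot u eC at₁ at₂ (there p) (there q)
          onW : ∀ {b} → ι b ∈ vsT D ++ vsT K → W b ≡ true
          onW p = trans (sym (Wc (same← e (here (at₂ , there (there (there (there p)))))))) Wx
          base : (∃[ z ] Cherry F' x z × z ≢ y)
          base = z , cherry m' cz , zy
          quart : ∀ {b} → ι z ∈ vsT D ++ vsT K → ι b ∈ vsT D ++ vsT K → b ≢ z → col x ≡ col b → ⊥
          quart z∈ b∈ n q = quartet (inφ b∈) (notx b∈) (noty b∈) n q (xyDK z∈ b∈)
          zK : ι z ∈ vsT K → Small D → Res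
          zK z∈ d = cutD d e eD uc (label∈ D) (onW (∈-++⁺ˡ (label∈ D)))
            where
            uc : Uncrossed col D (node w C K)
            uc {b} {b'} p q r = quart (∈-++⁺ʳ (vsT D) z∈) (∈-++⁺ˡ p) (λ { refl → DK p z∈ }) (sym (toX q r))
              where
              toX : ∀ {b'} → ι b' ∈ vsT (node w C K) → col b ≡ col b' → col b ≡ col x
              toX at₂ r = r
              toX at₃ r = trans r (sym xy)
              toX (there (there (there (there q)))) r =
                disj (res S) (confRoot u e (there (∈-++⁺ʳ (vsT C) p)) at₂ q z∈) r xz
            cutD : ∀ {D} → Small D → φ ≃ (join (node w C D) K ∷ ψ) → φ ≃ (join D (node w C K) ∷ ψ) → Uncrossed col D (node w C K) → ι (label D) ∈ vsT D → W (label D) ≡ true → Res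
            cutD (one-leaf {p}) e₀ eD' uc' onD' Wp = leafCut eD' uc' Wp at₂ Wx
              (λ G mn → x , move₂ (inj₁ (y , cherry m (shape-ch u sh) , inj₁ (base , ≈G-refl {G = F'} , inj₂ (inj₁ (p , inj₂ w , rt K , pendant3 m e₀ , inj₁ mn))))))
            cutD (two-leaf {d'} {p} {q}) e₀ eD' uc' onD' Wp =
              let G , mn , mG = cutEdge (models-≃ eD' m)
              in cutStep c sm pc eD' uc' onD' at₂ Wp Wx
                   {x} {G} (move₂ (inj₁ (y , cherry m (shape-ch u sh) , inj₁ (base , ≈G-refl {G = F'} , inj₂ (inj₂ (p , q , inj₂ w , rt K , pendant4 m e₀ , inj₂ (inj₂ (inj₂ d' , inj₂ w , pendant2 m eD' , mn)))))))) mG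
          pick : ∀ {d' p q} → φ ≃ (join (node w C (node d' (leaf p) (leaf q))) K ∷ ψ) → D ≡ node d' (leaf p) (leaf q) ⊎ D ≡ node d' (leaf q) (leaf p) → z ≡ p
            → (∀ G → MinusLeafEdge F q G → ∃[ x' ] Move x' F F' G F') → Res
          pick {d'} {p} {q} e₀ eqD refl ok = leafCut eq uc (onW q∈) at₁ (onW p∈) ok
            where
            mem : ∀ {D} → D ≡ node d' (leaf p) (leaf q) ⊎ D ≡ node d' (leaf q) (leaf p) → ι p ∈ vsT D × ι q ∈ vsT D
            mem (inj₁ refl) = at₁ , at₂
            mem (inj₂ refl) = at₂ , at₁
            p∈ : ι p ∈ vsT D ++ vsT K
            p∈ = ∈-++⁺ˡ (proj₁ (mem eqD))
            q∈ : ι q ∈ vsT D ++ vsT K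
            q∈ = ∈-++⁺ˡ (proj₂ (mem eqD))
            e₁ : φ ≃ (join (node d' (leaf p) (leaf q)) (node w C K) ∷ ψ)
            e₁ = reroot u e₀ nodeC'
            eq : φ ≃ (join (leaf q) (node d' (leaf p) (node w C K)) ∷ ψ)
            eq = reroot u e₁ nodeC'
            q≢p : q ≢ p
            q≢p refl with un (uniq-≃ eq u)
            ... | r = Unique[x∷xs]⇒x∉xs r at₁
            uc : Uncrossed col (leaf q) (node d' (leaf p) (node w C K))
            uc at₀ r s = quart p∈ q∈ q≢p (sym (toX r s))
              where
              toX : ∀ {b} → ι b ∈ vsT (node d' (leaf p) (node w C K)) → col q ≡ col b → col q ≡ col x
              toX at₁ s = trans s (sym xz)
              toX at₄ s = s
              toX at₅ s = trans s (sym xy)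
              toX (there (there (there (there (there (there r)))))) s =
                trans (disj (res S) (confRoot u e₁ at₂ at₁ (there (there (there (there r)))) at₂) s (sym xz)) (sym xz)
          zD : ∀ {D₀} → D₀ ≡ D → Small D₀ → ι z ∈ vsT D₀ → Res
          zD refl one-leaf at₀ =
            let G , mn , mG = cutEdge (models-≃ e m)
            in cutStep c sm pc e uc at₂ (label∈ K) Wx (onW (∈-++⁺ʳ (vsT D) (label∈ K)))
                 {x} {G} (move₂ (inj₁ (y , cherry m (shape-ch u sh) , inj₁ (base , ≈G-refl {G = F'} , inj₂ (inj₁ (z , inj₂ w , rt K , pendant3 m e , inj₂ mn)))))) mG
            where
            z∈ : ι z ∈ vsT D ++ vsT K
            z∈ = at₀
            uc : Uncrossed col (node w C D) K
            uc p q r = quart z∈ (∈-++⁺ʳ (vsT D) q) (λ { refl → DK at₀ q }) (trans (toX p) r)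
              where
              toX : ∀ {b} → ι b ∈ vsT (node w C D) → col x ≡ col b
              toX at₂ = refl
              toX at₃ = xy
              toX at₄ = xz
          zD refl (two-leaf {d'} {p} {q}) (there (here r)) = pick e (inj₁ refl) (inj₁-injective r)
            (λ G mn → x , move₂ (inj₁ (y , cherry m (shape-ch u sh) , inj₁ (base , ≈G-refl {G = F'} , inj₂ (inj₂ (p , q , inj₂ w , rt K , pendant4 m e , inj₂ (inj₁ mn)))))))
          zD refl (two-leaf {d'} {p} {q}) (there (there (here r))) = pick (reroot u e₂ (≃C-trans flip (≃C-trans mv flip))) (inj₂ refl) (inj₁-injective r)
            (λ G mn → x , move₂ (inj₁ (y , cherry m (shape-ch u sh) , inj₁ (base , ≈G-refl {G = F'} , inj₂ (inj₂ (p , q , inj₂ w , rt K , pendant4 m e , inj₁ mn))))))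
            where
            e₂ : φ ≃ (join (node d' (leaf p) (leaf q)) (node w C K) ∷ ψ)
            e₂ = eD
          where-z : Same (join (node w C D) K ∷ ψ) (ι x) (ι z) → Res
          where-z (there s) = ⊥-elim (disjoint (vsT (node w C D) ++ vsT K) (un (uniq-≃ e u)) at₂ (same∈ s))
          where-z (here (_ , at₂)) = ⊥-elim (z≢x refl)
          where-z (here (_ , at₃)) = ⊥-elim (zy refl)
          where-z (here (_ , there (there (there (there p))))) with ∈-++⁻ (vsT D) p
          ... | inj₁ q = zD refl d q
          ... | inj₂ q = zK q d

module _ {k : ℕ} where

  -- Every branch next to x in φ meets W, so a cut there has labels of W on both sides.
  Fine : (X k → Bool) → Forest k → X k → Set
  Fine W φ x = (∀ {v h g ψ} → φ ≃ (join (leaf x) (node v h g) ∷ ψ) → ∃[ a ] ι a ∈ vsT h × W a ≡ true) × (∀ {z} → Ch φ x z → W z ≡ true)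

  fine-whole : ∀ {W φ x} → Closed W φ → W x ≡ true → Fine W φ x
  fine-whole Wc Wx = (λ {v} {h} e → label h , label∈ h , trans (sym (Wc (same← e (here (at₀ , there (there (∈-++⁺ˡ (label∈ h)))))))) Wx)
    , (λ ch → trans (sym (Wc (ch-∈ ch))) Wx)

  module _ {W : X k → Bool} {φ ψ : Forest k} {s t : Tree k} {x : X k} (u : Distinct φ) (e : φ ≃ (join s t ∷ ψ)) (Ws : ∀ {x} → ι x ∈ vsT s → W x ≡ true)
    (Wt : ∀ {x} → ι x ∈ vsT t → W x ≡ false) (Wψ : Closed W ψ) (nx : ¬ Near x s) (Wx : W x ≡ true) where

    private
      tf : ∀ {b} → b ≡ true → b ≡ false → ⊥
      tf refl ()

      crossing : ∀ {z} → W z ≢ true → Same φ (ι x) (ι z) → ι x ∈ vsT s × ι z ∈ vsT t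
      crossing {z} n q with same→ e q
      ... | there r = ⊥-elim (n (trans (sym (Wψ r)) Wx))
      ... | here (p , p') with ∈-++⁻ (vsT s) p | ∈-++⁻ (vsT s) p'
      ... | inj₂ a | _ = ⊥-elim (tf Wx (Wt a))
      ... | inj₁ a | inj₁ b = ⊥-elim (n (Ws b))
      ... | inj₁ a | inj₂ b = a , b

      other : ∀ (a b : Tree k) {v} → Unique (vsT (node v a b)) → ι x ∈ vsT (node v a b) → ∃[ y ] ι y ∈ vsT (node v a b) × y ≢ x
      other a b (_ ∷ q) (there p) with ∈-++⁻ (vsT a) p
      ... | inj₁ m = label b , there (∈-++⁺ʳ (vsT a) (label∈ b)) , (λ { refl → disjoint (vsT a) q m (label∈ b) })
      ... | inj₂ m = label a , there (∈-++⁺ˡ (label∈ a)) , (λ { refl → disjoint (vsT a) q (label∈ a) m })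

      module _ {v : ℕ} {h g : Tree k} {ψ₁ : Forest k} (e₁ : φ ≃ (join (leaf x) (node v h g) ∷ ψ₁)) (none : ∀ {a} → ι a ∈ vsT h → W a ≢ true) where

        uh : Unique (ι x ∷ inj₂ v ∷ (vsT h ++ vsT g) ++ vs ψ₁)
        uh = un (uniq-≃ e₁ u)

        hg : ∀ {w} → w ∈ vsT h → w ∉ vsT g
        hg p q with uh
        ... | _ ∷ _ ∷ r = disjoint (vsT h) (uniqueˡ (vsT h ++ vsT g) r) p q

        x∉ : ι x ∉ inj₂ v ∷ (vsT h ++ vsT g) ++ vs ψ₁
        x∉ = Unique[x∷xs]⇒x∉xs uh

        in-g : ∀ {y} → y ≢ x → W y ≡ true → Same φ (ι x) (ι y) → ι y ∈ vsT g
        in-g n Wy q with same→ e₁ q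
        ... | there r = ⊥-elim (x∉ (there (∈-++⁺ʳ (vsT h ++ vsT g) (same∈ r))))
        ... | here (_ , at₀) = ⊥-elim (n refl)
        ... | here (_ , there (there p)) with ∈-++⁻ (vsT h) p
        ... | inj₁ a = ⊥-elim (none a Wy)
        ... | inj₂ b = b

        refute : ∀ {x₁ c z} → ι x₁ ∈ vsT g → ι c ∈ vsT g → ι z ∈ vsT h → Conf (join (leaf x) (node v h g) ∷ ψ₁) (ι x) (ι x₁) (ι c) (ι z) → ⊥
        refute a b d (there r) = x∉ (there (∈-++⁺ʳ (vsT h ++ vsT g) (∈-concatMap⁺ vsC (Any.map conf-∈ r))))
        refute a b d (here (_ , left self , inj₁ ((_ , at₀) , _))) = x∉ (there (∈-++⁺ˡ (∈-++⁺ʳ (vsT h) a)))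
        refute a b d (here (_ , left self , inj₂ ((at₀ , _) , _))) = x∉ (there (∈-++⁺ˡ (∈-++⁺ʳ (vsT h) b)))
        refute a b d (here (_ , right self , inj₁ ((p , _) , _))) = x∉ (there (∈-++⁺ˡ (tl p)))
          where
          tl : ι x ∈ inj₂ v ∷ vsT h ++ vsT g → ι x ∈ vsT h ++ vsT g
          tl (there p) = p
        refute a b d (here (_ , right self , inj₂ (_ , _ , (_ , q)))) = q (there (∈-++⁺ʳ (vsT h) a))
        refute a b d (here (_ , right (inl s) , inj₁ ((p , _) , _))) = x∉ (there (∈-++⁺ˡ (∈-++⁺ˡ (⊑-vs s p))))
        refute a b d (here (_ , right (inl s) , inj₂ ((p , _) , _))) = hg (⊑-vs s p) b
        refute a b d (here (_ , right (inr s) , inj₁ ((p , _) , _))) = x∉ (there (∈-++⁺ˡ (∈-++⁺ʳ (vsT h) (⊑-vs s p))))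
        refute a b d (here (_ , right (inr s) , inj₂ ((_ , p) , _))) = hg d (⊑-vs s p)

        core : ∀ {u₀ A B} → φ ≃ (join A (node u₀ B t) ∷ ψ) → ι x ∈ vsT A → (leaf x ≢ A) → (∀ {y} → ι y ∈ vsT A → W y ≡ true) → (∀ {y} → ι y ∈ vsT B → W y ≡ true)
          → ∀ {z} → ι z ∈ vsT h → ι z ∈ vsT t → ⊥
        core {A = leaf _} eA at₀ n WA WB z∈ z∈t = n refl
        core {u₀} {A@(node _ l r)} {B} eA x∈ n WA WB z∈ z∈t with other l r (uniqueˡ (vsT A) (uniqueˡ (vsT A ++ vsT (node u₀ B t)) (un (uniq-≃ eA u)))) x∈
        ... | x₁ , x₁∈ , x₁≢ = refute (in-g x₁≢ (WA x₁∈) (same← eA (here (∈-++⁺ˡ x∈ , ∈-++⁺ˡ x₁∈)))) (in-g c≢ (WB (label∈ B)) (same← eA (here (∈-++⁺ˡ x∈ , ∈-++⁺ʳ (vsT A) c∈)))) z∈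
            (conf→ e₁ (confRoot u eA x∈ x₁∈ c∈ (there (∈-++⁺ʳ (vsT B) z∈t))))
          where
          c∈ : ι (label B) ∈ vsT (node u₀ B t)
          c∈ = there (∈-++⁺ˡ (label∈ B))
          c≢ : label B ≢ x
          c≢ q = disjoint (vsT A) (uniqueˡ (vsT A ++ vsT (node u₀ B t)) (un (uniq-≃ eA u))) x∈ (subst (λ y → ι y ∈ vsT (node u₀ B t)) q c∈)

    fine-edge : Fine W φ x
    fine-edge = good , ch
      where
      good : ∀ {v h g ψ₁} → φ ≃ (join (leaf x) (node v h g) ∷ ψ₁) → ∃[ a ] ι a ∈ vsT h × W a ≡ true
      good {v} {h} {g} {ψ₁} e₁ with findT (λ z → W z Data.Bool.≟ true) h
      ... | inj₁ r = r
      ... | inj₂ none = ⊥-elim (go s e nx Ws (proj₁ cr))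
        where
        cr = crossing (none (label∈ h)) (same← e₁ (here (at₀ , there (there (∈-++⁺ˡ (label∈ h))))))
        go : ∀ s → φ ≃ (join s t ∷ ψ) → ¬ Near x s → (∀ {x} → ι x ∈ vsT s → W x ≡ true) → ι x ∈ vsT s → ⊥
        go (leaf _) e nx Ws at₀ = nx near₀
        go (node u₀ A B) e nx Ws (there p) with ∈-++⁻ (vsT A) p
        ... | inj₁ q = core e₁ none (reroot u e nodeC) q (λ { refl → nx near₁ }) (λ m → Ws (there (∈-++⁺ˡ m))) (λ m → Ws (there (∈-++⁺ʳ (vsT A) m))) (label∈ h) (proj₂ cr)
        ... | inj₂ q = core e₁ none (reroot u e nodeC') q (λ { refl → nx near₂ }) (λ m → Ws (there (∈-++⁺ʳ (vsT A) m))) (λ m → Ws (there (∈-++⁺ˡ m))) (label∈ h) (proj₂ cr)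
      ch : ∀ {z} → Ch φ x z → W z ≡ true
      ch (cher e₁) with good e₁
      ... | _ , at₀ , q = q
      ch {z} (pair {ψ₁} e₁) with W z Data.Bool.≟ true
      ... | yes q = q
      ... | no n = ⊥-elim (go s e nx Ws (proj₁ cr))
        where
        cr = crossing n (ch-∈ (pair e₁))
        end : ∀ {y} → y ≢ x → W y ≡ true → Same (join (leaf x) (leaf z) ∷ ψ₁) (ι x) (ι y) → ⊥
        end y≢ Wy (here (_ , at₀)) = y≢ refl
        end y≢ Wy (here (_ , at₁)) = n Wy
        end y≢ Wy (there r) = Unique[x∷xs]⇒x∉xs (un (uniq-≃ e₁ u)) (there (same∈ r))
        go : ∀ s → φ ≃ (join s t ∷ ψ) → ¬ Near x s → (∀ {x} → ι x ∈ vsT s → W x ≡ true) → ι x ∈ vsT s → ⊥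
        go (leaf _) e nx Ws at₀ = nx near₀
        go s@(node _ l r) e nx Ws p with other l r (uniqueˡ (vsT s) (uniqueˡ (vsT s ++ vsT t) (un (uniq-≃ e u)))) p
        ... | y , y∈ , y≢ = end y≢ (Ws y∈) (same→ e₁ (same← e (here (∈-++⁺ˡ p , ∈-++⁺ˡ y∈))))

  data DeepT (t : Tree k) : Set where
    cherryT : ∀ {v x y} → t ≡ node v (leaf x) (leaf y) → DeepT t
    subT : ∀ {w v x y D} → Small D → node w (node v (leaf x) (leaf y)) D ⊑ t ⊎ node w D (node v (leaf x) (leaf y)) ⊑ t → DeepT t

  deepT : ∀ v l r → DeepT (node v l r)
  deepT v (leaf x) (leaf y) = cherryT refl
  deepT v (leaf x) (node w a b) with deepT w a b
  ... | cherryT refl = subT one-leaf (inj₂ self)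
  ... | subT d s = subT d (Data.Sum.map inr inr s)
  deepT v (node w a b) (leaf x) with deepT w a b
  ... | cherryT refl = subT one-leaf (inj₁ self)
  ... | subT d s = subT d (Data.Sum.map inl inl s)
  deepT v (node w a b) (node w' a' b') with deepT w a b | deepT w' a' b'
  ... | subT d s | _ = subT d (Data.Sum.map inl inl s)
  ... | cherryT refl | subT d s = subT d (Data.Sum.map inr inr s)
  ... | cherryT refl | cherryT refl = subT two-leaf (inj₁ self)

  selectAt : ∀ {φ ρ v l r ψ} → Distinct φ → φ ≃ (join (leaf ρ) (node v l r) ∷ ψ)
    → ∃[ x ] ∃[ y ] Shape φ x y × ι x ∈ vsT (node v l r) × ι y ∈ vsT (node v l r)
  selectAt {ρ = ρ} {v} {l} {r} u e with deepT v l r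
  ... | cherryT refl = _ , _ , star-tree e , at₁ , at₂
  ... | subT {w} {v'} {x} {y} {D} d (inj₁ s) with expose (node v l r) s (leaf ρ)
  ... | K , eq , _ = x , y , deep-tree d (reroot u e eq) , ⊑-vs s at₂ , ⊑-vs s at₃
  selectAt {ρ = ρ} {v} {l} {r} u e | subT {w} {v'} {x} {y} {D} d (inj₂ s) with expose (node v l r) s (leaf ρ)
  ... | K , eq , _ = x , y , deep-tree d (reroot u (reroot u e eq) flip) , ⊑-vs s (there (∈-++⁺ʳ (vsT D) at₁)) , ⊑-vs s (there (∈-++⁺ʳ (vsT D) at₂))

  module _ {F F' : Graph k} {φ φ' : Forest k} {col : X k → V k} {L : List (X k)} {γ : X k → V k}
    (c : Ctx F F' φ φ' col L γ) {W : X k → Bool} (sm : Smaller c W) (Wc : Closed W φ) (H : Half W φ') where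

    private
      S : State F F' φ φ' col
      S = st c
      u : Distinct φ
      u = dis (mod S)
      u' : Distinct φ'
      u' = dis (mod' S)

      Res : Set
      Res = Result F F' φ φ' col L γ

      pc : Piece W φ φ'
      pc = inj₁ (Wc , H)

    three : ∀ {x y z} → Shape φ x y → Ch φ' x z → z ≢ y → W x ≡ true → W z ≡ true → Res
    three {x} {y} {z} sh cz zy Wx Wz = go (col x ≟V col y) (col x ≟V col z)
      where
      go : Dec (col x ≡ col y) → Dec (col x ≡ col z) → Res
      go (no n) _ = split-cherry c sm pc (shape-ch u sh) n Wx (trans (sym (Wc (ch-∈ (shape-ch u sh)))) Wx)
      go (yes _) (no n) = result-sym {φ = φ'} {φ} {col} {L} {γ} (split-cherry (ctx-sym c) (smaller-sym c sm) (piece-sym pc) cz n Wx Wz)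
      go (yes xy) (yes xz) = deep-cherry c sm pc Wc sh xy cz zy xz Wx

    handle : ∀ {x y} → Shape φ x y → Fine W φ' x → Fine W φ' y → W x ≡ true → Res
    handle {x} {y} sh fx fy Wx = go (col x ≟V col y) (status x∈) (status y∈)
      where
      ch : Ch φ x y
      ch = shape-ch u sh
      Wy : W y ≡ true
      Wy = trans (sym (Wc (ch-∈ ch))) Wx
      x∈ : ι x ∈ vs φ'
      x∈ = lab S (same∈ (ch-∈ ch))
      y∈ : ι y ∈ vs φ'
      y∈ = lab S (same∈ʳ (ch-∈ ch))
      status : ∀ {x} → ι x ∈ vs φ' → (∃[ z ] Ch φ' x z) ⊎ NoCh φ' x
      status p = let t , ψ , e = noI' c p in chStatus u' e
      go : Dec (col x ≡ col y) → (∃[ z ] Ch φ' x z) ⊎ NoCh φ' x → (∃[ z ] Ch φ' y z) ⊎ NoCh φ' y → Res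
      go (no n) _ _ = split-cherry c sm pc ch n Wx Wy
      go (yes xy) (inj₁ (z , cz)) _ with z ≟F y
      ... | yes refl = common c ch cz
      ... | no n = three sh cz n Wx (proj₂ fx cz)
      go (yes xy) (inj₂ nx) (inj₁ (z , cz)) with z ≟F x
      ... | yes refl = common c ch (ch-sym u' cz)
      ... | no n = three (shape-sym u sh) cz n Wy (proj₂ fy cz)
      go (yes xy) (inj₂ nx) (inj₂ ny) = no-cherries c sm pc ch xy nx ny (proj₁ fx) (proj₁ fy) Wx Wy

    fineAt : ∀ {ρ t ψ} → φ ≃ (join (leaf ρ) t ∷ ψ) → W ρ ≡ true → Fine W φ' ρ ⊎ (∃[ v ] ∃[ l ] ∃[ r ] t ≡ node v l r)
      → (∀ {x} → ι x ∈ vsT t → Fine W φ' x) → Res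
    fineAt {ρ} {t} e Wρ or f = go t e or f
      where
      W∈ : ∀ {t ψ x} → φ ≃ (join (leaf ρ) t ∷ ψ) → ι x ∈ vsT t → W x ≡ true
      W∈ e p = trans (sym (Wc (same← e (here (at₀ , there p))))) Wρ
      go : ∀ t {ψ} → φ ≃ (join (leaf ρ) t ∷ ψ) → Fine W φ' ρ ⊎ (∃[ v ] ∃[ l ] ∃[ r ] t ≡ node v l r) → (∀ {x} → ι x ∈ vsT t → Fine W φ' x) → Res
      go (leaf y) e (inj₁ fρ) f = handle (two-leaves e) fρ (f at₀) Wρ
      go (leaf y) e (inj₂ (_ , _ , _ , ())) f
      go (node v l r) e _ f = let x , y , sh , x∈ , y∈ = selectAt u e in handle sh (f x∈) (f y∈) (W∈ e x∈)

    allFine : ∀ {ρ} → ι ρ ∈ vs φ → W ρ ≡ true → (∀ {x} → Same φ (ι ρ) (ι x) → Fine W φ' x) → Res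
    allFine p Wρ f = let t , ψ , e = noI c p in
      fineAt e Wρ (inj₁ (f (same-refl p))) (λ q → f (same← e (here (at₀ , there q))))

    module _ {s t : Tree k} {ψ : Forest k} (e : φ' ≃ (join s t ∷ ψ)) (Ws : ∀ {x} → ι x ∈ vsT s → W x ≡ true) (Wt : ∀ {x} → ι x ∈ vsT t → W x ≡ false) (Wψ : Closed W ψ) where

      private
        fine : ∀ {x} → W x ≡ true → ¬ Near x s → Fine W φ' x
        fine Wx n = fine-edge {W} u' e Ws Wt Wψ n Wx

        sφ : ∀ {x} → ι x ∈ vsT s → ι x ∈ vs φ
        sφ p = lab' S (∈-resp-↭ (↭-sym (vsE e)) (∈-++⁺ˡ (∈-++⁺ˡ p)))

        only : ∀ {β} → ι β ∈ vsT s → (∀ {x} → Near x s → x ≡ β) → (∀ {y} → y ≢ β → ι y ∈ vsT s → ∃[ x ] ι x ∈ vsT s × x ≢ β × x ≢ y) → Res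
        only {β} β∈ nr more = let t , ψ , eβ = noI c (sφ β∈) in go t eβ
          where
          fine' : ∀ {x} → W x ≡ true → x ≢ β → Fine W φ' x
          fine' Wx n = fine Wx (λ q → n (nr q))
          go : ∀ t {ψ} → φ ≃ (join (leaf β) t ∷ ψ) → Res
          go t@(node v l r) eβ = fineAt eβ (Ws β∈) (inj₂ (v , l , r , refl)) (λ p → fine' (W∈ p) (λ { refl → Unique[x∷xs]⇒x∉xs (un (uniq-≃ eβ u)) (∈-++⁺ˡ p) }))
            where
            W∈ : ∀ {x} → ι x ∈ vsT t → W x ≡ true
            W∈ p = trans (sym (Wc (same← eβ (here (at₀ , there p))))) (Ws β∈)
          go (leaf y) {ψ₁} eβ with col β ≟V col y
          ... | no n = split-cherry c sm pc (pair eβ) n (Ws β∈) (trans (sym (Wc (ch-∈ (pair eβ)))) (Ws β∈))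
          ... | yes βy = allFine (sφ x∈) (Ws x∈) (λ q → fine' (trans (sym (Wc q)) (Ws x∈)) (λ { refl → apart q }))
            where
            y≢ : y ≢ β
            y≢ q = ch-≢ u (pair eβ) (sym q)
            Wy : W y ≡ true
            Wy = trans (sym (Wc (ch-∈ (pair eβ)))) (Ws β∈)
            y∈s : ι y ∈ vsT s
            y∈s = where-y (same→ e (conn (res' S) (lab S (sφ β∈)) (lab S (same∈ʳ (ch-∈ (pair eβ)))) βy))
              where
              where-y : Same (join s t ∷ ψ) (ι β) (ι y) → ι y ∈ vsT s
              where-y (there r) = ⊥-elim (disjoint (vsT s ++ vsT t) (un (uniq-≃ e u')) (∈-++⁺ˡ β∈) (same∈ r))
              where-y (here (_ , q)) with ∈-++⁻ (vsT s) q
              ... | inj₁ a = a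
              ... | inj₂ b with () ← trans (sym Wy) (Wt b)
            found = more y≢ y∈s
            x = proj₁ found
            x∈ = proj₁ (proj₂ found)
            x≢β = proj₁ (proj₂ (proj₂ found))
            x≢y = proj₂ (proj₂ (proj₂ found))
            apart : Same φ (ι x) (ι β) → ⊥
            apart q = f (same→ eβ q)
              where
              f : Same (join (leaf β) (leaf y) ∷ ψ₁) (ι x) (ι β) → ⊥
              f (here (here r , _)) = x≢β (inj₁-injective r)
              f (here (there (here r) , _)) = x≢y (inj₁-injective r)
              f (there r) = Unique[x∷xs]⇒x∉xs (un (uniq-≃ eβ u)) (there (same∈ʳ r))

      edgeStep : ∀ {s₀} → s₀ ≡ s → Res
      edgeStep {leaf β} refl = only {β} at₀ (λ { near₀ → refl }) (λ { n at₀ → ⊥-elim (n refl) })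
      edgeStep {node v₀ (leaf β) (leaf β')} refl = let t , ψ , eβ = noI c (sφ at₁) in go t eβ
        where
        ch' : Ch φ' β' β
        ch' = cher (reroot u' e nodeC')
        fine' : ∀ {x} → W x ≡ true → x ≢ β → x ≢ β' → Fine W φ' x
        fine' Wx n n' = fine Wx (λ { near₁ → n refl ; near₂ → n' refl })
        Wβ : W β ≡ true
        Wβ = Ws at₁
        go : ∀ t {ψ} → φ ≃ (join (leaf β) t ∷ ψ) → Res
        go (leaf y) eβ with y ≟F β'
        ... | yes refl = common c (ch-sym u (pair eβ)) ch'
        ... | no y≢ = go₂ (col β ≟V col y)
          where
          Wy : W y ≡ true
          Wy = trans (sym (Wc (ch-∈ (pair eβ)))) Wβ
          go₂ : Dec (col β ≡ col y) → Res
          go₂ (no n) = split-cherry c sm pc (pair eβ) n Wβ Wy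
          go₂ (yes βy) = ⊥-elim (f (same→ e (conn (res' S) (lab S (sφ at₁)) (lab S (same∈ʳ (ch-∈ (pair eβ)))) βy)))
            where
            f : Same (join (node v₀ (leaf β) (leaf β')) t ∷ ψ) (ι β) (ι y) → ⊥
            f (here (_ , at₁)) = ch-≢ u (pair eβ) refl
            f (here (_ , at₂)) = y≢ refl
            f (here (_ , there (there (there q)))) with () ← trans (sym Wy) (Wt q)
            f (there r) = disjoint (vsT s ++ vsT t) (un (uniq-≃ e u')) at₁ (same∈ r)
        go t₁@(node v l r) eβ = go₂ (selectAt u eβ)
          where
          W∈ : ∀ {x} → ι x ∈ vsT t₁ → W x ≡ true
          W∈ p = trans (sym (Wc (same← eβ (here (at₀ , there p))))) Wβ
          ≢β : ∀ {x} → ι x ∈ vsT t₁ → x ≢ β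
          ≢β p refl = Unique[x∷xs]⇒x∉xs (un (uniq-≃ eβ u)) (∈-++⁺ˡ p)
          go₂ : (∃[ x ] ∃[ y ] Shape φ x y × ι x ∈ vsT t₁ × ι y ∈ vsT t₁) → Res
          go₂ (x , y , sh , x∈ , y∈) with x ≟F β' | y ≟F β'
          ... | yes refl | _ = three sh ch' (λ q → ≢β y∈ (sym q)) (W∈ x∈) Wβ
          ... | no _ | yes refl = three (shape-sym u sh) ch' (λ q → ≢β x∈ (sym q)) (W∈ y∈) Wβ
          ... | no n | no n' = handle sh (fine' (W∈ x∈) (≢β x∈) n) (fine' (W∈ y∈) (≢β y∈) n') (W∈ x∈)
      edgeStep {node v₀ (leaf β) (node v₁ a b)} refl = only {β} at₁ (λ { near₁ → refl }) more
        where
        us : Unique (inj₂ v₀ ∷ ι β ∷ inj₂ v₁ ∷ vsT a ++ vsT b)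
        us = uniqueˡ (vsT s) (uniqueˡ (vsT s ++ vsT t) (un (uniq-≃ e u')))
        ≢β : ∀ {x} → ι x ∈ vsT a ++ vsT b → x ≢ β
        ≢β p refl with us
        ... | _ ∷ q = Unique[x∷xs]⇒x∉xs q (there p)
        more : ∀ {y} → y ≢ β → ι y ∈ vsT s → ∃[ x ] ι x ∈ vsT s × x ≢ β × x ≢ y
        more {y} n _ with label a ≟F y
        ... | no q = label a , there (there (there (∈-++⁺ˡ (label∈ a)))) , ≢β (∈-++⁺ˡ (label∈ a)) , q
        ... | yes refl = label b , there (there (there (∈-++⁺ʳ (vsT a) (label∈ b)))) , ≢β (∈-++⁺ʳ (vsT a) (label∈ b)) , ab
          where
          ab : label b ≢ label a
          ab q with us
          ... | _ ∷ _ ∷ _ ∷ r = disjoint (vsT a) r (label∈ a) (subst (λ z → ι z ∈ vsT b) q (label∈ b))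
      edgeStep {node v₀ (node v₁ a b) (leaf β)} refl = only {β} (there (∈-++⁺ʳ (vsT (node v₁ a b)) at₀)) (λ { near₂ → refl }) more
        where
        us : Unique (inj₂ v₀ ∷ inj₂ v₁ ∷ (vsT a ++ vsT b) ++ ι β ∷ [])
        us = uniqueˡ (vsT s) (uniqueˡ (vsT s ++ vsT t) (un (uniq-≃ e u')))
        ≢β : ∀ {x} → ι x ∈ vsT a ++ vsT b → x ≢ β
        ≢β p refl with us
        ... | _ ∷ _ ∷ q = disjoint (vsT a ++ vsT b) q p at₀
        more : ∀ {y} → y ≢ β → ι y ∈ vsT s → ∃[ x ] ι x ∈ vsT s × x ≢ β × x ≢ y
        more {y} n _ with label a ≟F y
        ... | no q = label a , there (there (∈-++⁺ˡ (∈-++⁺ˡ (label∈ a)))) , ≢β (∈-++⁺ˡ (label∈ a)) , q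
        ... | yes refl = label b , there (there (∈-++⁺ˡ (∈-++⁺ʳ (vsT a) (label∈ b)))) , ≢β (∈-++⁺ʳ (vsT a) (label∈ b)) , ab
          where
          ab : label b ≢ label a
          ab q with us
          ... | _ ∷ _ ∷ r = disjoint (vsT a) (uniqueˡ (vsT a ++ vsT b) r) (label∈ a) (subst (λ z → ι z ∈ vsT b) q (label∈ b))
      edgeStep {node v₀ (node v₁ a b) (node v₂ a' b')} refl =
        allFine (sφ (label∈ s)) (Ws (label∈ s)) (λ q → fine (trans (sym (Wc q)) (Ws (label∈ s))) (λ ()))

  pieceStep : ∀ {F F' φ φ' col L γ} (c : Ctx F F' φ φ' col L γ) {W} → Smaller c W → Closed W φ → Half W φ' → ∀ {x} → ι x ∈ vs φ → W x ≡ true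
    → Result F F' φ φ' col L γ
  pieceStep c sm Wc H@(uncut Wc') x∈ Wx = allFine c sm Wc H x∈ Wx (λ q → fine-whole Wc' (trans (sym (Wc q)) Wx))
  pieceStep c sm Wc H@(cut-at e Ws Wt Wψ) x∈ Wx = edgeStep c sm Wc H e Ws Wt Wψ refl

  pieceLoop : ∀ n {F F' : Graph k} {φ φ' col L γ} (c : Ctx F F' φ φ' col L γ) W → size W L < n → ∀ {x} → ι x ∈ vs φ → W x ≡ true → Piece W φ φ' → Result F F' φ φ' col L γ
  pieceLoop (suc n) {φ = φ} {φ'} {col} {L} {γ} c W (s≤s lt) {x} x∈ Wx pc = go pc
    where
    sm : Smaller c W
    sm W' lt' p q pc' = pieceLoop n c W' (≤-trans lt' lt) p q pc'
    go : Piece W φ φ' → Result _ _ φ φ' col L γ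
    go (inj₁ (Wc , H)) = pieceStep c sm Wc H x∈ Wx
    go (inj₂ (H , Wc')) = result-sym {φ = φ'} {φ} {col} {L} {γ} (pieceStep (ctx-sym c) (smaller-sym c sm) Wc' H (lab (st c) x∈) Wx)

  rep-single : ∀ {F : Graph k} {x} → Rep F (tree (leaf x) ∷ []) → SingleVertex F x
  rep-single {F} {x} r = (λ v → mk⇔ (λ p → f (vF r p)) (λ { refl → vφ r at₀ })) , none (edges F) (sums r one (λ _ _ → refl))
    where
    f : ∀ {v} → v ∈ ι x ∷ [] → v ≡ ι x
    f (here p) = p
    none : ∀ E → ΣE {k} one E ≡ 0 → E ≡ []
    none [] _ = refl

  compLabel : ∀ {c : Comp k} → ∃[ y ] ι y ∈ vsC c
  compLabel {tree t} = label t , label∈ t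
  compLabel {join s t} = label s , ∈-++⁺ˡ (label∈ s)

  isoStep : ∀ {F F' φ φ' col} → State F F' φ φ' col → Hyp φ φ' col → ∀ {L γ} → Enum φ L → Join L (Linked φ φ') γ
    → ∀ {x ψ} → φ ≃ (tree (leaf x) ∷ ψ) → Result F F' φ φ' col L γ
  isoStep {F} {F'} {φ} {φ'} {col} st ih {L} {γ} en J {x} {ψ} e = go (remove∈ x∈)
    where
    u = dis (mod st)
    u' = dis (mod' st)
    xφ : ι x ∈ vs φ
    xφ = ∈-resp-↭ (↭-sym (vsE e)) at₀
    x∈ : x ∈ L
    x∈ = toL en xφ
    rm : Removed F φ x
    rm = removeIso (mod st) e
    other : (∃[ ψ' ] φ' ≃ (tree (leaf x) ∷ ψ')) ⊎ (∃[ t' ] ∃[ ψ' ] φ' ≃ (join (leaf x) t' ∷ ψ'))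
    other = expose-leaf u' (pro (mod' st)) (lab st xφ)
    rmBy : (∃[ ψ' ] φ' ≃ (tree (leaf x) ∷ ψ')) ⊎ (∃[ t' ] ∃[ ψ' ] φ' ≃ (join (leaf x) t' ∷ ψ')) → Removed F' φ' x
    rmBy (inj₁ (ψ' , e')) = removeIso (mod' st) e'
    rmBy (inj₂ (t' , ψ' , e')) = removeLeaf (label t') (mod' st) e' (label∈ t')
    rm' : Removed F' φ' x
    rm' = rmBy other
    isolated : Isolated F x
    isolated = vφ (rep (mod st)) xφ , deg-head (rep-≃ e (rep (mod st))) (uniq-≃ e u) at₀
    onlyx : ∀ {z} → Same φ (ι x) (ι z) → z ≡ x
    onlyx s = f (same→ e s)
      where
      f : ∀ {z} → Same (tree (leaf x) ∷ ψ) (ι x) (ι z) → z ≡ x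
      f (here (_ , at₀)) = refl
      f (there r) = ⊥-elim (Unique[x∷xs]⇒x∉xs (un (uniq-≃ e u)) (same∈ r))
    go : ∃[ L' ] L ↭ x ∷ L' → Result F F' φ φ' col L γ
    go (x₁ ∷ L' , p) = removeBoth st ih {x₁ = x₁} (∈-resp-↭ (↭-sym p) at₁) x₁≢ en J x∈ rm rm'
        (λ sq → c3 {F = F} {F'} {G rm} {G rm'} {x} (inj₁ isolated , ml rm , ml rm') sq)
        (λ n s _ _ → ⊥-elim (n (onlyx s)))
      where
      x₁≢ : x₁ ≢ x
      x₁≢ refl = Unique[x∷xs]⇒x∉xs (unique-↭ p (uniqL en)) at₀
    go ([] , p) = x ∷ [] , 0 , done (rep-single repF) (rep-single repF') , ≤-reflexive (↭-length p) , ≤-reflexive (begin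
        length φ + length φ' ≡⟨ cong₂ _+_ (trans (lenE e) (cong suc (cong length ψ[]))) lenF' ⟩
        1 + 1 ≡⟨ cong₂ _+_ (cnt-↭ col p) (cnt-↭ γ p) ⟨
        cnt col L + cnt γ L ∎)
      where
      open ≡-Reasoning
      isx : ∀ {z} → ι z ∈ vs φ → z ≡ x
      isx q with ∈-resp-↭ p (toL en q)
      ... | here r = r
      empty : ∀ {χ φ₀} (ψ₀ : Forest k) → Distinct χ → χ ≃ (tree (leaf x) ∷ φ₀) → φ₀ ≡ ψ₀ → (∀ {z} → ι z ∈ vs χ → z ≡ x) → ψ₀ ≡ []
      empty [] _ _ _ _ = refl
      empty (c ∷ ψ₀) d e₀ refl h with compLabel {c}
      ... | y , y∈ with h (∈-resp-↭ (↭-sym (vsE e₀)) (there (∈-++⁺ˡ y∈)))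
      ... | refl = ⊥-elim (Unique[x∷xs]⇒x∉xs (un (uniq-≃ e₀ d)) (∈-++⁺ˡ y∈))
      ψ[] : ψ ≡ []
      ψ[] = empty ψ u e refl isx
      repF : Rep F (tree (leaf x) ∷ [])
      repF = subst (λ ψ → Rep F (tree (leaf x) ∷ ψ)) ψ[] (rep-≃ e (rep (mod st)))
      single' : ∃[ ψ' ] φ' ≃ (tree (leaf x) ∷ ψ') × ψ' ≡ []
      single' = f other
        where
        f : (∃[ ψ' ] φ' ≃ (tree (leaf x) ∷ ψ')) ⊎ (∃[ t' ] ∃[ ψ' ] φ' ≃ (join (leaf x) t' ∷ ψ')) → ∃[ ψ' ] φ' ≃ (tree (leaf x) ∷ ψ') × ψ' ≡ []
        f (inj₁ (ψ' , e')) = ψ' , e' , empty ψ' u' e' refl (λ q → isx (lab' st q))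
        f (inj₂ (t' , ψ' , e')) with isx (lab' st (∈-resp-↭ (↭-sym (vsE e')) (there (∈-++⁺ˡ (label∈ t')))))
        ... | q = ⊥-elim (Unique[x∷xs]⇒x∉xs (un (uniq-≃ e' u')) (∈-++⁺ˡ (subst (λ z → ι z ∈ vsT t') q (label∈ t'))))
      repF' : Rep F' (tree (leaf x) ∷ [])
      repF' = let ψ' , e' , q = single' in subst (λ ψ → Rep F' (tree (leaf x) ∷ ψ)) q (rep-≃ e' (rep (mod' st)))
      lenF' : length φ' ≡ 1
      lenF' = let ψ' , e' , q = single' in trans (lenE e') (cong suc (cong length q))

  allJoins : ∀ {φ : Forest k} → All Proper φ → (∃[ x ] tree (leaf x) ∈ φ) ⊎ (∀ {c} → c ∈ φ → ∃[ s ] ∃[ t ] c ≡ join s t)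
  allJoins [] = inj₂ (λ ())
  allJoins (iso ∷ ps) = inj₁ (_ , at₀)
  allJoins (jn ∷ ps) with allJoins ps
  ... | inj₁ (x , p) = inj₁ (x , there p)
  ... | inj₂ h = inj₂ (λ { at₀ → _ , _ , refl ; (there p) → h p })

  no-isolated : ∀ {φ : Forest k} → Distinct φ → (∀ {c} → c ∈ φ → ∃[ s ] ∃[ t ] c ≡ join s t) → ∀ {x} → ι x ∈ vs φ → ∃[ t ] ∃[ ψ ] φ ≃ (join (leaf x) t ∷ ψ)
  no-isolated {φ} u h {x} p with comp-front p
  ... | c , ψ , e , m with h (∈-resp-↭ (↭-sym e) at₀)
  ... | s , t , refl with exposeC {u = leaf x} {join s t} (sub (∈-++⁻ (vsT s) m))
    where
    sub : ι x ∈ vsT s ⊎ ι x ∈ vsT t → leaf x ⊑C join s t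
    sub (inj₁ q) = left (leaf⊑ s q)
    sub (inj₂ q) = right (leaf⊑ t q)
  ... | K , e' = K , ψ , reroot u (≃-perm e) e'

  solve : ∀ n {F F' : Graph k} {φ φ' col} → State F F' φ φ' col → wt φ + wt φ' < n → Goal F F' φ φ' col
  solve (suc n) {F} {F'} {φ} {φ'} {col} st (s≤s lt) L γ {x₀} x₀∈ en J = go (allJoins (pro (mod st))) (allJoins (pro (mod' st)))
    where
    hyp : Hyp φ φ' col
    hyp st' lt' = solve n st' (≤-trans lt' lt)
    u = dis (mod st)
    u' = dis (mod' st)
    go : (∃[ x ] tree (leaf x) ∈ φ) ⊎ (∀ {c} → c ∈ φ → ∃[ s ] ∃[ t ] c ≡ join s t)
       → (∃[ x ] tree (leaf x) ∈ φ') ⊎ (∀ {c} → c ∈ φ' → ∃[ s ] ∃[ t ] c ≡ join s t) → Result F F' φ φ' col L γ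
    go (inj₁ (x , p)) _ = isoStep st hyp en J (≃-perm (proj₂ (remove∈ p)))
    go (inj₂ _) (inj₁ (x , p)) = result-sym {φ = φ'} {φ} {col} {L} {γ} (isoStep (state-sym st) (hyp-sym {φ = φ} {φ'} hyp)
      (record { toL = λ q → toL en (lab' st q) ; fromL = λ q → lab st (fromL en q) ; uniqL = uniqL en }) (join-sym {φ = φ} {φ'} J) (≃-perm (proj₂ (remove∈ p))))
    go (inj₂ h) (inj₂ h') = pieceLoop (suc (size (λ _ → true) L))
      (record { st = st ; ih = hyp ; en = en ; jo = J ; noI = no-isolated u h ; noI' = no-isolated u' h' })
      (λ _ → true) ≤-refl (fromL en x₀∈) refl (inj₁ ((λ _ → refl) , uncut (λ _ → refl)))

module _ {k : ℕ} where

  open DecMem (_≟V_ {k}) using (_∈?_)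

  data Trail (P : Edges {k}) : V k → V k → List (V k) → Set where
    end  : ∀ {b} → Trail P b b (b ∷ [])
    cons : ∀ {a c b Q} → ((a , c) ∈ P ⊎ (c , a) ∈ P) → Trail P c b Q → Trail P a b (a ∷ Q)

  private
    suffix : ∀ {P a b c Q} → Trail P c b Q → Unique Q → a ∈ Q → ∃[ Q' ] Trail P a b Q' × Unique Q'
    suffix t@end u at₀ = _ , t , u
    suffix t@(cons _ _) u at₀ = _ , t , u
    suffix (cons _ t) (_ ∷ u) (there p) = suffix t u p

    simple : ∀ {P a b} → Conn P a b → ∃[ Q ] Trail P a b Q × Unique Q
    simple stay = _ , end , [] ∷ []
    simple {a = a} (move l p) with simple p
    ... | Q , t , u with a ∈? Q
    ... | yes q = suffix t u q
    ... | no n = a ∷ Q , cons l t , All.tabulate (λ { p refl → n p }) ∷ u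

    trail-chain : ∀ {G : Graph k} {P a b Q z} → (∀ {a c} → (a , c) ∈ P ⊎ (c , a) ∈ P → Adj G a c) → Trail P a b Q → Adj G b z → Chain G (Q ++ z ∷ [])
    trail-chain h end e = e , tt
    trail-chain h (cons l end) e = h l , e , tt
    trail-chain {G} h (cons l t@(cons _ _)) e = h l , trail-chain {G} h t e

  acyclic-conn : ∀ {G : Graph k} {P a b} → Acyclic G → (∀ {a c} → (a , c) ∈ P ⊎ (c , a) ∈ P → Adj G a c) → Adj G b a → a ≢ b
    → ¬ ((a , b) ∈ P ⊎ (b , a) ∈ P) → ¬ Conn P a b
  acyclic-conn {G} {P} {a} {b} ac h e n nl p with simple p
  ... | _ , end , u = n refl
  ... | _ , cons l end , u = nl l
  ... | _ , t@(cons _ (cons {Q = Q} _ t')) , u = ac (inj₂ (a , _ , s≤s (s≤s (pos t')) , u , trail-chain {G} h t e))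
    where
    pos : ∀ {a b Q} → Trail P a b Q → 1 ≤ length Q
    pos end = s≤s z≤n
    pos (cons _ _) = s≤s z≤n

-- Rose trees

data Rose (k : ℕ) : Set where
  rose : V k → List (Rose k) → Rose k

module _ {k : ℕ} where

  rtR : Rose k → V k
  rtR (rose v ts) = v

  vsR : Rose k → List (V k)
  vsRs : List (Rose k) → List (V k)
  vsR (rose v ts) = v ∷ vsRs ts
  vsRs [] = []
  vsRs (t ∷ ts) = vsR t ++ vsRs ts

  esR : Rose k → Edges {k}
  esK : V k → List (Rose k) → Edges {k}
  esR (rose v ts) = esK v ts
  esK v [] = []
  esK v (t ∷ ts) = (v , rtR t) ∷ esR t ++ esK v ts

  esRs : List (Rose k) → Edges {k}
  esRs [] = []
  esRs (t ∷ ts) = esR t ++ esRs ts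

  vsRs-++ : ∀ ts us → vsRs (ts ++ us) ≡ vsRs ts ++ vsRs us
  vsRs-++ [] us = refl
  vsRs-++ (t ∷ ts) us = trans (cong (vsR t ++_) (vsRs-++ ts us)) (sym (Data.List.Properties.++-assoc (vsR t) (vsRs ts) (vsRs us)))

  ΣK : (V k → V k → ℕ) → V k → List (Rose k) → ℕ
  ΣK f v ts = ΣE f (esK v ts)

  ΣK-∷ : ∀ f v t ts → ΣK f v (t ∷ ts) ≡ f v (rtR t) + (ΣE f (esR t) + ΣK f v ts)
  ΣK-∷ f v t ts = cong (f v (rtR t) +_) (ΣE-++ f (esR t) (esK v ts))

  ΣK-++ : ∀ f v ts us → ΣK f v (ts ++ us) ≡ ΣK f v ts + ΣK f v us
  ΣK-++ f v [] us = refl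
  ΣK-++ f v (t ∷ ts) us rewrite ΣK-∷ f v t (ts ++ us) | ΣK-∷ f v t ts | ΣK-++ f v ts us = ar (f v (rtR t)) (ΣE f (esR t)) (ΣK f v ts) (ΣK f v us)
    where
    ar : ∀ a b c d → a + (b + (c + d)) ≡ a + (b + c) + d
    ar = solve-∀

  rtR∈ : ∀ t → rtR t ∈ vsR t
  rtR∈ (rose v ts) = at₀

  -- rerooting at v a tree (with further subtrees K hung at its root)
  reR : ∀ t {v} → v ∈ vsR t → ∀ K → ∃[ cs ] (v ∷ vsRs cs ↭ vsR t ++ vsRs K) × (∀ f → Sym f → ΣK f v cs ≡ ΣE f (esR t) + ΣK f (rtR t) K)
  reRs : ∀ ts {v} → v ∈ vsRs ts → ∀ u K → ∃[ cs ] (v ∷ vsRs cs ↭ u ∷ vsRs ts ++ vsRs K) × (∀ f → Sym f → ΣK f v cs ≡ ΣK f u ts + ΣK f u K)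
  reR (rose u ts) at₀ K = ts ++ K , prep u (↭-reflexive (vsRs-++ ts K)) , (λ f _ → ΣK-++ f u ts K)
  reR (rose u ts) (there p) K = reRs ts p u K
  reRs (s ∷ ts) p u K with ∈-++⁻ (vsR s) p
  ... | inj₁ q with reR s q (rose u (ts ++ K) ∷ [])
  ... | cs , pm , sm = cs , ↭-trans pm pm' , sums'
    where
    pm' : vsR s ++ (u ∷ vsRs (ts ++ K)) ++ [] ↭ u ∷ (vsR s ++ vsRs ts) ++ vsRs K
    pm' = ↭-trans (++⁺ˡ (vsR s) (↭-reflexive (trans (++-identityʳ _) (cong (u ∷_) (vsRs-++ ts K)))))
      (↭-trans (shift u (vsR s) (vsRs ts ++ vsRs K)) (prep u (↭-reflexive (sym (Data.List.Properties.++-assoc (vsR s) (vsRs ts) (vsRs K))))))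
    ar : ∀ a b c d → b + (a + (c + d + 0)) ≡ a + (b + c) + d
    ar = solve-∀
    sums' : ∀ f → Sym f → ΣK f _ cs ≡ ΣK f u (s ∷ ts) + ΣK f u K
    sums' f sy = trans (sm f sy) (trans (cong (ΣE f (esR s) +_) (trans (ΣK-∷ f (rtR s) (rose u (ts ++ K)) []) (cong₂ _+_ (sy (rtR s) u) (cong (_+ 0) (ΣK-++ f u ts K)))))
      (trans (ar (f u (rtR s)) (ΣE f (esR s)) (ΣK f u ts) (ΣK f u K)) (cong (_+ ΣK f u K) (sym (ΣK-∷ f u s ts)))))
  reRs (s ∷ ts) p u K | inj₂ q with reRs ts q u (s ∷ K)
  ... | cs , pm , sm = cs , ↭-trans pm (prep u pm') , sums'
    where
    pm' : vsRs ts ++ vsR s ++ vsRs K ↭ (vsR s ++ vsRs ts) ++ vsRs K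
    pm' = ↭-trans (shifts (vsRs ts) (vsR s)) (↭-reflexive (sym (Data.List.Properties.++-assoc (vsR s) (vsRs ts) (vsRs K))))
    ar : ∀ a b c d → c + (a + (b + d)) ≡ a + (b + c) + d
    ar = solve-∀
    sums' : ∀ f → Sym f → ΣK f _ cs ≡ ΣK f u (s ∷ ts) + ΣK f u K
    sums' f sy = trans (sm f sy) (trans (cong (ΣK f u ts +_) (ΣK-∷ f u s K))
      (trans (ar (f u (rtR s)) (ΣE f (esR s)) (ΣK f u ts) (ΣK f u K)) (cong (_+ ΣK f u K) (sym (ΣK-∷ f u s ts)))))

  connR : ∀ t {v} → v ∈ vsR t → Conn (esR t) v (rtR t)
  connK : ∀ u ts {v} → v ∈ vsRs ts → Conn (esK u ts) v u
  connR (rose u ts) at₀ = stay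
  connR (rose u ts) (there p) = connK u ts p
  connK u (t ∷ ts) p with ∈-++⁻ (vsR t) p
  ... | inj₁ q = conn-trans (conn-⊆ (λ m → there (∈-++⁺ˡ m)) (connR t q)) (move (inj₂ at₀) stay)
  ... | inj₂ q = conn-⊆ (λ m → there (∈-++⁺ʳ (esR t) m)) (connK u ts q)

  rose-front : ∀ {R} {v : V k} → v ∈ vsRs R → ∃[ t ] ∃[ R' ] R ↭ t ∷ R' × v ∈ vsR t
  rose-front {t ∷ R} p with ∈-++⁻ (vsR t) p
  ... | inj₁ q = t , R , ↭-refl , q
  ... | inj₂ q with rose-front q
  ... | t' , R' , e , m = t' , t ∷ R' , ↭-trans (prep t e) (swap t t' ↭-refl) , m

  vsRs-↭ : ∀ {R R'} → R ↭ R' → vsRs R ↭ vsRs R'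
  vsRs-↭ _↭_.refl = ↭-refl
  vsRs-↭ (prep t p) = ++⁺ˡ (vsR t) (vsRs-↭ p)
  vsRs-↭ {_ ∷ _ ∷ R} (swap t t' p) = ↭-trans (shifts (vsR t) (vsR t') {vsRs R}) (++⁺ˡ (vsR t') (++⁺ˡ (vsR t) (vsRs-↭ p)))
  vsRs-↭ (_↭_.trans p q) = ↭-trans (vsRs-↭ p) (vsRs-↭ q)

  esRs-↭ : ∀ {R R'} → R ↭ R' → esRs R ↭ esRs R'
  esRs-↭ _↭_.refl = ↭-refl
  esRs-↭ (prep t p) = ++⁺ˡ (esR t) (esRs-↭ p)
  esRs-↭ {_ ∷ _ ∷ R} (swap t t' p) = ↭-trans (shifts (esR t) (esR t') {esRs R}) (++⁺ˡ (esR t') (++⁺ˡ (esR t) (esRs-↭ p)))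
  esRs-↭ (_↭_.trans p q) = ↭-trans (esRs-↭ p) (esRs-↭ q)

  conn-link : ∀ {P Q : Edges {k}} {a b} → (∀ {a b} → (a , b) ∈ P → (a , b) ∈ Q ⊎ (b , a) ∈ Q) → Conn P a b → Conn Q a b
  conn-link h stay = stay
  conn-link h (move (inj₁ m) p) = move (h m) (conn-link h p)
  conn-link h (move (inj₂ m) p) = move (Data.Sum.swap (h m)) (conn-link h p)

  link∈ : ∀ {Q : Edges {k}} {a b} → 1 ≤ ΣE (ind a b) Q → (a , b) ∈ Q ⊎ (b , a) ∈ Q
  link∈ {a = a} {b} p with ΣE-pos {f = ind a b} p
  ... | u , v , m , q with ind-link {a = a} {b} {u} {v} q
  ... | inj₁ refl = inj₁ m
  ... | inj₂ refl = inj₂ m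

  record RoseRep (xs : List (V k)) (E : Edges {k}) : Set where
    field
      roses : List (Rose k)
      rvs   : vsRs roses ↭ xs
      rsum  : ∀ f → Sym f → ΣE f E ≡ ΣE f (esRs roses)

  open RoseRep public

  data Fresh (xs : List (V k)) : Edges {k} → Set where
    []  : Fresh xs []
    _∷_ : ∀ {a b E} → a ∈ xs × b ∈ xs × ¬ Conn E a b → Fresh xs E → Fresh xs ((a , b) ∷ E)

  buildRoses : ∀ xs {E} → Fresh xs E → RoseRep xs E
  buildRoses xs [] = record { roses = map (λ v → rose v []) xs ; rvs = ↭-reflexive (single xs) ; rsum = λ f _ → sym (none f xs) }
    where
    single : ∀ xs → vsRs (map (λ v → rose v []) xs) ≡ xs
    single [] = refl
    single (x ∷ xs) = cong (x ∷_) (single xs)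
    none : ∀ f xs → ΣE f (esRs (map (λ v → rose v []) xs)) ≡ 0
    none f [] = refl
    none f (x ∷ xs) = none f xs
  buildRoses xs (_∷_ {a} {b} {E} (a∈ , b∈ , nc) fr) with buildRoses xs fr
  ... | record { roses = R ; rvs = pv ; rsum = ps } with rose-front {R} (∈-resp-↭ (↭-sym pv) a∈)
  ... | ta , R' , ea , ma with ∈-++⁻ (vsR ta) (∈-resp-↭ (vsRs-↭ ea) (∈-resp-↭ (↭-sym pv) b∈))
  ... | inj₁ mb = ⊥-elim (nc (conn-link up (conn-trans (connR ta ma) (conn-sym (connR ta mb)))))
    where
    up : ∀ {c d} → (c , d) ∈ esR ta → (c , d) ∈ E ⊎ (d , c) ∈ E
    up {c} {d} m = link∈ (≤-trans (≤-reflexive (sym (link-ind {a = c} {d} {c} {d} (inj₁ refl))))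
      (≤-trans (ΣE-∈ {f = ind c d} (∈-resp-↭ (↭-sym (esRs-↭ ea)) (∈-++⁺ˡ m))) (≤-reflexive (sym (ps (ind c d) (ind-sym c d))))))
  ... | inj₂ mb with rose-front {R'} mb
  ... | tb , R'' , eb , mb' with reR ta ma [] | reR tb mb' []
  ... | ca , pa , sa | cb , pb , sb = record
    { roses = rose a (rose b cb ∷ ca) ∷ R''
    ; rvs = ↭-trans pm pv
    ; rsum = sums' }
    where
    e : R ↭ ta ∷ tb ∷ R''
    e = ↭-trans ea (prep ta eb)
    pm : vsRs (rose a (rose b cb ∷ ca) ∷ R'') ↭ vsRs R
    pm = ↭-trans (↭-reflexive (cong (a ∷_) (Data.List.Properties.++-assoc (b ∷ vsRs cb) (vsRs ca) (vsRs R''))))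
      (↭-trans (prep a (shifts (b ∷ vsRs cb) (vsRs ca) {vsRs R''}))
      (↭-trans (↭-++ pa' (↭-++ pb' ↭-refl)) (↭-sym (vsRs-↭ e))))
      where
      pa' : a ∷ vsRs ca ↭ vsR ta
      pa' = ↭-trans pa (↭-reflexive (++-identityʳ _))
      pb' : b ∷ vsRs cb ↭ vsR tb
      pb' = ↭-trans pb (↭-reflexive (++-identityʳ _))
    ar : ∀ x a b r → x + ((a + 0) + ((b + 0) + r)) ≡ x + (b + a) + r
    ar = solve-∀
    sums' : ∀ f → Sym f → ΣE f ((a , b) ∷ E) ≡ ΣE f (esRs (rose a (rose b cb ∷ ca) ∷ R''))
    sums' f sy = begin
      f a b + ΣE f E ≡⟨ cong (f a b +_) (trans (ps f sy) (ΣE-↭ f (esRs-↭ e))) ⟩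
      f a b + ΣE f (esR ta ++ esR tb ++ esRs R'') ≡⟨ cong (f a b +_) (trans (ΣE-++ f (esR ta) _) (cong (ΣE f (esR ta) +_) (ΣE-++ f (esR tb) (esRs R'')))) ⟩
      f a b + (ΣE f (esR ta) + (ΣE f (esR tb) + ΣE f (esRs R''))) ≡⟨ cong₂ (λ y z → f a b + (y + (z + ΣE f (esRs R'')))) (trans (sym (+-identityʳ _)) (trans (sym (sa f sy)) (sym (+-identityʳ _)))) (trans (sym (+-identityʳ _)) (trans (sym (sb f sy)) (sym (+-identityʳ _)))) ⟩
      f a b + ((ΣK f a ca + 0) + ((ΣK f b cb + 0) + ΣE f (esRs R''))) ≡⟨ ar (f a b) (ΣK f a ca) (ΣK f b cb) _ ⟩
      f a b + (ΣK f b cb + ΣK f a ca) + ΣE f (esRs R'') ≡⟨ cong (_+ ΣE f (esRs R'')) (ΣK-∷ f a (rose b cb) ca) ⟨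
      ΣK f a (rose b cb ∷ ca) + ΣE f (esRs R'') ≡⟨ ΣE-++ f (esK a (rose b cb ∷ ca)) (esRs R'') ⟨
      ΣE f (esRs (rose a (rose b cb ∷ ca) ∷ R'')) ∎
      where open ≡-Reasoning

  esR-within : ∀ t → All (Within (vsR t)) (esR t)
  esK-within : ∀ v ts → All (Within (v ∷ vsRs ts)) (esK v ts)
  esR-within (rose v ts) = esK-within v ts
  esK-within v [] = []
  esK-within v (t ∷ ts) = (at₀ , there (∈-++⁺ˡ (rtR∈ t))) ∷ All.++⁺ (within-⊆ (λ p → there (∈-++⁺ˡ p)) (esR-within t))
    (within-⊆ (λ { (here q) → here q ; (there p) → there (∈-++⁺ʳ (vsR t) p) }) (esK-within v ts))

  esRs-within : ∀ ts → All (Within (vsRs ts)) (esRs ts)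
  esRs-within [] = []
  esRs-within (t ∷ ts) = All.++⁺ (within-⊆ ∈-++⁺ˡ (esR-within t)) (within-⊆ (∈-++⁺ʳ (vsR t)) (esRs-within ts))

  isRtR : V k → Rose k → ℕ
  isRtR a t = if eqb a (rtR t) then 1 else 0

  inc-head : ∀ {a} v t ts → Unique (v ∷ vsR t ++ vsRs ts) → a ∈ vsR t → ΣK (inc a) v (t ∷ ts) ≡ ΣE (inc a) (esR t) + isRtR a t
  inc-head {a} v t ts u@(_ ∷ u') p = go (λ { refl → Unique[x∷xs]⇒x∉xs u (∈-++⁺ˡ p) })
    where
    ar : ∀ a b → a + (b + 0) ≡ b + a
    ar = solve-∀
    go : a ≢ v → ΣK (inc a) v (t ∷ ts) ≡ ΣE (inc a) (esR t) + isRtR a t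
    go a≢ rewrite ΣK-∷ (inc a) v t ts | eqb-≢ a≢
      | inc-out {a = a} (λ { (here q) → a≢ q ; (there q) → disjoint (vsR t) u' p q }) (esK-within v ts) = ar (isRtR a t) _

  inc-tail : ∀ {a} v t ts → Unique (v ∷ vsR t ++ vsRs ts) → a ∈ vsRs ts → ΣK (inc a) v (t ∷ ts) ≡ ΣK (inc a) v ts
  inc-tail {a} v t ts u@(_ ∷ u') p rewrite ΣK-∷ (inc a) v t ts
      | inc-≢ {a = a} {v} {rtR t} (λ { refl → Unique[x∷xs]⇒x∉xs u (∈-++⁺ʳ (vsR t) p) }) (λ { refl → disjoint (vsR t) u' (rtR∈ t) p })
      | inc-out {a = a} (λ q → disjoint (vsR t) u' q p) (esR-within t) = refl

  uniq-tail : ∀ {v : V k} {xs ys} → Unique (v ∷ xs ++ ys) → Unique (v ∷ ys)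
  uniq-tail {xs = xs} (n ∷ u) = All.++⁻ʳ xs n ∷ uniqueʳ xs u

  inc-root : ∀ {v} ts → Unique (v ∷ vsRs ts) → ΣK (inc v) v ts ≡ length ts
  inc-root [] u = refl
  inc-root {v} (t ∷ ts) u rewrite ΣK-∷ (inc v) v t ts | eqb-refl v
    | inc-out {a = v} (λ q → Unique[x∷xs]⇒x∉xs u (∈-++⁺ˡ q)) (esR-within t) | inc-root ts (uniq-tail {xs = vsR t} u) = refl

  module _ (D : V k → ℕ) (D₁ : ∀ x → D (inj₁ x) ≤ 1) (D₃ : ∀ {v} n → v ≡ inj₂ n → D v ≡ 3) where

    record BinT (t : Rose k) : Set where
      field
        bin  : Tree k
        brt  : rt bin ≡ rtR t
        bvs  : vsT bin ↭ vsR t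
        bsum : ∀ f → Sym f → ΣE f (esT bin) ≡ ΣE f (esR t)

    open BinT

    node-sums : ∀ f {n s₁ s₂} (B₁ : BinT s₁) (B₂ : BinT s₂) → Sym f
      → ΣE f (esT (node n (bin B₁) (bin B₂))) ≡ ΣK f (inj₂ n) (s₁ ∷ s₂ ∷ [])
    node-sums f {n} {s₁} {s₂} B₁ B₂ sy rewrite ΣE-++ f (esT (bin B₁)) (esT (bin B₂)) | ΣK-∷ f (inj₂ n) s₁ (s₂ ∷ []) | ΣK-∷ f (inj₂ n) s₂ []
      | brt B₁ | brt B₂ | bsum B₁ f sy | bsum B₂ f sy = ar (f (inj₂ n) (rtR s₁)) (f (inj₂ n) (rtR s₂)) (ΣE f (esR s₁)) (ΣE f (esR s₂))
      where
      ar : ∀ a b c d → a + (b + (c + d)) ≡ a + (c + (b + (d + 0)))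
      ar = solve-∀

    node-vs : ∀ {n s₁ s₂} (B₁ : BinT s₁) (B₂ : BinT s₂) → vsT (node n (bin B₁) (bin B₂)) ↭ inj₂ n ∷ vsR s₁ ++ vsR s₂ ++ []
    node-vs {s₂ = s₂} B₁ B₂ = prep _ (↭-++ (bvs B₁) (↭-trans (bvs B₂) (↭-reflexive (sym (++-identityʳ (vsR s₂))))))

    HangT : Rose k → Set
    HangT t = ∀ {a} → a ∈ vsR t → ΣE (inc a) (esR t) + isRtR a t ≡ D a

    root-count : ∀ v ts → Unique (v ∷ vsRs ts) → HangT (rose v ts) → length ts + 1 ≡ D v
    root-count v ts u h = trans (cong₂ _+_ (sym (inc-root ts u)) (cong (λ b → if b then 1 else 0) (sym (eqb-refl v)))) (h at₀)

    toBin : ∀ t → Unique (vsR t) → HangT t → BinT t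
    toBin (rose (inj₁ x) []) u h = record { bin = leaf x ; brt = refl ; bvs = ↭-refl ; bsum = λ _ _ → refl }
    toBin (rose (inj₁ x) ts@(_ ∷ ts')) u h = ⊥-elim (bad (subst (_≤ 1) (sym (root-count (inj₁ x) ts u h)) (D₁ x)))
      where
      bad : suc (length ts' + 1) ≤ 1 → ⊥
      bad p rewrite +-comm (length ts') 1 with s≤s () ← p
    toBin (rose (inj₂ n) (s₁ ∷ s₂ ∷ [])) u h = record { bin = node n (bin B₁) (bin B₂) ; brt = refl ; bvs = node-vs B₁ B₂ ; bsum = λ f sy → node-sums f B₁ B₂ sy }
      where
      inner : ∀ {a} → a ∈ vsRs (s₁ ∷ s₂ ∷ []) → ΣK (inc a) (inj₂ n) (s₁ ∷ s₂ ∷ []) ≡ D a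
      inner {a} p = trans (sym (trans (cong (ΣK (inc a) (inj₂ n) (s₁ ∷ s₂ ∷ []) +_) z) (+-identityʳ _))) (h (there p))
        where
        z : isRtR a (rose (inj₂ n) (s₁ ∷ s₂ ∷ [])) ≡ 0
        z rewrite eqb-≢ {a = a} {inj₂ n} (λ { refl → Unique[x∷xs]⇒x∉xs u p }) = refl
      tl : ∀ {A : Set} {x : A} {xs} → Unique (x ∷ xs) → Unique xs
      tl (_ ∷ u) = u
      B₁ : BinT s₁
      B₁ = toBin s₁ (uniqueˡ (vsR s₁) (tl u)) (λ p → trans (sym (inc-head (inj₂ n) s₁ (s₂ ∷ []) u p)) (inner (∈-++⁺ˡ p)))
      u₂ : Unique (inj₂ n ∷ vsR s₂ ++ [])
      u₂ = uniq-tail {xs = vsR s₁} u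
      B₂ : BinT s₂
      B₂ = toBin s₂ (uniqueˡ (vsR s₂) (tl u₂)) (λ p → trans (sym (inc-head (inj₂ n) s₂ [] u₂ p)) (trans (sym (inc-tail (inj₂ n) s₁ (s₂ ∷ []) u (∈-++⁺ˡ p))) (inner (∈-++⁺ʳ (vsR s₁) (∈-++⁺ˡ p)))))
    toBin (rose (inj₂ n) []) u h with () ← trans (root-count (inj₂ n) [] u h) (D₃ n refl)
    toBin (rose (inj₂ n) (s₁ ∷ [])) u h with () ← trans (root-count (inj₂ n) (s₁ ∷ []) u h) (D₃ n refl)
    toBin (rose (inj₂ n) (s₁ ∷ s₂ ∷ s₃ ∷ ts)) u h = ⊥-elim (bad (trans (root-count (inj₂ n) (s₁ ∷ s₂ ∷ s₃ ∷ ts) u h) (D₃ n refl)))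
      where
      bad : suc (suc (suc (length ts + 1))) ≡ 3 → ⊥
      bad p rewrite +-comm (length ts) 1 with () ← p

    record BinC (t : Rose k) : Set where
      field
        cbin : Comp k
        cpro : Proper cbin
        cvs  : vsC cbin ↭ vsR t
        csum : ∀ f → Sym f → ΣE f (esC cbin) ≡ ΣE f (esR t)

    open BinC

    toComp : ∀ t → Unique (vsR t) → (∀ {a} → a ∈ vsR t → ΣE (inc a) (esR t) ≡ D a) → BinC t
    toComp (rose (inj₁ x) []) u h = record { cbin = tree (leaf x) ; cpro = iso ; cvs = ↭-refl ; csum = λ _ _ → refl }
    toComp (rose (inj₁ x) (s ∷ [])) u@(_ ∷ u') h = record { cbin = join (leaf x) (bin B) ; cpro = jn
      ; cvs = prep _ (↭-trans (bvs B) (↭-reflexive (sym (++-identityʳ _))))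
      ; csum = λ f sy → trans (cong₂ (λ r z → f (ι x) r + z) (brt B) (trans (bsum B f sy) (sym (+-identityʳ _)))) (sym (ΣK-∷ f (ι x) s [])) }
      where
      B : BinT s
      B = toBin s (uniqueˡ (vsR s) u') (λ p → trans (sym (inc-head (inj₁ x) s [] u p)) (h (there (∈-++⁺ˡ p))))
    toComp (rose (inj₁ x) (s ∷ s' ∷ ts)) u h = ⊥-elim (bad (subst (_≤ 1) (trans (sym (h at₀)) (inc-root (s ∷ s' ∷ ts) u)) (D₁ x)))
      where
      bad : suc (suc (length ts)) ≤ 1 → ⊥
      bad (s≤s ())
    toComp (rose (inj₂ n) (s₀ ∷ s₁ ∷ s₂ ∷ [])) u h = record { cbin = join (bin B₀) (node n (bin B₁) (bin B₂)) ; cpro = jn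
      ; cvs = ↭-trans (↭-++ (bvs B₀) (node-vs B₁ B₂)) (shift (inj₂ n) (vsR s₀) _)
      ; csum = sums' }
      where
      tl : ∀ {A : Set} {x : A} {xs} → Unique (x ∷ xs) → Unique xs
      tl (_ ∷ u) = u
      u₁ : Unique (inj₂ n ∷ vsR s₁ ++ vsR s₂ ++ [])
      u₁ = uniq-tail {xs = vsR s₀} u
      u₂ : Unique (inj₂ n ∷ vsR s₂ ++ [])
      u₂ = uniq-tail {xs = vsR s₁} u₁
      B₀ : BinT s₀
      B₀ = toBin s₀ (uniqueˡ (vsR s₀) (tl u)) (λ p → trans (sym (inc-head (inj₂ n) s₀ (s₁ ∷ s₂ ∷ []) u p)) (h (there (∈-++⁺ˡ p))))
      B₁ : BinT s₁
      B₁ = toBin s₁ (uniqueˡ (vsR s₁) (tl u₁)) (λ p → trans (sym (inc-head (inj₂ n) s₁ (s₂ ∷ []) u₁ p)) (trans (sym (inc-tail (inj₂ n) s₀ (s₁ ∷ s₂ ∷ []) u (∈-++⁺ˡ p))) (h (there (∈-++⁺ʳ (vsR s₀) (∈-++⁺ˡ p))))))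
      B₂ : BinT s₂
      B₂ = toBin s₂ (uniqueˡ (vsR s₂) (tl u₂)) (λ p → trans (sym (inc-head (inj₂ n) s₂ [] u₂ p)) (trans (sym (inc-tail (inj₂ n) s₁ (s₂ ∷ []) u₁ (∈-++⁺ˡ p))) (trans (sym (inc-tail (inj₂ n) s₀ (s₁ ∷ s₂ ∷ []) u (∈-++⁺ʳ (vsR s₁) (∈-++⁺ˡ p))))
        (h (there (∈-++⁺ʳ (vsR s₀) (∈-++⁺ʳ (vsR s₁) (∈-++⁺ˡ p))))))))
      sums' : ∀ f → Sym f → ΣE f (esC (join (bin B₀) (node n (bin B₁) (bin B₂)))) ≡ ΣK f (inj₂ n) (s₀ ∷ s₁ ∷ s₂ ∷ [])
      sums' f sy rewrite ΣE-++ f (esT (bin B₀)) (esT (node n (bin B₁) (bin B₂))) | node-sums f {n} B₁ B₂ sy | brt B₀ | bsum B₀ f sy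
        | ΣK-∷ f (inj₂ n) s₀ (s₁ ∷ s₂ ∷ []) | sy (rtR s₀) (inj₂ n) = refl
    toComp (rose (inj₂ n) []) u h with () ← trans (trans (sym (inc-root [] u)) (h at₀)) (D₃ n refl)
    toComp (rose (inj₂ n) (s ∷ [])) u h with () ← trans (trans (sym (inc-root (s ∷ []) u)) (h at₀)) (D₃ n refl)
    toComp (rose (inj₂ n) (s ∷ s' ∷ [])) u h with () ← trans (trans (sym (inc-root (s ∷ s' ∷ []) u)) (h at₀)) (D₃ n refl)
    toComp (rose (inj₂ n) (s ∷ s' ∷ s'' ∷ s''' ∷ ts)) u h with () ← trans (trans (sym (inc-root (s ∷ s' ∷ s'' ∷ s''' ∷ ts) u)) (h at₀)) (D₃ n refl)

    toForest : ∀ R → Unique (vsRs R) → (∀ {a} → a ∈ vsRs R → ΣE (inc a) (esRs R) ≡ D a)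
      → ∃[ φ ] All Proper φ × vs φ ↭ vsRs R × (∀ f → Sym f → ΣE f (es φ) ≡ ΣE f (esRs R))
    toForest [] u h = [] , [] , ↭-refl , (λ _ _ → refl)
    toForest (t ∷ R) u h with toForest R (uniqueʳ (vsR t) u) (λ {a} p → trans (sym (trans (ΣE-++ (inc a) (esR t) (esRs R))
        (cong (_+ ΣE (inc a) (esRs R)) (inc-out (λ q → disjoint (vsR t) u q p) (esR-within t))))) (h (∈-++⁺ʳ (vsR t) p)))
    ... | φ , pr , pv , ps = cbin C ∷ φ , cpro C ∷ pr , ↭-++ (cvs C) pv
        , (λ f sy → trans (ΣE-++ f (esC (cbin C)) (es φ)) (trans (cong₂ _+_ (csum C f sy) (ps f sy)) (sym (ΣE-++ f (esR t) (esRs R)))))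
      where
      C : BinC t
      C = toComp t (uniqueˡ (vsR t) u) (λ {a} p → trans (sym (trans (ΣE-++ (inc a) (esR t) (esRs R))
        (trans (cong (ΣE (inc a) (esR t) +_) (inc-out (disjoint (vsR t) u p) (esRs-within R))) (+-identityʳ _)))) (h (∈-++⁺ˡ p)))

  adj-comm : ∀ {G : Graph k} a b → Adj G a b → Adj G b a
  adj-comm {G} a b p with ΣE-pos {f = ind a b} {edges G} p
  ... | u , v , m , q = ≤-trans (≤-reflexive (sym (link-ind (Data.Sum.swap (ind-link {a = a} {b} {u} {v} q))))) (ΣE-∈ {f = ind b a} m)

  edge-adj : ∀ {G : Graph k} {a b} → (a , b) ∈ edges G → Adj G a b
  edge-adj {G} {a} {b} m = ≤-trans (≤-reflexive (sym (link-ind {a = a} {b} (inj₁ refl)))) (ΣE-∈ {f = ind a b} m)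

  forest-models : ∀ {F : Graph k} → ForestOn F → ∃[ φ ] Models F φ
  forest-models {F} (ac , allL , lc) = go (buildRoses (verts F) (fresh (edges F) (edges-ok F) id (λ _ _ → ≤-refl)))
    where
    fresh : ∀ E → All (λ e → proj₁ e ∈ verts F × proj₂ e ∈ verts F × proj₁ e ≢ proj₂ e) E → (∀ {e} → e ∈ E → e ∈ edges F)
      → (∀ a b → ΣE (ind a b) E ≤ mult F a b) → Fresh (verts F) E
    fresh [] _ _ _ = []
    fresh ((a , b) ∷ E) ((a∈ , b∈ , n) ∷ ok) sub le = (a∈ , b∈ , acyclic-conn {G = F} ac adj (adj-comm {F} a b (edge-adj {F} (sub at₀))) n dup)
        ∷ fresh E ok (λ m → sub (there m)) (λ c d → ≤-trans (m≤n+m _ (ind c d a b)) (le c d))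
      where
      adj : ∀ {a c} → (a , c) ∈ E ⊎ (c , a) ∈ E → Adj F a c
      adj (inj₁ m) = edge-adj {F} (sub (there m))
      adj {a} {c} (inj₂ m) = adj-comm {F} c a (edge-adj {F} (sub (there m)))
      dup : ¬ ((a , b) ∈ E ⊎ (b , a) ∈ E)
      dup l = ac (inj₁ (a , b , ≤-trans (+-mono-≤ (≤-reflexive (sym (link-ind {a = a} {b} (inj₁ refl)))) (one≤ l)) (le a b)))
        where
        one≤ : (a , b) ∈ E ⊎ (b , a) ∈ E → 1 ≤ ΣE (ind a b) E
        one≤ (inj₁ m) = ≤-trans (≤-reflexive (sym (link-ind {a = a} {b} (inj₁ refl)))) (ΣE-∈ {f = ind a b} m)
        one≤ (inj₂ m) = ≤-trans (≤-reflexive (sym (link-ind {a = a} {b} (inj₂ refl)))) (ΣE-∈ {f = ind a b} m)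
    go : RoseRep (verts F) (edges F) → ∃[ φ ] Models F φ
    go R = let φ , pr , pv , ps = toForest D D₁ D₃ (roses R) (unique-↭ (↭-sym (rvs R)) (verts-unique F)) degs in
      φ , record { rep = record { vF = λ p → ∈-resp-↭ (↭-sym (↭-trans pv (rvs R))) p ; vφ = λ p → ∈-resp-↭ (↭-trans pv (rvs R)) p
                                ; sums = λ f sy → trans (rsum R f sy) (sym (ps f sy)) }
                 ; dis = distinct (unique-↭ (↭-sym (↭-trans pv (rvs R))) (verts-unique F)) ; pro = pr }
      where
      D : V k → ℕ
      D (inj₁ x) = deg F (inj₁ x)
      D (inj₂ n) = 3
      D₁ : ∀ x → D (inj₁ x) ≤ 1
      D₁ x with lc (inj₁ x) (allL x)
      ... | inj₁ (_ , d) = d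
      ... | inj₂ (n , _) = ⊥-elim (n (x , refl))
      D₃ : ∀ {v} n → v ≡ inj₂ n → D v ≡ 3
      D₃ n refl = refl
      Ddeg : ∀ a → a ∈ verts F → deg F a ≡ D a
      Ddeg (inj₁ x) _ = refl
      Ddeg (inj₂ n) p with lc (inj₂ n) p
      ... | inj₁ ((_ , ()) , _)
      ... | inj₂ (_ , d) = d
      degs : ∀ {a} → a ∈ vsRs (roses R) → ΣE (inc a) (esRs (roses R)) ≡ D a
      degs {a} p = trans (sym (rsum R (inc a) (inc-sym a))) (Ddeg a (∈-resp-↭ (rvs R) p))

module _ {k : ℕ} where

  open DecMem (_≟V_ {k}) using (_∈?_)

  ΣE-ind : ∀ (E E' : Edges {k}) → (∀ a b → ΣE (ind a b) E ≡ ΣE (ind a b) E') → ∀ f → Sym f → ΣE f E ≡ ΣE f E'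
  ΣE-ind [] [] h f sy = refl
  ΣE-ind [] ((u , v) ∷ E') h f sy with trans (h u v) (cong (_+ ΣE (ind u v) E') (link-ind {a = u} {v} (inj₁ refl)))
  ... | ()
  ΣE-ind ((u , v) ∷ E) E' h f sy = go (link∈ {a = u} {v} (subst (1 ≤_) (h u v) (≤-trans (≤-reflexive (sym (link-ind {a = u} {v} (inj₁ refl)))) (m≤m+n _ _))))
    where
    finish : ∀ u' v' → (∀ g → Sym g → g u' v' ≡ g u v) → (u' , v') ∈ E' → f u v + ΣE f E ≡ ΣE f E'
    finish u' v' sw' m with remove∈ m
    ... | E'' , p = trans (cong (f u v +_) (ΣE-ind E E'' (λ a b → +-cancelˡ-≡ (ind a b u v) _ _
        (trans (h a b) (trans (ΣE-↭ (ind a b) p) (cong (_+ ΣE (ind a b) E'') (sw' (ind a b) (ind-sym a b)))))) f sy))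
        (trans (cong (_+ ΣE f E'') (sym (sw' f sy))) (sym (ΣE-↭ f p)))
    go : (u , v) ∈ E' ⊎ (v , u) ∈ E' → f u v + ΣE f E ≡ ΣE f E'
    go (inj₁ m) = finish u v (λ _ _ → refl) m
    go (inj₂ m) = finish v u (λ g sg → sg v u) m

  -- Cuts

  cr : (V k → Bool) → V k → V k → ℕ
  cr κ u v = if κ u xor κ v then 1 else 0

  cr-sym : ∀ κ → Sym (cr κ)
  cr-sym κ u v with κ u | κ v
  ... | true | true = refl
  ... | true | false = refl
  ... | false | true = refl
  ... | false | false = refl

  cr-eq : ∀ κ {u v} → κ u ≡ κ v → cr κ u v ≡ 0
  cr-eq κ {u} {v} e rewrite e with κ v
  ... | true = refl
  ... | false = refl

  cr-ne : ∀ κ {u v} → κ u ≢ κ v → cr κ u v ≡ 1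
  cr-ne κ {u} {v} n with κ u | κ v
  ... | true | true = ⊥-elim (n refl)
  ... | true | false = refl
  ... | false | true = refl
  ... | false | false = ⊥-elim (n refl)

  cross : (V k → Bool) → Graph k → ℕ
  cross κ G = ΣE (cr κ) (edges G)

  ΣE-cong : ∀ {f g : V k → V k → ℕ} {E : Edges {k}} → All (λ e → f (proj₁ e) (proj₂ e) ≡ g (proj₁ e) (proj₂ e)) E → ΣE f E ≡ ΣE g E
  ΣE-cong [] = refl
  ΣE-cong (p ∷ ps) = cong₂ _+_ p (ΣE-cong ps)

  adj-edge : ∀ {G : Graph k} {a b} → Adj G a b → (a , b) ∈ edges G ⊎ (b , a) ∈ edges G
  adj-edge p = link∈ p

  adj-verts' : ∀ {G : Graph k} a b → Adj G a b → a ∈V G × b ∈V G × a ≢ b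
  adj-verts' {G} a b p with adj-edge {G} {a} {b} p
  ... | inj₁ m = All.lookup (edges-ok G) m
  ... | inj₂ m = let x , y , n = All.lookup (edges-ok G) m in y , x , (λ e → n (sym e))

  lift-step : ∀ {G H : Graph k} → SuppressStep G H → ∀ κ → ∃[ κ' ] (∀ {a} → a ∈V H → κ' a ≡ κ a) × cross κ' G ≡ cross κ H
  lift-step {G} {H} (v , u , w , v∈ , _ , u≢w , uv , vw , vs⇔ , meq) κ = κ' , agreeH , eq
    where
    κ' : V k → Bool
    κ' a = if eqb a v then κ u else κ a
    κ'-≢ : ∀ {a} → a ≢ v → κ' a ≡ κ a
    κ'-≢ n rewrite eqb-≢ n = refl
    κ'-v : κ' v ≡ κ u
    κ'-v rewrite eqb-refl v = refl
    ≢v : ∀ {a} → a ∈V H → a ≢ v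
    ≢v {a} p = proj₂ (Function.Bundles.Equivalence.to (vs⇔ a) p)
    agreeH : ∀ {a} → a ∈V H → κ' a ≡ κ a
    agreeH p = κ'-≢ (≢v p)
    u≢v : u ≢ v
    u≢v = proj₂ (proj₂ (adj-verts' {G} u v uv))
    big : ΣE (cr κ') ((u , v) ∷ (v , w) ∷ edges H) ≡ ΣE (cr κ') ((u , w) ∷ edges G)
    big = ΣE-ind ((u , v) ∷ (v , w) ∷ edges H) ((u , w) ∷ edges G) (λ a b → trans (ar (ind a b u v) (ind a b v w) (mult H a b)) (trans (meq a b) (+-comm (mult G a b) (ind a b u w)))) (cr κ') (cr-sym κ')
      where
      ar : ∀ a b c → a + (b + c) ≡ c + a + b
      ar = solve-∀
    cuv : cr κ' u v ≡ 0
    cuv = cr-eq κ' (trans (κ'-≢ u≢v) (sym κ'-v))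
    cvw : cr κ' v w ≡ cr κ' u w
    cvw = cong (λ b → if b xor κ' w then 1 else 0) (trans κ'-v (sym (κ'-≢ u≢v)))
    eq : cross κ' G ≡ cross κ H
    eq = trans (sym (+-cancelˡ-≡ (cr κ' u w) _ _ (trans (cong (_+ cross κ' H) (sym cvw)) (trans (cong (_+ (cr κ' v w + cross κ' H)) (sym cuv)) big))))
      (ΣE-cong (All.map (λ { (p , q , _) → cong₂ (λ a b → if a xor b then 1 else 0) (agreeH p) (agreeH q) }) (edges-ok H)))

  lift-star : ∀ {G H : Graph k} → Star SuppressStep G H → ∀ κ → ∃[ κ' ] (∀ {a} → a ∈V H → κ' a ≡ κ a) × cross κ' G ≡ cross κ H
  star-verts : ∀ {G H : Graph k} → Star SuppressStep G H → ∀ {a} → a ∈V H → a ∈V G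
  star-verts ε p = p
  star-verts (st ◅ r) {a} p = let _ , _ , _ , _ , _ , _ , _ , _ , vs⇔ , _ = st in proj₁ (Function.Bundles.Equivalence.to (vs⇔ a) (star-verts r p))
  lift-star ε κ = κ , (λ _ → refl) , refl
  lift-star {G} (_◅_ {j = M} st r) κ with lift-star r κ
  ... | κ₁ , h₁ , e₁ with lift-step {G} {M} st κ₁
  ... | κ₂ , h₂ , e₂ = κ₂ , (λ p → trans (h₂ (star-verts r p)) (h₁ p)) , trans e₂ e₁

  iso-cross : ∀ {T F : Graph k} (i : Iso T F) κ → cross (λ a → κ (proj₁ i a)) T ≡ cross κ F
  iso-cross {T} {F} (f , g , fV , gV , gf , fg , _ , _ , me) κ = trans (sym (ΣE-map (edges T))) (ΣE-ind (map fe (edges T)) (edges F) same (cr κ) (cr-sym κ))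
    where
    fe : V k × V k → V k × V k
    fe (u , v) = f u , f v
    ΣE-map : ∀ E → ΣE (cr κ) (map fe E) ≡ ΣE (cr (λ a → κ (f a))) E
    ΣE-map [] = refl
    ΣE-map ((u , v) ∷ E) = cong (cr κ (f u) (f v) +_) (ΣE-map E)
    eqb-fg : ∀ {a u} → a ∈V F → u ∈V T → eqb a (f u) ≡ eqb (g a) u
    eqb-fg {a} {u} a∈ u∈ with g a ≟V u
    ... | yes refl rewrite fg a a∈ = eqb-refl a
    ... | no n = eqb-≢ (λ { refl → n (gf u u∈) })
    shiftE : ∀ {a b E} → a ∈V F → b ∈V F → All (λ e → proj₁ e ∈V T × proj₂ e ∈V T × proj₁ e ≢ proj₂ e) E → ΣE (ind a b) (map fe E) ≡ ΣE (ind (g a) (g b)) E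
    shiftE a∈ b∈ [] = refl
    shiftE {a} {b} {(u , v) ∷ E} a∈ b∈ ((p , q , _) ∷ ok) rewrite eqb-fg a∈ p | eqb-fg a∈ q | eqb-fg b∈ p | eqb-fg b∈ q = cong (ind (g a) (g b) u v +_) (shiftE a∈ b∈ ok)
    out₁ : ∀ {a b E} → ¬ (a ∈V F × b ∈V F) → All (λ e → proj₁ e ∈V F × proj₂ e ∈V F) E → ΣE (ind a b) E ≡ 0
    out₁ {a} {b} n ok = ΣE-zero (All.map (λ { {u , v} (p , q) → zero' u v p q }) ok)
      where
      zero' : ∀ u v → u ∈V F → v ∈V F → ind a b u v ≡ 0
      zero' u v p q with ind a b u v in eq
      ... | 0 = refl
      ... | suc m with ind-link {a = a} {b} {u} {v} (subst (1 ≤_) (sym eq) (s≤s z≤n))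
      ... | inj₁ refl = ⊥-elim (n (p , q))
      ... | inj₂ refl = ⊥-elim (n (q , p))
    mapOk : ∀ {E} → All (λ e → proj₁ e ∈V T × proj₂ e ∈V T × proj₁ e ≢ proj₂ e) E → All (λ e → proj₁ e ∈V F × proj₂ e ∈V F) (map fe E)
    mapOk [] = []
    mapOk ((p , q , _) ∷ ok) = (fV _ p , fV _ q) ∷ mapOk ok
    same : ∀ a b → ΣE (ind a b) (map fe (edges T)) ≡ ΣE (ind a b) (edges F)
    same a b with a ∈? verts F | b ∈? verts F
    ... | yes p | yes q = trans (shiftE p q (edges-ok T)) (trans (sym (me (g a) (g b) (gV a p) (gV b q))) (cong₂ (mult F) (fg a p) (fg b q)))
    ... | no n | _ = trans (out₁ {a} {b} (λ z → n (proj₁ z)) (mapOk (edges-ok T))) (sym (out₁ {a} {b} (λ z → n (proj₁ z)) (All.map (λ { (p , q , _) → p , q }) (edges-ok F))))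
    ... | yes _ | no n = trans (out₁ {a} {b} (λ z → n (proj₂ z)) (mapOk (edges-ok T))) (sym (out₁ {a} {b} (λ z → n (proj₂ z)) (All.map (λ { (p , q , _) → p , q }) (edges-ok F))))

  module _ {S T F : Graph k} (sup : SuppressAll S T) (i : Iso T F) (lF : ∀ x → ι x ∈V F) where

    private
      H₁ = proj₁ sup
      steps = proj₁ (proj₂ sup)
      eqV = proj₁ (proj₁ (proj₂ (proj₂ sup)))
      eqM = proj₂ (proj₁ (proj₂ (proj₂ sup)))
      f g : V k → V k
      f = proj₁ i
      g = proj₁ (proj₂ i)
      gV : ∀ v → v ∈V F → g v ∈V T
      gV = proj₁ (proj₂ (proj₂ (proj₂ i)))
      fg : ∀ v → v ∈V F → f (g v) ≡ v
      fg = proj₁ (proj₂ (proj₂ (proj₂ (proj₂ (proj₂ i)))))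
      gι : ∀ x → g (ι x) ≡ ι x
      gι x = proj₁ (proj₂ (proj₂ (proj₂ (proj₂ (proj₂ (proj₂ (proj₂ i))))))) x (lF x)
      me : ∀ a b → a ∈V T → b ∈V T → mult F (f a) (f b) ≡ mult T a b
      me = proj₂ (proj₂ (proj₂ (proj₂ (proj₂ (proj₂ (proj₂ (proj₂ i)))))))
      ιT : ∀ x → ι x ∈V T
      ιT x = subst (_∈V T) (gι x) (gV (ι x) (lF x))
      fι : ∀ x → f (ι x) ≡ ι x
      fι x = trans (cong f (sym (gι x))) (fg (ι x) (lF x))

    lift-cut : ∀ κ → ∃[ κ' ] (∀ x → κ' (ι x) ≡ κ (ι x)) × cross κ' S ≡ cross κ F
    lift-cut κ with lift-star steps (λ a → κ (f a))
    ... | κ' , h , e = κ' , (λ x → trans (h (Function.Bundles.Equivalence.from (eqV (ι x)) (ιT x))) (cong κ (fι x)))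
      , trans e (trans (ΣE-ind (edges H₁) (edges T) eqM (cr (λ a → κ (f a))) (cr-sym (λ a → κ (f a)))) (iso-cross {T} {F} i κ))

    push-colour : ∀ (χ : V k → V k) → (∀ a b → Adj S a b → χ a ≡ χ b) → ∃[ χ' ] (∀ x → χ' (ι x) ≡ χ (ι x)) × (∀ a b → Adj F a b → χ' a ≡ χ' b)
    push-colour χ h = (λ a → χ (g a)) , (λ x → cong χ (gι x)) , (λ a b p → down steps h (g a) (g b) (atT a b p))
      where
      atT : ∀ a b → Adj F a b → Adj H₁ (g a) (g b)
      atT a b p = let a∈ , b∈ , _ = adj-verts' {F} a b p in
        subst (1 ≤_) (trans (cong₂ (mult F) (sym (fg a a∈)) (sym (fg b b∈))) (trans (me (g a) (g b) (gV a a∈) (gV b b∈)) (sym (eqM (g a) (g b))))) p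
      down : ∀ {G H} → Star SuppressStep G H → (∀ a b → Adj G a b → χ a ≡ χ b) → ∀ a b → Adj H a b → χ a ≡ χ b
      down ε h a b p = h a b p
      down {G} (_◅_ {j = M} (v , u , w , _ , _ , _ , uv , vw , _ , meq) r) h = down r step'
        where
        step' : ∀ a b → Adj M a b → χ a ≡ χ b
        step' a b q = go (mult G a b) refl
          where
          le : 1 ≤ mult G a b + ind a b u w
          le = ≤-trans q (≤-trans (m≤m+n _ (ind a b u v)) (≤-trans (m≤m+n _ (ind a b v w)) (≤-reflexive (meq a b))))
          uw : χ u ≡ χ w
          uw = trans (h u v uv) (h v w vw)
          lk : Link a b (u , w) → χ a ≡ χ b
          lk (inj₁ refl) = uw
          lk (inj₂ refl) = sym uw
          go : ∀ n → mult G a b ≡ n → χ a ≡ χ b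
          go (suc n) e = h a b (subst (1 ≤_) (sym e) (s≤s z≤n))
          go zero e = lk (ind-link {a = a} {b} {u} {w} (subst (λ n → 1 ≤ n + ind a b u w) e le))

  inB : List (V k) → V k → Bool
  inB xs v = ⌊ v ∈? xs ⌋

  inB-∈ : ∀ {xs v} → v ∈ xs → inB xs v ≡ true
  inB-∈ {xs} {v} p with v ∈? xs
  ... | yes _ = refl
  ... | no n = ⊥-elim (n p)

  inB-∉ : ∀ {xs v} → v ∉ xs → inB xs v ≡ false
  inB-∉ {xs} {v} n with v ∈? xs
  ... | yes p = ⊥-elim (n p)
  ... | no _ = refl

  ∈-inB : ∀ {xs v} → inB xs v ≡ true → v ∈ xs
  ∈-inB {xs} {v} e with v ∈? xs
  ... | yes p = p
  ... | no _ with () ← e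

  cr-inside : ∀ {xs ys E} → (∀ {v} → v ∈ ys → v ∈ xs) → All (Within ys) E → ΣE (cr (inB xs)) E ≡ 0
  cr-inside {xs} h w = ΣE-zero (All.map (λ { (p , q) → cr-eq (inB xs) (trans (inB-∈ (h p)) (sym (inB-∈ (h q)))) }) w)

  cr-outside : ∀ {xs ys E} → (∀ {v} → v ∈ ys → v ∉ xs) → All (Within ys) E → ΣE (cr (inB xs)) E ≡ 0
  cr-outside {xs} h w = ΣE-zero (All.map (λ { (p , q) → cr-eq (inB xs) (trans (inB-∉ (h p)) (sym (inB-∉ (h q)))) }) w)

  comp-cut : ∀ {F : Graph k} {c ψ} → Rep F (c ∷ ψ) → Distinct (c ∷ ψ) → cross (inB (vsC c)) F ≡ 0
  comp-cut {F} {c} {ψ} r (distinct u) = trans (sums r (cr κ) (cr-sym κ)) (trans (ΣE-++ (cr κ) (esC c) (es ψ))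
    (cong₂ _+_ (cr-inside {vsC c} id (esC-within c)) (cr-outside {vsC c} (λ p q → disjoint (vsC c) u q p) (es-within ψ))))
    where κ = inB (vsC c)

  edge-cut : ∀ {F : Graph k} {s t ψ} → Rep F (join s t ∷ ψ) → Distinct (join s t ∷ ψ) → cross (inB (vsT s)) F ≤ 1
  edge-cut {F} {s} {t} {ψ} r (distinct u) = ≤-reflexive (trans (sums r (cr κ) (cr-sym κ)) (trans (cong (cr κ (rt s) (rt t) +_) (trans (ΣE-++ (cr κ) (esT s ++ esT t) (es ψ))
    (cong₂ _+_ (trans (ΣE-++ (cr κ) (esT s) (esT t)) (cong₂ _+_ (cr-inside {vsT s} id (esT-within s)) (cr-outside {vsT s} out (esT-within t))))
               (cr-outside {vsT s} (λ p q → disjoint (vsT s ++ vsT t) u (∈-++⁺ˡ q) p) (es-within ψ)))))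
      (cong (_+ 0) (cr-ne κ (λ e → tf (trans (sym (inB-∈ (rt∈ s))) (trans e (inB-∉ (out (rt∈ t))))))))))
    where
    κ = inB (vsT s)
    out : ∀ {v} → v ∈ vsT t → v ∉ vsT s
    out p q = disjoint (vsT s) (uniqueˡ (vsT s ++ vsT t) u) q p
    tf : true ≡ false → ⊥
    tf ()

  conf-cut : ∀ {F : Graph k} {φ a b p q} → Rep F φ → Distinct φ → Conf φ a b p q
    → ∃[ κ ] cross κ F ≤ 1 × κ a ≡ κ b × κ p ≡ κ q × κ a ≢ κ p
  conf-cut {F} {φ} {a} {b} {p} {q} r d cf with locate cf
    where
    locate : ∀ {φ} → Conf φ a b p q → ∃[ c ] c ∈ φ × ConfC c a b p q
    locate (here x) = _ , at₀ , x
    locate (there x) with locate x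
    ... | c , m , y = c , there m , y
  ... | c , m , (u , s , side) with remove∈ m | exposeC s
  ... | ψ , pm | K , e = inB (vsT u) , edge-cut (rep-≃ e₁ r) (uniq-≃ e₁ d) , vals side
    where
    e₁ : φ ≃ (join u K ∷ ψ)
    e₁ = reroot d (≃-perm pm) e
    tf : true ≡ false → ⊥
    tf ()
    vals : Side c u a b p q ⊎ Side c u p q a b → inB (vsT u) a ≡ inB (vsT u) b × inB (vsT u) p ≡ inB (vsT u) q × inB (vsT u) a ≢ inB (vsT u) p
    vals (inj₁ ((x , y) , (_ , z) , (_ , w))) = trans (inB-∈ x) (sym (inB-∈ y)) , trans (inB-∉ z) (sym (inB-∉ w)) , (λ e → tf (trans (sym (inB-∈ x)) (trans e (inB-∉ z))))
    vals (inj₂ ((x , y) , (_ , z) , (_ , w))) = trans (inB-∉ z) (sym (inB-∉ w)) , trans (inB-∈ x) (sym (inB-∈ y)) , (λ e → tf (trans (sym (inB-∈ x)) (trans (sym e) (inB-∉ z))))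

  crossing : ∀ {P : Edges {k}} (κ : V k → Bool) {x y} → Conn P x y → κ x ≢ κ y → ∃[ c ] ∃[ d ] ((c , d) ∈ P ⊎ (d , c) ∈ P) × κ c ≢ κ d × Conn P x c
  crossing κ stay n = ⊥-elim (n refl)
  crossing κ (move {a} {b} l p) n with κ a Data.Bool.≟ κ b
  ... | no q = a , b , l , q , stay
  ... | yes e with crossing κ p (λ z → n (trans e z))
  ... | c , d , l' , q , r = c , d , l' , q , move l r

  one-crossing : ∀ {S : Graph k} κ {c d c' d'} → cross κ S ≤ 1 → Adj S c d → Adj S c' d' → κ c ≢ κ d → κ c' ≢ κ d' → (c ≡ c' × d ≡ d') ⊎ (c ≡ d' × d ≡ c')
  one-crossing {S} κ {c} {d} {c'} {d'} le e e' n n' = go (adj-edge {S} {c} {d} e) (adj-edge {S} {c'} {d'} e')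
    where
    two : ∀ {a b a' b'} → (a , b) ∈ edges S → (a' , b') ∈ edges S → κ a ≢ κ b → κ a' ≢ κ b' → (a , b) ≡ (a' , b')
    two {a} {b} {a'} {b'} m m' q q' with ×-≡-dec _≟V_ _≟V_ (a , b) (a' , b')
    ... | yes eq = eq
    ... | no ne with remove∈ m
    ... | E' , p with ∈-resp-↭ p m'
    ... | here eq = ⊥-elim (ne (sym eq))
    ... | there m'' with ≤-trans (+-mono-≤ (≤-reflexive (sym (cr-ne κ q))) (≤-trans (≤-reflexive (sym (cr-ne κ q'))) (ΣE-∈ {f = cr κ} m''))) (≤-trans (≤-reflexive (sym (ΣE-↭ (cr κ) p))) le)
    ... | s≤s ()
    go : (c , d) ∈ edges S ⊎ (d , c) ∈ edges S → (c' , d') ∈ edges S ⊎ (d' , c') ∈ edges S → (c ≡ c' × d ≡ d') ⊎ (c ≡ d' × d ≡ c')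
    go (inj₁ m) (inj₁ m') = let q = two m m' n n' in inj₁ (cong proj₁ q , cong proj₂ q)
    go (inj₁ m) (inj₂ m') = let q = two m m' n (λ z → n' (sym z)) in inj₂ (cong proj₁ q , cong proj₂ q)
    go (inj₂ m) (inj₁ m') = let q = two m m' (λ z → n (sym z)) n' in inj₂ (cong proj₂ q , cong proj₁ q)
    go (inj₂ m) (inj₂ m') = let q = two m m' (λ z → n (sym z)) (λ z → n' (sym z)) in inj₁ (cong proj₂ q , cong proj₁ q)

  no-crossing : ∀ {S : Graph k} κ {a b} → cross κ S ≡ 0 → Adj S a b → κ a ≡ κ b
  no-crossing {S} κ {a} {b} z e with κ a Data.Bool.≟ κ b
  ... | yes q = q
  ... | no n = ⊥-elim (go (adj-edge {S} {a} {b} e))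
    where
    bad : 1 ≤ 0 → ⊥
    bad ()
    go : (a , b) ∈ edges S ⊎ (b , a) ∈ edges S → ⊥
    go (inj₁ m) = bad (≤-trans (≤-reflexive (sym (cr-ne κ n))) (≤-trans (ΣE-∈ {f = cr κ} m) (≤-reflexive z)))
    go (inj₂ m) = bad (≤-trans (≤-reflexive (sym (cr-ne κ (λ q → n (sym q))))) (≤-trans (ΣE-∈ {f = cr κ} m) (≤-reflexive z)))

module _ {A : Set} where

  sel : (A → Bool) → List A → List A
  sel p [] = []
  sel p (x ∷ xs) = if p x then x ∷ sel p xs else sel p xs

  sel⁻ : ∀ p {x} xs → x ∈ sel p xs → x ∈ xs × p x ≡ true
  sel⁻ p (y ∷ xs) m with p y in eq
  sel⁻ p (y ∷ xs) at₀ | true = at₀ , eq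
  sel⁻ p (y ∷ xs) (there m) | true = let a , b = sel⁻ p xs m in there a , b
  sel⁻ p (y ∷ xs) m | false = let a , b = sel⁻ p xs m in there a , b

  sel⁺ : ∀ p {x} xs → x ∈ xs → p x ≡ true → x ∈ sel p xs
  sel⁺ p (y ∷ xs) at₀ e rewrite e = at₀
  sel⁺ p (y ∷ xs) (there m) e with p y
  ... | true = there (sel⁺ p xs m e)
  ... | false = sel⁺ p xs m e

module _ {k : ℕ} where

  cl : Edges {k} → V k → V k
  cl = clos id id

  cl-conn : ∀ P {z w} → cl P z ≡ cl P w → Conn P z w
  cl-conn = clos-conn id id

  conn-cl : ∀ P {z w} → Conn P z w → cl P z ≡ cl P w
  conn-cl = conn-clos id id

  cnt-inj : ∀ {A : Set} (f : A → V k) xs → Unique xs → (∀ {a b} → f a ≡ f b → a ≡ b) → length xs ≤ cnt f xs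
  cnt-inj f [] u h = z≤n
  cnt-inj f (x ∷ xs) u@(_ ∷ u') h = ≤-trans (s≤s (cnt-inj f xs u' h)) (≤-reflexive (sym (cnt-∷-new f x xs (λ p e → Unique[x∷xs]⇒x∉xs u (subst (_∈ xs) (h e) p)))))

  adjB : Graph k → V k × V k → Bool
  adjB G (a , b) = ⌊ 1 ≤? mult G a b ⌋

  adjB-true : ∀ {G a b} → adjB G (a , b) ≡ true → Adj G a b
  adjB-true {G} {a} {b} e with 1 ≤? mult G a b
  ... | yes p = p
  ... | no _ with () ← e

  adjB-adj : ∀ {G a b} → Adj G a b → adjB G (a , b) ≡ true
  adjB-adj {G} {a} {b} p with 1 ≤? mult G a b
  ... | yes _ = refl
  ... | no n = ⊥-elim (n p)

  module _ {N S S' : Graph k} (simp : Simple N) (subS : Subgraph S N) (subS' : Subgraph S' N) (acS : Acyclic S) where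

    bS bS' bB bJ : V k × V k → Bool
    bS = adjB S
    bS' = adjB S'
    bB e = bS e ∧ bS' e
    bJ e = bS e ∨ bS' e

    bB-S : ∀ {e} → bB e ≡ true → bS e ≡ true
    bB-S {e} p with bS e
    ... | true = refl
    ... | false with () ← p

    bB-S' : ∀ {e} → bB e ≡ true → bS' e ≡ true
    bB-S' {e} p with bS e
    ... | true = p
    ... | false with () ← p

    -- Without edges both sides are 3|xs|.  The left side never overtakes the right one, as an edge
    -- of S ∩ S' always joins two components of S ∩ S' (S being acyclic), and an edge that joins two
    -- components of N joins two components of S ∪ S'.
    module _ (xs : List (V k)) (uxs : Unique xs) (inxs : ∀ {v} → v ∈V N → v ∈ xs) where

      private
        # : Edges {k} → ℕ
        # P = cnt (cl P) xs

        Ineq : Edges {k} → Set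
        Ineq E = # (sel bB E) + # (sel bJ E) + length xs ≤ length E + # (sel bS E) + # (sel bS' E) + # E

        J≤N : ∀ E {a b} → a ∈ xs → b ∈ xs → # ((a , b) ∷ sel bJ E) + # E ≤ # (sel bJ E) + # ((a , b) ∷ E)
        J≤N E {a} {b} a∈ b∈ with cl E a ≟V cl E b
        ... | yes e = +-mono-≤ (recolour-coarser (cl (sel bJ E)) _ _ xs)
                (subst (λ c → # E ≤ cnt (recolour (cl E) c (cl E b)) xs) (sym e) (recolour-same (cl E) (cl E b) xs))
        ... | no n = s≤s⁻¹ (≤-trans (≤-trans (+-monoʳ-≤ (suc (# ((a , b) ∷ sel bJ E))) (recolour-≤ (cl E) (cl E a) (cl E b) xs))
                (+-monoˡ-≤ _ (recolour-< (cl (sel bJ E)) xs a∈ b∈ (λ q → n (conn-cl E (conn-⊆ (λ m → proj₁ (sel⁻ bJ E m)) (cl-conn (sel bJ E) q))))))) (≤-reflexive (+-suc (# (sel bJ E)) _)))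

        r≤ : ∀ P {e} → # P ≤ suc (# (e ∷ P))
        r≤ P {a , b} = recolour-≤ (cl P) (cl P a) (cl P b) xs

      count : ∀ E → (∀ {e} → e ∈ E → e ∈ edges N) → (∀ a b → ΣE (ind a b) E ≤ mult N a b) → Ineq E
      count [] _ _ = ≤-trans (≤-reflexive (+-comm (# [] + # []) (length xs))) (≤-trans (+-monoˡ-≤ (# [] + # []) (cnt-inj id xs uxs id)) (≤-reflexive (sym (+-assoc (# []) (# []) (# [])))))
      count (e@(a , b) ∷ E) sub le = go (bS e) refl (bS' e) refl
        where
        rec : Ineq E
        rec = count E (λ m → sub (there m)) (λ c d → ≤-trans (m≤n+m _ (ind c d a b)) (le c d))
        ok = All.lookup (edges-ok N) (sub at₀)
        a∈ : a ∈ xs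
        a∈ = inxs (proj₁ ok)
        b∈ : b ∈ xs
        b∈ = inxs (proj₁ (proj₂ ok))
        open ≤-Reasoning
        B J Sₙ S'ₙ Nₙ ℓ n N₁ : ℕ
        B = # (sel bB E)
        J = # (sel bJ E)
        Sₙ = # (sel bS E)
        S'ₙ = # (sel bS' E)
        Nₙ = # E
        ℓ = length E
        n = length xs
        N₁ = # (e ∷ E)
        J₁ = # (e ∷ sel bJ E)
        apart : bS e ≡ true → cl (sel bB E) a ≢ cl (sel bB E) b
        apart t q = acyclic-conn {G = S} {P = sel bB E} acS adj (adj-comm {G = S} a b (adjB-true {S} {a} {b} t)) (proj₂ (proj₂ ok)) dup (cl-conn (sel bB E) q)
          where
          adj : ∀ {c d} → (c , d) ∈ sel bB E ⊎ (d , c) ∈ sel bB E → Adj S c d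
          adj {c} {d} (inj₁ m) = adjB-true {S} {c} {d} (bB-S {c , d} (proj₂ (sel⁻ bB E m)))
          adj {c} {d} (inj₂ m) = adj-comm {G = S} d c (adjB-true {S} {d} {c} (bB-S {d , c} (proj₂ (sel⁻ bB E m))))
          two : 1 ≤ ΣE (ind a b) E → ⊥
          two p with ≤-trans (+-mono-≤ (≤-reflexive (sym (link-ind {a = a} {b} (inj₁ refl)))) p) (≤-trans (le a b) (simp a b))
          ... | s≤s ()
          dup : ¬ ((a , b) ∈ sel bB E ⊎ (b , a) ∈ sel bB E)
          dup (inj₁ m) = two (≤-trans (≤-reflexive (sym (link-ind {a = a} {b} (inj₁ refl)))) (ΣE-∈ {f = ind a b} (proj₁ (sel⁻ bB E m))))
          dup (inj₂ m) = two (≤-trans (≤-reflexive (sym (link-ind {a = a} {b} (inj₂ refl)))) (ΣE-∈ {f = ind a b} (proj₁ (sel⁻ bB E m))))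
        ar₁ : ∀ b j n m → b + j + n + m ≡ b + (j + m) + n
        ar₁ = solve-∀
        ar₂ : ∀ b j n m → b + (j + m) + n ≡ b + j + n + m
        ar₂ = solve-∀
        ar₃ : ∀ l s t n m → l + suc s + t + n + m ≡ suc (l + s + t + m) + n
        ar₃ = solve-∀
        ar₄ : ∀ l s t n m → l + s + suc t + n + m ≡ suc (l + s + t + m) + n
        ar₄ = solve-∀
        ar₅ : ∀ l s t n m → l + suc s + suc t + n + m ≡ suc (suc (l + s + t + m) + n)
        ar₅ = solve-∀
        go : ∀ p → bS e ≡ p → ∀ q → bS' e ≡ q → Ineq (e ∷ E)
        go false p false q rewrite p | q = ≤-trans rec (≤-trans (+-monoʳ-≤ (ℓ + Sₙ + S'ₙ) (r≤ E {e})) (≤-reflexive (+-suc (ℓ + Sₙ + S'ₙ) N₁)))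
        go true p false q rewrite p | q = +-cancelʳ-≤ Nₙ _ _ (begin
          B + J₁ + n + Nₙ ≡⟨ ar₁ B J₁ n Nₙ ⟩
          B + (J₁ + Nₙ) + n ≤⟨ +-monoˡ-≤ n (+-monoʳ-≤ B (J≤N E a∈ b∈)) ⟩
          B + (J + N₁) + n ≡⟨ ar₂ B J n N₁ ⟩
          B + J + n + N₁ ≤⟨ +-monoˡ-≤ N₁ rec ⟩
          ℓ + Sₙ + S'ₙ + Nₙ + N₁ ≤⟨ +-monoˡ-≤ N₁ (+-monoˡ-≤ Nₙ (+-monoˡ-≤ S'ₙ (+-monoʳ-≤ ℓ (r≤ (sel bS E) {e})))) ⟩
          ℓ + suc (# (e ∷ sel bS E)) + S'ₙ + Nₙ + N₁ ≡⟨ ar₃ ℓ (# (e ∷ sel bS E)) S'ₙ Nₙ N₁ ⟩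
          suc (ℓ + # (e ∷ sel bS E) + S'ₙ + N₁) + Nₙ ∎)
        go false p true q rewrite p | q = +-cancelʳ-≤ Nₙ _ _ (begin
          B + J₁ + n + Nₙ ≡⟨ ar₁ B J₁ n Nₙ ⟩
          B + (J₁ + Nₙ) + n ≤⟨ +-monoˡ-≤ n (+-monoʳ-≤ B (J≤N E a∈ b∈)) ⟩
          B + (J + N₁) + n ≡⟨ ar₂ B J n N₁ ⟩
          B + J + n + N₁ ≤⟨ +-monoˡ-≤ N₁ rec ⟩
          ℓ + Sₙ + S'ₙ + Nₙ + N₁ ≤⟨ +-monoˡ-≤ N₁ (+-monoˡ-≤ Nₙ (+-monoʳ-≤ (ℓ + Sₙ) (r≤ (sel bS' E) {e}))) ⟩
          ℓ + Sₙ + suc (# (e ∷ sel bS' E)) + Nₙ + N₁ ≡⟨ ar₄ ℓ Sₙ (# (e ∷ sel bS' E)) Nₙ N₁ ⟩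
          suc (ℓ + Sₙ + # (e ∷ sel bS' E) + N₁) + Nₙ ∎)
        go true p true q with apart p
        ... | ap rewrite p | q = +-cancelʳ-≤ Nₙ _ _ (s≤s⁻¹ (begin
          suc (# (e ∷ sel bB E)) + J₁ + n + Nₙ ≤⟨ +-monoˡ-≤ Nₙ (+-monoˡ-≤ n (+-monoˡ-≤ J₁ (recolour-< (cl (sel bB E)) xs a∈ b∈ ap))) ⟩
          B + J₁ + n + Nₙ ≡⟨ ar₁ B J₁ n Nₙ ⟩
          B + (J₁ + Nₙ) + n ≤⟨ +-monoˡ-≤ n (+-monoʳ-≤ B (J≤N E a∈ b∈)) ⟩
          B + (J + N₁) + n ≡⟨ ar₂ B J n N₁ ⟩
          B + J + n + N₁ ≤⟨ +-monoˡ-≤ N₁ rec ⟩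
          ℓ + Sₙ + S'ₙ + Nₙ + N₁ ≤⟨ +-monoˡ-≤ N₁ (+-monoˡ-≤ Nₙ (+-mono-≤ (+-monoʳ-≤ ℓ (r≤ (sel bS E) {e})) (r≤ (sel bS' E) {e}))) ⟩
          ℓ + suc (# (e ∷ sel bS E)) + suc (# (e ∷ sel bS' E)) + Nₙ + N₁ ≡⟨ ar₅ ℓ (# (e ∷ sel bS E)) (# (e ∷ sel bS' E)) Nₙ N₁ ⟩
          suc (suc (ℓ + # (e ∷ sel bS E) + # (e ∷ sel bS' E) + N₁) + Nₙ) ∎))

  -- Forgetting a vertex does not increase |cB| + |join| - |f| - |g|

  module _ {A : Set} (_≟A_ : ∀ (a b : A) → Dec (a ≡ b)) (e : A → V k) (e-inj : ∀ {z w} → e z ≡ e w → z ≡ w) (cB f g : A → V k)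
    (Bf : ∀ {z w} → cB z ≡ cB w → f z ≡ f w) (Bg : ∀ {z w} → cB z ≡ cB w → g z ≡ g w) (c d : ℕ) where

    Both : A → A → Set
    Both z w = f z ≡ f w ⊎ g z ≡ g w

    Bound : List A → Set
    Bound xs = Σ (A → V k) λ γ → Join xs Both γ × cnt cB xs + cnt γ xs + c ≤ d + cnt f xs + cnt g xs

    private
      mateOf : ∀ (h : A → V k) x xs → (∃[ m ] m ∈ xs × h m ≡ h x) ⊎ (∀ {y} → y ∈ xs → h y ≢ h x)
      mateOf h x xs with has h (h x) xs in eq
      ... | true = inj₁ (has-true h xs eq)
      ... | false = inj₂ (λ p q → tf (trans (sym (has-∈ h xs p q)) eq))
        where
        tf : true ≡ false → ⊥
        tf ()

    forget : ∀ {x xs} → x ∉ xs → Bound (x ∷ xs) → Bound xs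
    forget {x} {xs} x∉ (γ , J , ineq) = δ , Jδ , go (mateOf f x xs) (mateOf g x xs) (mateOf cB x xs)
      where
      ex : ∃[ δ ] Join xs Both δ
      ex = join-exists e e-inj xs (λ z w → (f z ≟V f w) ⊎-dec (g z ≟V g w))
      δ : A → V k
      δ = proj₁ ex
      Jδ : Join xs Both δ
      Jδ = proj₂ ex
      hδ : ∀ {z w} → z ∈ xs → w ∈ xs → Both z w → δ z ≡ δ w
      hδ = closed Jδ
      both-sym : ∀ {z w} → Both z w → Both w z
      both-sym = Data.Sum.map sym sym
      via : ∀ col' → (∀ {z} → z ∈ xs → Both x z → δ z ≡ col') → cnt δ xs ≤ cnt γ (x ∷ xs)
      via col' h = ≤-trans (join-remove _≟A_ J x∉ δ hδ col' h (λ p r → h p (both-sym r))) (cnt-∷-≤ γ x xs)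
      b₀ = cnt cB xs
      f₀ = cnt f xs
      g₀ = cnt g xs
      open ≤-Reasoning
      ar₁ : ∀ b s c → b + suc s + c ≡ suc b + s + c
      ar₁ = solve-∀
      ar₂ : ∀ b s c → b + suc s + c ≡ suc (b + s + c)
      ar₂ = solve-∀
      ar₃ : ∀ b s c → b + suc s + suc c ≡ suc (suc (b + s + c))
      ar₃ = solve-∀
      go : (∃[ m ] m ∈ xs × f m ≡ f x) ⊎ (∀ {y} → y ∈ xs → f y ≢ f x) → (∃[ m ] m ∈ xs × g m ≡ g x) ⊎ (∀ {y} → y ∈ xs → g y ≢ g x)
         → (∃[ m ] m ∈ xs × cB m ≡ cB x) ⊎ (∀ {y} → y ∈ xs → cB y ≢ cB x) → b₀ + cnt δ xs + c ≤ d + f₀ + g₀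
      go _ _ (inj₁ (m , m∈ , q)) = begin
        b₀ + cnt δ xs + c ≤⟨ +-monoˡ-≤ c (+-monoʳ-≤ b₀ (via (δ m) h)) ⟩
        b₀ + cnt γ (x ∷ xs) + c ≡⟨ cong (λ n → n + cnt γ (x ∷ xs) + c) (sym (cnt-∷-old cB x xs m∈ q)) ⟩
        cnt cB (x ∷ xs) + cnt γ (x ∷ xs) + c ≤⟨ ineq ⟩
        d + cnt f (x ∷ xs) + cnt g (x ∷ xs) ≡⟨ cong₂ (λ m n → d + m + n) (cnt-∷-old f x xs m∈ (Bf q)) (cnt-∷-old g x xs m∈ (Bg q)) ⟩
        d + f₀ + g₀ ∎
        where
        h : ∀ {z} → z ∈ xs → Both x z → δ z ≡ δ m
        h p (inj₁ r) = hδ p m∈ (inj₁ (trans (sym r) (sym (Bf q))))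
        h p (inj₂ r) = hδ p m∈ (inj₂ (trans (sym r) (sym (Bg q))))
      go (inj₁ (m , m∈ , q)) (inj₁ (m' , m∈' , q')) (inj₂ nb) = begin
        b₀ + cnt δ xs + c ≤⟨ +-monoˡ-≤ c (+-monoʳ-≤ b₀ (≤-trans (recolour-≤ δ (δ m) (δ m') xs) (s≤s viaμ))) ⟩
        b₀ + suc (cnt γ (x ∷ xs)) + c ≡⟨ ar₁ b₀ (cnt γ (x ∷ xs)) c ⟩
        suc b₀ + cnt γ (x ∷ xs) + c ≡⟨ cong (λ n → n + cnt γ (x ∷ xs) + c) (sym (cnt-∷-new cB x xs nb)) ⟩
        cnt cB (x ∷ xs) + cnt γ (x ∷ xs) + c ≤⟨ ineq ⟩
        d + cnt f (x ∷ xs) + cnt g (x ∷ xs) ≡⟨ cong₂ (λ m n → d + m + n) (cnt-∷-old f x xs m∈ q) (cnt-∷-old g x xs m∈' q') ⟩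
        d + f₀ + g₀ ∎
        where
        μ : A → V k
        μ = recolour δ (δ m) (δ m')
        h : ∀ {z} → z ∈ xs → Both x z → μ z ≡ μ m
        h p (inj₁ r) = recolour-cong δ (δ m) (δ m') (hδ p m∈ (inj₁ (trans (sym r) (sym q))))
        h p (inj₂ r) = trans (recolour-cong δ (δ m) (δ m') (hδ p m∈' (inj₂ (trans (sym r) (sym q'))))) (sym (recolour-eq δ (δ m) (δ m') {m} {m'} refl refl))
        viaμ : cnt μ xs ≤ cnt γ (x ∷ xs)
        viaμ = ≤-trans (join-remove _≟A_ J x∉ μ (λ p q r → recolour-cong δ (δ m) (δ m') (hδ p q r)) (μ m) h (λ p r → h p (both-sym r))) (cnt-∷-≤ γ x xs)
      go (inj₁ (m , m∈ , q)) (inj₂ n') (inj₂ nb) = s≤s⁻¹ (begin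
        suc b₀ + cnt δ xs + c ≤⟨ +-monoˡ-≤ c (+-monoʳ-≤ (suc b₀) (via (δ m) h)) ⟩
        suc b₀ + cnt γ (x ∷ xs) + c ≡⟨ cong (λ n → n + cnt γ (x ∷ xs) + c) (sym (cnt-∷-new cB x xs nb)) ⟩
        cnt cB (x ∷ xs) + cnt γ (x ∷ xs) + c ≤⟨ ineq ⟩
        d + cnt f (x ∷ xs) + cnt g (x ∷ xs) ≡⟨ cong₂ (λ m n → d + m + n) (cnt-∷-old f x xs m∈ q) (cnt-∷-new g x xs n') ⟩
        d + f₀ + suc g₀ ≡⟨ +-suc (d + f₀) g₀ ⟩
        suc (d + f₀ + g₀) ∎)
        where
        h : ∀ {z} → z ∈ xs → Both x z → δ z ≡ δ m
        h p (inj₁ r) = hδ p m∈ (inj₁ (trans (sym r) (sym q)))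
        h p (inj₂ r) = ⊥-elim (n' p (sym r))
      go (inj₂ n) (inj₁ (m' , m∈' , q')) (inj₂ nb) = s≤s⁻¹ (begin
        suc b₀ + cnt δ xs + c ≤⟨ +-monoˡ-≤ c (+-monoʳ-≤ (suc b₀) (via (δ m') h)) ⟩
        suc b₀ + cnt γ (x ∷ xs) + c ≡⟨ cong (λ n → n + cnt γ (x ∷ xs) + c) (sym (cnt-∷-new cB x xs nb)) ⟩
        cnt cB (x ∷ xs) + cnt γ (x ∷ xs) + c ≤⟨ ineq ⟩
        d + cnt f (x ∷ xs) + cnt g (x ∷ xs) ≡⟨ cong₂ (λ m n → d + m + n) (cnt-∷-new f x xs n) (cnt-∷-old g x xs m∈' q') ⟩
        d + suc f₀ + g₀ ≡⟨ ar₂ d f₀ g₀ ⟩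
        suc (d + f₀ + g₀) ∎)
        where
        h : ∀ {z} → z ∈ xs → Both x z → δ z ≡ δ m'
        h p (inj₁ r) = ⊥-elim (n p (sym r))
        h p (inj₂ r) = hδ p m∈' (inj₂ (trans (sym r) (sym q')))
      go (inj₂ n) (inj₂ n') (inj₂ nb) = s≤s⁻¹ (s≤s⁻¹ (begin
        suc (suc (b₀ + cnt δ xs + c)) ≡⟨ cong suc (sym (ar₂ b₀ (cnt δ xs) c)) ⟩
        suc b₀ + suc (cnt δ xs) + c ≤⟨ +-monoˡ-≤ c (+-monoʳ-≤ (suc b₀) (join-remove-iso _≟A_ J x∉ δ hδ alone' (λ p r → alone' p (both-sym r)))) ⟩
        suc b₀ + cnt γ (x ∷ xs) + c ≡⟨ cong (λ n → n + cnt γ (x ∷ xs) + c) (sym (cnt-∷-new cB x xs nb)) ⟩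
        cnt cB (x ∷ xs) + cnt γ (x ∷ xs) + c ≤⟨ ineq ⟩
        d + cnt f (x ∷ xs) + cnt g (x ∷ xs) ≡⟨ cong₂ (λ m n → d + m + n) (cnt-∷-new f x xs n) (cnt-∷-new g x xs n') ⟩
        d + suc f₀ + suc g₀ ≡⟨ ar₃ d f₀ g₀ ⟩
        suc (suc (d + f₀ + g₀)) ∎))
        where
        alone' : ∀ {z} → z ∈ xs → ¬ Both x z
        alone' p (inj₁ r) = n p (sym r)
        alone' p (inj₂ r) = n' p (sym r)

    forget-all : ∀ us {xs} → Unique (us ++ xs) → Bound (us ++ xs) → Bound xs
    forget-all [] u b = b
    forget-all (x ∷ us) u@(_ ∷ u') b = forget-all us u' (forget (Unique[x∷xs]⇒x∉xs u) b)

module _ {k : ℕ} where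

  open DecMem (_≟V_ {k}) using (_∈?_)

  reach-const : ∀ {F : Graph k} {B : Set} (χ : V k → B) → (∀ a b → Adj F a b → χ a ≡ χ b) → ∀ {a b} → Reach F a b → χ a ≡ χ b
  reach-const χ h (here _) = refl
  reach-const χ h (there {a} {b} p r) = trans (h a b p) (reach-const χ h r)

  module _ {S T F : Graph k} {φ : Forest k} (sup : SuppressAll S T) (i : Iso T F) (lF : ∀ x → ι x ∈V F) (m : Models F φ) where

    same-colour : ∀ (χ : V k → V k) → (∀ a b → Adj S a b → χ a ≡ χ b) → ∀ {x y} → Same φ (ι x) (ι y) → χ (ι x) ≡ χ (ι y)
    same-colour χ h {x} {y} s = let χ' , eq , h' = push-colour {S = S} {T} {F} sup i lF χ h in
      trans (sym (eq x)) (trans (reach-const {F = F} χ' h' (same-reach (rep m) s)) (eq y))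

    cnt-components : ∀ (χ : V k → V k) → (∀ a b → Adj S a b → χ a ≡ χ b) → ∀ L → cnt (λ x → χ (ι x)) L ≤ length φ
    cnt-components χ h L = ≤-trans (cnt-length (λ x → χ (ι x)) L (map colour φ) (λ {x} _ → go φ id (∈-concatMap⁻ vsC {xs = φ} (vF (rep m) (lF x)))))
        (≤-reflexive (length-map colour φ))
      where
      colour : Comp k → V k
      colour c = χ (ι (proj₁ (compLabel {c = c})))
      go : ∀ ψ → (∀ {a b} → Same ψ a b → Same φ a b) → ∀ {x} → Any (λ c → ι x ∈ vsC c) ψ → χ (ι x) ∈ map colour ψ
      go (c ∷ ψ) f (here p) = here (same-colour χ h (f (here (p , proj₂ (compLabel {c = c})))))
      go (c ∷ ψ) f (there p) = there (go ψ (λ s → f (there s)) p)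

    module _ {P : Edges {k}} (hP : ∀ a b → (a , b) ∈ P → Adj S a b) where

      linkP : ∀ a b → (a , b) ∈ P ⊎ (b , a) ∈ P → Adj S a b
      linkP a b (inj₁ q) = hP a b q
      linkP a b (inj₂ q) = adj-comm {G = S} b a (hP b a q)

      conn-same : ∀ {x y} → Conn P (ι x) (ι y) → Same φ (ι x) (ι y)
      conn-same {x} {y} cn with comp-front (vF (rep m) (lF x))
      ... | c , ψ , e , x∈ with lift-cut {S = S} {T} {F} sup i lF (inB (vsC c))
      ... | κ , hκ , cz = same← (≃-perm e) (here (x∈ , ∈-inB (trans (sym (hκ y)) (trans (sym eq) (trans (hκ x) (inB-∈ x∈))))))
        where
        z : cross κ S ≡ 0
        z = trans cz (comp-cut {F = F} (rep-≃ (≃-perm e) (rep m)) (uniq-≃ (≃-perm e) (dis m)))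
        eq : κ (ι x) ≡ κ (ι y)
        eq = conn-const κ (λ {a} {b} q → no-crossing {S = S} κ {a} {b} z (hP a b q)) cn

      cut-of : ∀ {x y z w} → Conf φ (ι x) (ι y) (ι z) (ι w) → ∃[ κ ] cross κ S ≤ 1 × κ (ι x) ≡ κ (ι y) × κ (ι z) ≡ κ (ι w) × κ (ι x) ≢ κ (ι z)
      cut-of {x} {y} {z} {w} cf with conf-cut {F = F} (rep m) (dis m) cf
      ... | κ₀ , le , e₁ , e₂ , n with lift-cut {S = S} {T} {F} sup i lF κ₀
      ... | κ , hκ , cz = κ , ≤-trans (≤-reflexive cz) le , trans (hκ x) (trans e₁ (sym (hκ y))) , trans (hκ z) (trans e₂ (sym (hκ w)))
        , (λ q → n (trans (sym (hκ x)) (trans q (hκ z))))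

      respects : Respects (λ x → cl P (ι x)) φ
      respects = record { conn = λ _ _ e → conn-same (cl-conn P e) ; disj = dj }
        where
        dj : ∀ {x y z w} → Conf φ (ι x) (ι z) (ι y) (ι w) → cl P (ι x) ≡ cl P (ι y) → cl P (ι z) ≡ cl P (ι w) → cl P (ι x) ≡ cl P (ι z)
        dj {x} {y} {z} {w} cf e e' with cut-of cf
        ... | κ , le , xz , yw , n with crossing κ (cl-conn P e) n | crossing κ (cl-conn P e') (λ q → n (trans xz (trans q (sym yw))))
        ... | c , d , l , nl , r | c' , d' , l' , nl' , r' = trans (conn-cl P r) (trans (sameEdge (one-crossing {S = S} κ {c} {d} {c'} {d'} le (linkP c d l) (linkP c' d' l') nl nl')) (sym (conn-cl P r')))
          where
          sameEdge : (c ≡ c' × d ≡ d') ⊎ (c ≡ d' × d ≡ c') → cl P c ≡ cl P c'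
          sameEdge (inj₁ (refl , refl)) = refl
          sameEdge (inj₂ (refl , refl)) = conn-cl P (move l stay)

  -- Two crossing cuts of a connected graph with one edge each: the quadrant avoiding both edges is isolated.
  quadrants : ∀ {P : Edges {k}} {S S' : Graph k} → (∀ a b → (a , b) ∈ P → Adj S a b) → (∀ a b → (a , b) ∈ P → Adj S' a b)
    → ∀ κ κ' → cross κ S ≤ 1 → cross κ' S' ≤ 1 → ∀ {x y z w} → Conn P x y → Conn P x z → Conn P x w
    → κ x ≡ κ y → κ z ≡ κ w → κ x ≢ κ z → κ' x ≡ κ' z → κ' y ≡ κ' w → κ' x ≢ κ' y → ⊥
  quadrants {P} {S} {S'} hS hS' κ κ' le le' {x} {y} {z} {w} cy cz cw xy zw nxz xz yw nxy = go (crossing κ cz nxz) (crossing κ' cy nxy)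
    where
    lS : ∀ a b → (a , b) ∈ P ⊎ (b , a) ∈ P → Adj S a b
    lS a b (inj₁ q) = hS a b q
    lS a b (inj₂ q) = adj-comm {G = S} b a (hS b a q)
    lS' : ∀ a b → (a , b) ∈ P ⊎ (b , a) ∈ P → Adj S' a b
    lS' a b (inj₁ q) = hS' a b q
    lS' a b (inj₂ q) = adj-comm {G = S'} b a (hS' b a q)
    neg : ∀ {a b : Bool} → a ≢ b → b ≡ not a
    neg {true} {true} n = ⊥-elim (n refl)
    neg {true} {false} n = refl
    neg {false} {true} n = refl
    neg {false} {false} n = ⊥-elim (n refl)
    final : ∀ i j α β → (α xor i) ∧ (β xor j) ≡ (α xor i) ∧ (not β xor j) → (α xor i) ∧ (β xor j) ≡ (not α xor i) ∧ (β xor j)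
      → (α xor i) ∧ (β xor j) ≡ (not α xor i) ∧ (not β xor j) → ⊥
    final true true true true p q ()
    final true true true false p () r
    final true true false true () q r
    final true true false false () q r
    final true false true true p () r
    final true false true false p q ()
    final true false false true () q r
    final true false false false () q r
    final false true true true () q r
    final false true true false () q r
    final false true false true p q ()
    final false true false false p () r
    final false false true true () q r
    final false false true false () q r
    final false false false true p () r
    final false false false false p q ()
    go : (∃[ c ] ∃[ d ] ((c , d) ∈ P ⊎ (d , c) ∈ P) × κ c ≢ κ d × Conn P x c) → (∃[ c ] ∃[ d ] ((c , d) ∈ P ⊎ (d , c) ∈ P) × κ' c ≢ κ' d × Conn P x c) → ⊥
    go (c , d , l , n , _) (c' , d' , l' , n' , _) = split (κ' c Data.Bool.≟ κ' d)
      where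
      split : Dec (κ' c ≡ κ' d) → ⊥
      split (no nc) = odd (κ x) (κ' x) (trans (conn-const π hπ cy) (cong₂ _xor_ (sym xy) (neg nxy)))
        where
        π : V k → Bool
        π v = κ v xor κ' v
        hπ : ∀ {a b} → (a , b) ∈ P → π a ≡ π b
        hπ {a} {b} m with κ a Data.Bool.≟ κ b | κ' a Data.Bool.≟ κ' b
        ... | yes p | yes q = cong₂ _xor_ p q
        ... | no p | no q = trans (flip₂ (κ a) (κ' a)) (cong₂ _xor_ (sym (neg p)) (sym (neg q)))
          where
          flip₂ : ∀ a b → a xor b ≡ not a xor not b
          flip₂ true true = refl
          flip₂ true false = refl
          flip₂ false true = refl
          flip₂ false false = refl
        ... | no p | yes q with one-crossing {S = S} κ {a} {b} {c} {d} le (hS a b m) (lS c d l) p n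
        ... | inj₁ (refl , refl) = ⊥-elim (nc q)
        ... | inj₂ (refl , refl) = ⊥-elim (nc (sym q))
        hπ {a} {b} m | yes p | no q with one-crossing {S = S'} κ' {a} {b} {c} {d} le' (hS' a b m) (lS' c d l) q nc
        ... | inj₁ (refl , refl) = ⊥-elim (n p)
        ... | inj₂ (refl , refl) = ⊥-elim (n (sym p))
        odd : ∀ a b → a xor b ≡ a xor not b → ⊥
        odd true true ()
        odd true false ()
        odd false true ()
        odd false false ()
      split (yes jc) = final (κ c') (κ' c) (κ x) (κ' x)
          (trans (conn-const π hπ cy) (cong₂ quad (sym xy) (neg nxy)))
          (trans (conn-const π hπ cz) (cong₂ quad (neg nxz) (sym xz)))
          (trans (conn-const π hπ cw) (cong₂ quad (trans (sym zw) (neg nxz)) (trans (sym yw) (neg nxy))))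
        where
        quad : Bool → Bool → Bool
        quad a b = (a xor κ c') ∧ (b xor κ' c)
        π : V k → Bool
        π v = quad (κ v) (κ' v)
        ic : κ c' ≡ κ d'
        ic with κ c' Data.Bool.≟ κ d'
        ... | yes p = p
        ... | no p with one-crossing {S = S} κ {c'} {d'} {c} {d} le (lS c' d' l') (lS c d l) p n
        ... | inj₁ (refl , refl) = ⊥-elim (n' jc)
        ... | inj₂ (refl , refl) = ⊥-elim (n' (sym jc))
        off₁ : ∀ {a b} → b ≡ κ' c → quad a b ≡ false
        off₁ {a} refl with a xor κ c' | κ' c
        ... | true | true = refl
        ... | true | false = refl
        ... | false | _ = refl
        off₂ : ∀ {a b} → a ≡ κ c' → quad a b ≡ false
        off₂ refl with κ c'
        ... | true = refl
        ... | false = refl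
        hπ : ∀ {a b} → (a , b) ∈ P → π a ≡ π b
        hπ {a} {b} m with κ a Data.Bool.≟ κ b | κ' a Data.Bool.≟ κ' b
        ... | yes p | yes q = cong₂ quad p q
        ... | no p | _ with one-crossing {S = S} κ {a} {b} {c} {d} le (hS a b m) (lS c d l) p n
        ... | inj₁ (refl , refl) = trans (off₁ {κ c} refl) (sym (off₁ {κ d} (sym jc)))
        ... | inj₂ (refl , refl) = trans (off₁ {κ d} (sym jc)) (sym (off₁ {κ c} refl))
        hπ {a} {b} m | yes p | no q with one-crossing {S = S'} κ' {a} {b} {c'} {d'} le' (hS' a b m) (lS' c' d' l') q n'
        ... | inj₁ (refl , refl) = trans (off₂ {b = κ' c'} refl) (sym (off₂ {b = κ' d'} (sym ic)))
        ... | inj₂ (refl , refl) = trans (off₂ {b = κ' d'} (sym ic)) (sym (off₂ {b = κ' c'} refl))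

  unlabelled : List (V k) → List (V k)
  unlabelled [] = []
  unlabelled (inj₁ x ∷ vs) = unlabelled vs
  unlabelled (inj₂ n ∷ vs) = inj₂ n ∷ unlabelled vs

  labels : List (V k) → List (X k)
  labels [] = []
  labels (inj₁ x ∷ vs) = x ∷ labels vs
  labels (inj₂ n ∷ vs) = labels vs

  sort-↭ : ∀ vs → vs ↭ unlabelled vs ++ map ι (labels vs)
  sort-↭ [] = ↭-refl
  sort-↭ (inj₁ x ∷ vs) = ↭-trans (prep _ (sort-↭ vs)) (↭-sym (shift (ι x) (unlabelled vs) (map ι (labels vs))))
  sort-↭ (inj₂ n ∷ vs) = prep _ (sort-↭ vs)

  ∈-labels : ∀ {x} vs → ι x ∈ vs → x ∈ labels vs
  ∈-labels (inj₁ y ∷ vs) at₀ = at₀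
  ∈-labels (inj₁ y ∷ vs) (there p) = there (∈-labels vs p)
  ∈-labels (inj₂ n ∷ vs) (there p) = ∈-labels vs p

  has-map : ∀ (f : V k → V k) c xs → has f c (map ι xs) ≡ has (λ x → f (ι x)) c xs
  has-map f c [] = refl
  has-map f c (x ∷ xs) = cong (eqb (f (ι x)) c ∨_) (has-map f c xs)

  cnt-map : ∀ (f : V k → V k) xs → cnt f (map ι xs) ≡ cnt (λ x → f (ι x)) xs
  cnt-map f [] = refl
  cnt-map f (x ∷ xs) rewrite cnt-map f xs | has-map f (f (ι x)) xs = refl

module _ {k : ℕ} where

  module _ {N F F' : Graph k} (simp : Simple N) (con : Connected N) (lN : ∀ x → ι x ∈V N)
    {φ φ' : Forest k} (m : Models F φ) (m' : Models F' φ') (lF : ∀ x → ι x ∈V F) (lF' : ∀ x → ι x ∈V F')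
    {S S' T T' : Graph k} (subS : Subgraph S N) (acS : Acyclic S) (sup : SuppressAll S T) (i : Iso T F)
    (subS' : Subgraph S' N) (sup' : SuppressAll S' T') (i' : Iso T' F') where

    private
      E : Edges {k}
      E = edges N
      s s' b j : V k × V k → Bool
      s = bS {N = N} {S} {S'} simp subS subS' acS
      s' = bS' {N = N} {S} {S'} simp subS subS' acS
      b = bB {N = N} {S} {S'} simp subS subS' acS
      j = bJ {N = N} {S} {S'} simp subS subS' acS
      cB cS cS' : V k → V k
      cB = cl (sel b E)
      cS = cl (sel s E)
      cS' = cl (sel s' E)
      L : List (X k)
      L = labels (verts N)
      us xs : List (V k)
      us = unlabelled (verts N)
      xs = us ++ map ι L
      uxs : Unique xs
      uxs = unique-↭ (sort-↭ (verts N)) (verts-unique N)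
      inxs : ∀ {v} → v ∈V N → v ∈ xs
      inxs = ∈-resp-↭ (sort-↭ (verts N))
      xsN : ∀ {v} → v ∈ xs → v ∈V N
      xsN = ∈-resp-↭ (↭-sym (sort-↭ (verts N)))

      bs : ∀ {e} → b e ≡ true → s e ≡ true
      bs {e} = bB-S {N = N} {S} {S'} simp subS subS' acS {e}
      bs' : ∀ {e} → b e ≡ true → s' e ≡ true
      bs' {e} = bB-S' {N = N} {S} {S'} simp subS subS' acS {e}

      PS : ∀ a c → (a , c) ∈ sel b E → Adj S a c
      PS a c q = adjB-true {G = S} {a} {c} (bs {a , c} (proj₂ (sel⁻ b E q)))
      PS' : ∀ a c → (a , c) ∈ sel b E → Adj S' a c
      PS' a c q = adjB-true {G = S'} {a} {c} (bs' {a , c} (proj₂ (sel⁻ b E q)))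

      BS : ∀ {z w} → cB z ≡ cB w → cS z ≡ cS w
      BS e = conn-cl (sel s E) (conn-⊆ (λ {e} q → let p , t = sel⁻ b E q in sel⁺ s E p (bs {e} t)) (cl-conn (sel b E) e))
      BS' : ∀ {z w} → cB z ≡ cB w → cS' z ≡ cS' w
      BS' e = conn-cl (sel s' E) (conn-⊆ (λ {e} q → let p , t = sel⁻ b E q in sel⁺ s' E p (bs' {e} t)) (cl-conn (sel b E) e))

      const : ∀ (G : Graph k) → Subgraph G N → ∀ a c → Adj G a c → cl (sel (adjB G) E) a ≡ cl (sel (adjB G) E) c
      const G sub a c p = go (link∈ {Q = E} {a} {c} (≤-trans p (proj₂ sub a c)))
        where
        go : (a , c) ∈ E ⊎ (c , a) ∈ E → _
        go (inj₁ q) = conn-cl (sel (adjB G) E) (move (inj₁ (sel⁺ (adjB G) E q (adjB-adj {G = G} {a} {c} p))) stay)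
        go (inj₂ q) = conn-cl (sel (adjB G) E) (move (inj₂ (sel⁺ (adjB G) E q (adjB-adj {G = G} {c} {a} (adj-comm {G = G} a c p)))) stay)

      Bd : List (V k) → Set
      Bd = Bound _≟V_ id id cB cS cS' BS BS' (length xs) (length E + 1)

      start : Bd xs
      start = cl (sel j E) , J , ≤-trans (count {N = N} {S} {S'} simp subS subS' acS xs uxs inxs E id (λ _ _ → ≤-refl))
          (≤-trans (+-monoʳ-≤ _ (cnt-const (cl E) xs allSame)) (≤-reflexive (ar (length E) (cnt cS xs) (cnt cS' xs))))
        where
        ar : ∀ e p q → e + p + q + 1 ≡ e + 1 + p + q
        ar = solve-∀
        adjN : ∀ a c → Adj N a c → cl E a ≡ cl E c
        adjN a c p = go (link∈ {Q = E} {a} {c} p)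
          where
          go : (a , c) ∈ E ⊎ (c , a) ∈ E → cl E a ≡ cl E c
          go q = conn-cl E (move q stay)
        allSame : ∀ {z w} → z ∈ xs → w ∈ xs → cl E z ≡ cl E w
        allSame {z} {w} p q = reach-const {F = N} (cl E) adjN (con z w (xsN p) (xsN q))
        sj : ∀ {e} → s e ≡ true → j e ≡ true
        sj p rewrite p = refl
        s'j : ∀ {e} → s' e ≡ true → j e ≡ true
        s'j {e} p rewrite p with s e
        ... | true = refl
        ... | false = refl
        js : ∀ {e} → j e ≡ true → s e ≡ true ⊎ s' e ≡ true
        js {e} p with s e
        ... | true = inj₁ refl
        ... | false = inj₂ p
        J : Join xs (Both _≟V_ id id cB cS cS' BS BS' (length xs) (length E + 1)) (cl (sel j E))
        J = record { closed = λ _ _ → cls ; least = lst }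
          where
          cls : ∀ {z w} → cS z ≡ cS w ⊎ cS' z ≡ cS' w → cl (sel j E) z ≡ cl (sel j E) w
          cls (inj₁ e) = conn-cl (sel j E) (conn-⊆ (λ {e} q → let p , t = sel⁻ s E q in sel⁺ j E p (sj {e} t)) (cl-conn (sel s E) e))
          cls (inj₂ e) = conn-cl (sel j E) (conn-⊆ (λ {e} q → let p , t = sel⁻ s' E q in sel⁺ j E p (s'j {e} t)) (cl-conn (sel s' E) e))
          lst : ∀ (κ : V k → Bool) → (∀ {z w} → z ∈ xs → w ∈ xs → cS z ≡ cS w ⊎ cS' z ≡ cS' w → κ z ≡ κ w) → ∀ {z w} → z ∈ xs → w ∈ xs → cl (sel j E) z ≡ cl (sel j E) w → κ z ≡ κ w
          lst κ h _ _ e = conn-const κ edge (cl-conn (sel j E) e)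
            where
            edge : ∀ {a c} → (a , c) ∈ sel j E → κ a ≡ κ c
            edge {a} {c} q = go (js {a , c} (proj₂ (sel⁻ j E q)))
              where
              q∈ : (a , c) ∈ E
              q∈ = proj₁ (sel⁻ j E q)
              ok = All.lookup (edges-ok N) q∈
              go : s (a , c) ≡ true ⊎ s' (a , c) ≡ true → κ a ≡ κ c
              go (inj₁ t) = h (inxs (proj₁ ok)) (inxs (proj₁ (proj₂ ok))) (inj₁ (conn-cl (sel s E) (move (inj₁ (sel⁺ s E q∈ t)) stay)))
              go (inj₂ t) = h (inxs (proj₁ ok)) (inxs (proj₁ (proj₂ ok))) (inj₂ (conn-cl (sel s' E) (move (inj₁ (sel⁺ s' E q∈ t)) stay)))

      atLabels : Bd (map ι L)
      atLabels = forget-all _≟V_ id id cB cS cS' BS BS' (length xs) (length E + 1) us uxs start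

      col : X k → V k
      col x = cB (ι x)

      st₀ : State F F' φ φ' col
      st₀ = record { mod = m ; mod' = m' ; lab = λ {x} _ → vF (rep m') (lF' x) ; lab' = λ {x} _ → vF (rep m) (lF x)
        ; res = respects {S = S} {T} {F} sup i lF m PS ; res' = respects {S = S'} {T'} {F'} sup' i' lF' m' PS' ; agree = ag }
        where
        ag : ∀ {x y z w} → Conf φ (ι x) (ι y) (ι z) (ι w) → Conf φ' (ι x) (ι z) (ι y) (ι w) → col x ≡ col y → col x ≡ col z → col x ≡ col w → ⊥
        ag cf cf' p q t = let κ , le , e₁ , e₂ , n = cut-of {S = S} {T} {F} sup i lF m PS cf
                              κ' , le' , e₁' , e₂' , n' = cut-of {S = S'} {T'} {F'} sup' i' lF' m' PS' cf'
          in quadrants {S = S} {S'} PS PS' κ κ' le le' (cl-conn (sel b E) p) (cl-conn (sel b E) q) (cl-conn (sel b E) t) e₁ e₂ n e₁' e₂' n'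

      uL : Unique L
      uL = map⁻ (uniqueʳ us uxs)

      en₀ : Enum φ L
      en₀ = record { toL = λ {x} _ → ∈-labels (verts N) (lN x) ; fromL = λ {x} _ → vF (rep m) (lF x) ; uniqL = uL }

    sequence : (x₀ : X k) → ∃[ σ ] ∃[ w ] Seq F F' σ w × suc k ≤ length σ × w + length (verts N) ≤ length E + 1
    sequence x₀ =
      let γ , J = join-exists ι inj₁-injective L (λ z w → same? φ (ι z) (ι w) ⊎-dec same? φ' (ι z) (ι w))
          σ , w , sq , l , ineq = solve (suc (wt φ + wt φ')) st₀ ≤-refl L γ (∈-labels (verts N) (lN x₀)) en₀ J
          γ₀ , J₀ , ineq₀ = atLabels
      in σ , w , sq , ≤-trans sizeL l , final w γ J γ₀ J₀ ineq ineq₀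
      where
      sizeL : suc k ≤ length L
      sizeL = ≤-trans (≤-reflexive (sym (length-tabulate {n = suc k} id))) (≤-trans (cnt-inj ι (allFin (suc k)) (allFin⁺ (suc k)) inj₁-injective)
        (≤-trans (cnt-length ι (allFin (suc k)) (map ι L) (λ {x} _ → ∈-map⁺ ι (∈-labels (verts N) (lN x)))) (≤-reflexive (length-map ι L))))
      final : ∀ w γ → Join L (Linked φ φ') γ → ∀ γ₀ → Join (map ι L) (Both _≟V_ id id cB cS cS' BS BS' (length xs) (length E + 1)) γ₀
        → w + (length φ + length φ') ≤ cnt col L + cnt γ L
        → cnt cB (map ι L) + cnt γ₀ (map ι L) + length xs ≤ length E + 1 + cnt cS (map ι L) + cnt cS' (map ι L)
        → w + length (verts N) ≤ length E + 1
      final w γ J γ₀ J₀ ineq ineq₀ = +-cancelʳ-≤ (length φ + length φ') _ _ (begin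
          w + length (verts N) + (length φ + length φ') ≡⟨ ar w (length (verts N)) (length φ + length φ') ⟩
          w + (length φ + length φ') + length (verts N) ≤⟨ +-mono-≤ ineq (≤-reflexive (↭-length (sort-↭ (verts N)))) ⟩
          cnt col L + cnt γ L + length xs ≤⟨ +-monoˡ-≤ (length xs) (+-mono-≤ (≤-reflexive (sym (cnt-map cB L))) γγ₀) ⟩
          cnt cB (map ι L) + cnt γ₀ (map ι L) + length xs ≤⟨ ineq₀ ⟩
          length E + 1 + cnt cS (map ι L) + cnt cS' (map ι L) ≤⟨ +-mono-≤ (+-monoʳ-≤ (length E + 1) (≤-trans (≤-reflexive (cnt-map cS L)) (cnt-components {S = S} {T} {F} sup i lF m cS (const S subS) L)))
                (≤-trans (≤-reflexive (cnt-map cS' L)) (cnt-components {S = S'} {T'} {F'} sup' i' lF' m' cS' (const S' subS') L)) ⟩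
          length E + 1 + length φ + length φ' ≡⟨ +-assoc (length E + 1) (length φ) (length φ') ⟩
          length E + 1 + (length φ + length φ') ∎)
        where
        open ≤-Reasoning
        ar : ∀ a b c → a + b + c ≡ a + c + b
        ar = solve-∀
        δ : V k → V k
        δ (inj₁ x) = γ x
        δ (inj₂ n) = inj₂ n
        PSs : ∀ a c → (a , c) ∈ sel s E → Adj S a c
        PSs a c q = adjB-true {G = S} {a} {c} (proj₂ (sel⁻ s E q))
        PSs' : ∀ a c → (a , c) ∈ sel s' E → Adj S' a c
        PSs' a c q = adjB-true {G = S'} {a} {c} (proj₂ (sel⁻ s' E q))
        hδ : ∀ {z w} → z ∈ map ι L → w ∈ map ι L → cS z ≡ cS w ⊎ cS' z ≡ cS' w → δ z ≡ δ w
        hδ p q t with ∈-map⁻ ι p | ∈-map⁻ ι q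
        hδ p q (inj₁ t) | x , x∈ , refl | y , y∈ , refl = closed J x∈ y∈ (inj₁ (conn-same {S = S} {T} {F} sup i lF m PSs (cl-conn (sel s E) t)))
        hδ p q (inj₂ t) | x , x∈ , refl | y , y∈ , refl = closed J x∈ y∈ (inj₂ (conn-same {S = S'} {T'} {F'} sup' i' lF' m' PSs' (cl-conn (sel s' E) t)))
        γγ₀ : cnt γ L ≤ cnt γ₀ (map ι L)
        γγ₀ = ≤-trans (≤-reflexive (sym (cnt-map δ L))) (join-≤ J₀ δ hδ)

bound-ℤ : ∀ w v e → w + v ≤ e + 1 → ℤ.+ w ℤ.≤ ℤ.+ e ℤ.- (ℤ.+ v ℤ.- ℤ.+ 1)
bound-ℤ w v e p with m≤n⇒∃[o]m+o≡n p
... | d , q = subst (ℤ.+ w ℤ.≤_) (sym eq) (ℤ.+≤+ (m≤m+n w d))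
  where
  ar₁ : ∀ e v → e ℤ.- (v ℤ.- ℤ.+ 1) ≡ e ℤ.+ ℤ.+ 1 ℤ.- v
  ar₁ = ℤ.solve-∀
  ar₂ : ∀ w v d → w ℤ.+ v ℤ.+ d ℤ.- v ≡ w ℤ.+ d
  ar₂ = ℤ.solve-∀
  eq : ℤ.+ e ℤ.- (ℤ.+ v ℤ.- ℤ.+ 1) ≡ ℤ.+ (w + d)
  eq = trans (ar₁ (ℤ.+ e) (ℤ.+ v)) (trans (cong (λ n → ℤ.+ n ℤ.- ℤ.+ v) (sym q)) (ar₂ (ℤ.+ w) (ℤ.+ v) (ℤ.+ d)))

theorem6p1 : (k : ℕ) (N F F' : Graph k)
    → PhyloNetwork N → ForestOn F → ForestOn F'
    → Displays N F → Displays N F'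
    → ∃[ σ ] ∃[ w ] CherryPickingSeq F F' σ w × ℤ.+ w ℤ.≤ r N
theorem6p1 k N F F' (simp , con , lN , _) fo fo' (S , subS , acS , T , sup , i) (S' , subS' , acS' , T' , sup' , i') =
  let φ , m = forest-models fo
      φ' , m' = forest-models fo'
      σ , w , sq , l , p = sequence {N = N} {F} {F'} simp con lN {φ} {φ'} m m' (proj₁ (proj₂ fo)) (proj₁ (proj₂ fo')) {S} {S'} {T} {T'} subS acS sup i subS' sup' i' fz
  in σ , w , (l , sq) , bound-ℤ w (length (verts N)) (length (edges N)) p
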